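{- There is a polynomial-time algorithm that, given an undirected graph $G$ on $n$ nodes with nonnegative weights on its edges, and a positive integer $k\le n$, constructs a tree in $G$ spanning at least $k$ nodes of weight at most $2\sqrt{k}$ times that of a minimum-weight tree spanning any $k$ nodes.
   Context: The weight of a tree is the sum of the weights of its edges. "A minimum-weight tree spanning any $k$ nodes" means a tree (subgraph of $G$) of minimum weight among all trees in $G$ spanning $k$ nodes, over all choices of the $k$ nodes. -}

module Defs where

open import Data.Bool using (Bool; true; false; if_then_else_)
open import Data.Fin using (Fin; toℕ)
open import Data.Fin.Subset using (Subset; _∈_; ∣_∣; Nonempty)
open import Data.Integer using (+_)
import Data.Integer as ℤ
open import Data.List using (List; []; _∷_; [_]; _++_; length; tabulate)
import Data.List as List
open import Data.List.Relation.Unary.Linked using (Linked)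
open import Data.List.Relation.Unary.Unique.Propositional using (Unique)
open import Data.Nat using (ℕ; suc; _+_; _∸_; _*_; _^_; _≤_)
open import Data.Nat.Logarithm using (⌊log₂_⌋)
open import Data.Product using (Σ; ∃-syntax; _×_)
open import Data.Rational using (ℚ; 0ℚ; ↥_; ↧ₙ_)
import Data.Rational as ℚ
import Data.Rational.Properties as ℚₚ
open import Data.Sum using (_⊎_)
open import Data.Vec using (Vec; []; _∷_; lookup; toList)
open import Algebra.Properties.CommutativeMonoid.Sum ℚₚ.+-0-commutativeMonoid
  using (sum)
open import Relation.Binary.Construct.Closure.ReflexiveTransitive using (Star)
open import Relation.Binary.PropositionalEquality using (_≡_)
open import Relation.Nullary using (¬_)

------------------------------------------------------------------------
-- Weighted graphs

-- A finite simple undirected graph on the nodes Fin n.  The edges are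
-- numbered by Fin m.  An edge {u , v} is stored once, smaller endpoint
-- first, which rules out loops; `simple` rules out parallel edges.

record Graph (n : ℕ) : Set where
  field
    m       : ℕ
    src tgt : Fin m → Fin n
    weight  : Fin m → ℚ
    ordered : ∀ e → src e Data.Fin.< tgt e
    simple  : ∀ e f → src e ≡ src f → tgt e ≡ tgt f → e ≡ f
    nonneg  : ∀ e → 0ℚ ℚ.≤ weight e

  Joins : Fin m → Fin n → Fin n → Set
  Joins e u v = (src e ≡ u × tgt e ≡ v) ⊎ (src e ≡ v × tgt e ≡ u)

record Subgraph {n : ℕ} (G : Graph n) : Set where
  open Graph G
  field
    nodes  : Subset n
    edges  : Subset m
    closed : ∀ e → e ∈ edges → src e ∈ nodes × tgt e ∈ nodes

  Adj : Fin n → Fin n → Set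
  Adj u v = ∃[ e ] (e ∈ edges × Joins e u v)

  Connected : Set
  Connected = ∀ u v → u ∈ nodes → v ∈ nodes → Star Adj u v

  -- A cycle v, v₁, …, vᵣ, v with r ≥ 2 and v, v₁, …, vᵣ distinct.
  Cycle : Fin n → List (Fin n) → Set
  Cycle v vs = 2 ≤ length vs × Unique (v ∷ vs) × Linked Adj (v ∷ vs ++ [ v ])

  Acyclic : Set
  Acyclic = ∀ v vs → ¬ Cycle v vs

  IsTree : Set
  IsTree = Nonempty nodes × Connected × Acyclic

  totalWeight : ℚ
  totalWeight = sum (λ e → if lookup edges e then weight e else 0ℚ)

open Subgraph public using (nodes; edges; IsTree; totalWeight)

TreeSpanning : ∀ {n} {G : Graph n} → ℕ → Subgraph G → Set
TreeSpanning k T = IsTree T × ∣ nodes T ∣ ≡ k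

MinimumWeightTreeSpanning : ∀ {n} {G : Graph n} → ℕ → Subgraph G → Set
MinimumWeightTreeSpanning {G = G} k T =
  TreeSpanning k T ×
  (∀ (S : Subgraph G) → TreeSpanning k S → totalWeight T ℚ.≤ totalWeight S)

-- x ≤ c √k y for nonnegative x and y, with the irrational root removed by
-- squaring both sides.

infix 4 _≤[_√_]_

_≤[_√_]_ : ℚ → ℕ → ℕ → ℚ → Set
x ≤[ c √ k ] y = x ℚ.* x ℚ.≤ ((+ (c * c * k)) ℚ./ 1) ℚ.* (y ℚ.* y)

------------------------------------------------------------------------
-- A model of computation

-- Programs are written in an untyped first-order call-by-value language
-- with general recursion, whose values are trees with natural numbers at
-- the leaves.

data Value : Set where
  nat  : ℕ → Value
  pair : Value → Value → Value

bits : ℕ → ℕ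
bits x = suc ⌊log₂ x ⌋

size : Value → ℕ
size (nat x)    = bits x
size (pair a b) = suc (size a + size b)

data Op : Set where
  plus monus times : Op

⟦_⟧ : Op → ℕ → ℕ → ℕ
⟦ plus  ⟧ = _+_
⟦ monus ⟧ = _∸_
⟦ times ⟧ = _*_

-- Expressions with Γ variables in scope (de Bruijn indices) over a table of
-- F mutually recursive functions.

data Exp {F : ℕ} (arity : Fin F → ℕ) (Γ : ℕ) : Set where
  var  : Fin Γ → Exp arity Γ
  lit  : ℕ → Exp arity Γ
  op   : Op → Exp arity Γ → Exp arity Γ → Exp arity Γ
  pair : Exp arity Γ → Exp arity Γ → Exp arity Γ
  lett : Exp arity Γ → Exp arity (suc Γ) → Exp arity Γ
  -- branches: zero, positive number, pair (its first component is variable 0,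
  -- its second component is variable 1)
  case : Exp arity Γ → Exp arity Γ → Exp arity Γ → Exp arity (suc (suc Γ)) →
         Exp arity Γ
  call : (f : Fin F) → Vec (Exp arity Γ) (arity f) → Exp arity Γ

record Program : Set where
  field
    F     : ℕ
    arity : Fin F → ℕ
    body  : (f : Fin F) → Exp arity (arity f)
    main  : Exp arity 1

-- ρ ⊢ e ⇓ v [ t ]: in environment ρ, e evaluates to v in time t.  Arithmetic
-- is charged the bit length of its operands.  All other steps are charged 1:
-- values are immutable, so they can be passed around and put into pairs by
-- reference, without copying.  Arithmetic on a pair is stuck.

module Semantics (P : Program) where
  open Program P

  infix 4 _⊢_⇓_[_] _⊢*_⇓_[_]

  data _⊢_⇓_[_] {Γ : ℕ} (ρ : Vec Value Γ) :
         Exp arity Γ → Value → ℕ → Set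
  data _⊢*_⇓_[_] {Γ : ℕ} (ρ : Vec Value Γ) :
         ∀ {a} → Vec (Exp arity Γ) a → Vec Value a → ℕ → Set

  data _⊢_⇓_[_] {Γ} ρ where
    var : ∀ {x} → ρ ⊢ var x ⇓ lookup ρ x [ 1 ]
    lit : ∀ {x} → ρ ⊢ lit x ⇓ nat x [ 1 ]
    op  : ∀ {o e₁ e₂ x y t₁ t₂} →
          ρ ⊢ e₁ ⇓ nat x [ t₁ ] → ρ ⊢ e₂ ⇓ nat y [ t₂ ] →
          ρ ⊢ op o e₁ e₂ ⇓ nat (⟦ o ⟧ x y) [ bits x + bits y + (t₁ + t₂) ]
    pair : ∀ {e₁ e₂ v₁ v₂ t₁ t₂} →
           ρ ⊢ e₁ ⇓ v₁ [ t₁ ] → ρ ⊢ e₂ ⇓ v₂ [ t₂ ] →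
           ρ ⊢ pair e₁ e₂ ⇓ pair v₁ v₂ [ suc (t₁ + t₂) ]
    lett : ∀ {e₁ e₂ v₁ v₂ t₁ t₂} →
           ρ ⊢ e₁ ⇓ v₁ [ t₁ ] → (v₁ ∷ ρ) ⊢ e₂ ⇓ v₂ [ t₂ ] →
           ρ ⊢ lett e₁ e₂ ⇓ v₂ [ suc (t₁ + t₂) ]
    case-zero : ∀ {e e₀ e₁ e₂ v t₁ t₂} →
                ρ ⊢ e ⇓ nat 0 [ t₁ ] → ρ ⊢ e₀ ⇓ v [ t₂ ] →
                ρ ⊢ case e e₀ e₁ e₂ ⇓ v [ suc (t₁ + t₂) ]
    case-suc : ∀ {e e₀ e₁ e₂ x v t₁ t₂} →
               ρ ⊢ e ⇓ nat (suc x) [ t₁ ] → ρ ⊢ e₁ ⇓ v [ t₂ ] →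
               ρ ⊢ case e e₀ e₁ e₂ ⇓ v [ suc (t₁ + t₂) ]
    case-pair : ∀ {e e₀ e₁ e₂ a b v t₁ t₂} →
                ρ ⊢ e ⇓ pair a b [ t₁ ] → (a ∷ b ∷ ρ) ⊢ e₂ ⇓ v [ t₂ ] →
                ρ ⊢ case e e₀ e₁ e₂ ⇓ v [ suc (t₁ + t₂) ]
    call : ∀ {f es vs v t₁ t₂} →
           ρ ⊢* es ⇓ vs [ t₁ ] → vs ⊢ body f ⇓ v [ t₂ ] →
           ρ ⊢ call f es ⇓ v [ suc (t₁ + t₂) ]

  data _⊢*_⇓_[_] {Γ} ρ where
    []  : ρ ⊢* [] ⇓ [] [ 0 ]
    _∷_ : ∀ {a e v t₁ t₂} {es : Vec (Exp arity Γ) a} {vs : Vec Value a} →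
          ρ ⊢ e ⇓ v [ t₁ ] → ρ ⊢* es ⇓ vs [ t₂ ] →
          ρ ⊢* (e ∷ es) ⇓ (v ∷ vs) [ t₁ + t₂ ]

Runs : Program → Value → Value → ℕ → Set
Runs P input output t =
  Semantics._⊢_⇓_[_] P (input ∷ []) (Program.main P) output t

-- One program halts on every encoded instance with a correct output, within
-- time polynomial in the size of the encoding.  The size of the output is
-- counted as well, since sharing could otherwise hide the cost of writing it.

PolynomialTimeSolvable : {I : Set} → (I → Value) → (I → Value → Set) → Set
PolynomialTimeSolvable {I} encode Correct =
  Σ Program λ P → Σ ℕ λ c → Σ ℕ λ d → (x : I) →
    Σ Value λ output → Σ ℕ λ t →
      Runs P (encode x) output t ×
      t + size output ≤ c * size (encode x) ^ d ×
      Correct x output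

------------------------------------------------------------------------
-- Encodings

encodeList : List Value → Value
encodeList []       = nat 0
encodeList (v ∷ vs) = pair v (encodeList vs)

-- Only applied to nonnegative rationals.
encodeℚ : ℚ → Value
encodeℚ q = pair (nat ℤ.∣ ↥ q ∣) (nat (↧ₙ q))

-- The nodes are listed explicitly, so that the size is at least n even when
-- there are few edges.
encodeGraph : ∀ {n} → Graph n → Value
encodeGraph {n} G =
  pair (encodeList (tabulate {n = n} (λ v → nat (toℕ v))))
       (encodeList (tabulate (λ e →
         pair (pair (nat (toℕ (src e))) (nat (toℕ (tgt e))))
              (encodeℚ (weight e)))))
  where open Graph G

encodeBool : Bool → Value
encodeBool false = nat 0
encodeBool true  = nat 1

encodeSubset : ∀ {n} → Subset n → Value
encodeSubset p = encodeList (List.map encodeBool (toList p))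

encodeSubgraph : ∀ {n} {G : Graph n} → Subgraph G → Value
encodeSubgraph T = pair (encodeSubset (nodes T)) (encodeSubset (edges T))

record Instance : Set where
  field
    n   : ℕ
    G   : Graph n
    k   : ℕ
    1≤k : 1 ≤ k
    k≤n : k ≤ n

encodeInstance : Instance → Value
encodeInstance x = pair (nat k) (encodeGraph G)
  where open Instance x

module Submission where

open import Defs
open import Data.Bool using (Bool; true; false; if_then_else_; _∧_; _∨_; not; _xor_)
import Data.Bool as Bool
open import Data.Fin using (Fin; zero; suc; toℕ; fromℕ<; _↑ˡ_; _↑ʳ_; splitAt)
import Data.Fin as Fin
open import Data.Fin.Properties using (splitAt-↑ˡ; splitAt-↑ʳ; toℕ<n; toℕ-fromℕ<; toℕ-injective; any?)
open import Data.Fin.Subset using (Subset; ∣_∣)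
import Data.Fin.Subset as Subset
import Data.Integer as ℤ
import Data.Integer.Properties as ℤₚ
open import Data.List using (List; []; _∷_; _++_; [_]; length; map; foldr; allFin; tabulate)
open import Data.List.Membership.DecPropositional using (_∈?_)
open import Data.List.Membership.Propositional using (_∈_)
open import Data.List.Membership.Propositional.Properties using (∈-allFin; ∈-map⁻; ∈-map⁺)
open import Data.List.Properties using (foldr-map; length-map; length-tabulate; map-id; map-∘; map-tabulate)
open import Data.List.Relation.Unary.All using (All; []; _∷_)
import Data.List.Relation.Unary.All as All
open import Data.List.Relation.Unary.AllPairs using ([]; _∷_)
open import Data.List.Relation.Unary.Any using (here; there)
open import Data.List.Relation.Unary.Linked using (Linked; []; [-]; _∷_)
import Data.List.Relation.Unary.Linked as Linked
open import Data.List.Relation.Unary.Unique.Propositional using (Unique)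
open import Data.List.Relation.Unary.Unique.Propositional.Properties using (allFin⁺)
open import Data.Nat using (ℕ; zero; suc; _+_; _*_; _∸_; _^_; _≤_; _<_; z≤n; s≤s; _⊓_; ⌊_/2⌋; NonZero; >-nonZero; >-nonZero⁻¹; _<ᵇ_; _≡ᵇ_)
open import Data.Nat.Induction using (<-rec)
open import Data.Nat.Logarithm using (⌊log₂_⌋; ⌊log₂⌋-mono-≤; ⌊log₂⌊n/2⌋⌋≡⌊log₂n⌋∸1)
open import Data.Nat.Properties
open import Data.Nat.Tactic.RingSolver using (solve-∀)
open import Data.Product using (Σ; _×_; _,_; proj₁; proj₂)
open import Data.Rational using (ℚ; mkℚ; 0ℚ; ↥_; ↧ₙ_; toℚᵘ; Positive)
import Data.Rational as ℚ
import Data.Rational.Properties as ℚₚ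
open import Data.Rational.Unnormalised using (mkℚᵘ; _≃_; *≡*; *≤*)
import Data.Rational.Unnormalised as ℚᵘ
import Data.Rational.Unnormalised.Properties as ℚᵘₚ
open import Data.Sum using (_⊎_; inj₁; inj₂; [_,_]′)
open import Data.Unit using (⊤; tt)
open import Data.Vec using (Vec; []; _∷_)
import Data.Vec as Vec
open import Data.Vec.Properties using (lookup∘tabulate; lookup⇒[]=; []=⇒lookup)
open import Algebra.Properties.CommutativeMonoid.Sum ℚₚ.+-0-commutativeMonoid using (sum)
open import Algebra.Properties.CommutativeSemigroup using (interchange)
open import Function using (_∘_; id)
open import Relation.Binary.Construct.Closure.ReflexiveTransitive using (Star; ε; _◅_; _◅◅_; gmap; reverse)
open import Relation.Binary.PropositionalEquality hiding ([_])
open import Relation.Nullary using (contradiction; yes; no; ¬_)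

-- Cut the edges of an optimal tree T* of weight L that are heavier than δ.
-- With h = ⌊√k⌋ there is a threshold δ, either 0 or an edge weight, such that
-- at most h edges are cut and (h + 1) δ ≤ L.  A tree is grown from a root r in
-- T*: it is saturated with edges of weight at most δ until it has k nodes,
-- and then enlarged greedily by a path from r of weight at most D, the largest
-- distance from r to a node of T*, and saturated again, so that the number of
-- nodes becomes as large as possible.  By an exchange argument each
-- enlargement makes up for one of the at most h pieces of T* not containing r,
-- so h enlargements reach k nodes, at cost at most h D + k δ ≤ 2 √k L.  The
-- algorithm tries all r, D and δ.
--
-- Polynomial time is shown compositionally: programs are built from
-- combinators that carry a polynomial bound on the running time, and every
-- loop keeps its state in a type whose encodings have polynomial size.

-- Combinators and their compilation

-- The obstacle is that neither T* nor its pieces are known, and that a cheap path may run through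
-- foreign nodes. Saturation repairs this: a node set that no light edge leaves contains each piece
-- entirely or not at all. Short of k nodes, an enlargement thus either swallows a listed piece or,
-- meeting none, has at least as many nodes as the path to a listed piece would have brought. What
-- never drops below k is the number of nodes in the tree or in a piece still listed. A path is not
-- glued to the tree, as this could close a cycle. Its edges are only permitted, and the tree still
-- grows leaf by leaf. All that is asked of a path is that every node set closed under its edges and
-- containing r contains its end, so the analysis phrases connectivity by cuts. The threshold δ is
-- lowered until it is 0 or a further step would leave more than h heavier edges; in the latter case
-- h + 1 edges weigh at least δ. The machine has no division, so weights are first multiplied by the
-- product of all denominators. No square root is computed either: h occurs in the analysis only,
-- while the loops make n rounds.

infixr 5 _⨾_

-- Every code has one input and no variables, and its only recursion is the fold along a list.
-- Termination and running time can thus be bounded code by code.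
data Code : Set where
  idᶜ fstᶜ sndᶜ : Code
  _⨾_ pairᶜ ifᶜ : Code → Code → Code
  litᶜ  : ℕ → Code
  opᶜ   : Op → Code
  foldᶜ : Code → Code

loops : Code → ℕ
loops (c ⨾ d)     = loops c + loops d
loops (pairᶜ c d) = loops c + loops d
loops (ifᶜ c d)   = loops c + loops d
loops (foldᶜ c)   = suc (loops c)
loops _           = 0

Exp₃ : ℕ → ℕ → Set
Exp₃ F = Exp {F} (λ _ → 3)

v₀ : ∀ {F Γ} → Exp₃ F (suc Γ)
v₀ = var zero
v₁ : ∀ {F Γ} → Exp₃ F (suc (suc Γ))
v₁ = var (suc zero)
v₂ : ∀ {F Γ} → Exp₃ F (suc (suc (suc Γ)))
v₂ = var (suc (suc zero))
v₃ : ∀ {F Γ} → Exp₃ F (suc (suc (suc (suc Γ))))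
v₃ = var (suc (suc (suc zero)))

-- The input of a code is variable 0.
compile : ∀ {F Γ} (c : Code) → (Fin (loops c) → Fin F) → Exp₃ F (suc Γ)
compile idᶜ         ι = v₀
compile fstᶜ        ι = case v₀ (lit 0) (lit 0) v₀
compile sndᶜ        ι = case v₀ (lit 0) (lit 0) v₁
compile (c ⨾ d)     ι = lett (compile c (ι ∘ (_↑ˡ loops d))) (compile d (ι ∘ (loops c ↑ʳ_)))
compile (pairᶜ c d) ι = pair (compile c (ι ∘ (_↑ˡ loops d))) (compile d (ι ∘ (loops c ↑ʳ_)))
-- The `lett` makes the second component variable 0, where the chosen branch expects its input. The
-- literals `lit 0` answer malformed inputs.
compile (ifᶜ c d)   ι = case v₀ (lit 0) (lit 0)
  (case v₀ (lett v₁ (compile d (ι ∘ (loops c ↑ʳ_)))) (lett v₁ (compile c (ι ∘ (_↑ˡ loops d)))) (lit 0))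
compile (litᶜ x)    ι = lit x
compile (opᶜ o)     ι = case v₀ (lit 0) (lit 0) (op o v₀ v₁)
compile (foldᶜ c)   ι = case v₀ (lit 0) (lit 0)
  (case v₁ (lit 0) (lit 0) (call (ι zero) (v₂ ∷ v₀ ∷ v₁ ∷ [])))

-- A loop takes an environment, the value for the empty list, and the list.
loopBody : ∀ {F} (c : Code) → (Fin (suc (loops c)) → Fin F) → Exp₃ F 3
loopBody c ι = case v₂ v₁ v₁
  -- The tail is folded first, and `c` receives the environment with the head and the result for the
  -- tail: the loop is a right fold.
  (lett (pair (pair v₂ v₀) (call (ι zero) (v₂ ∷ v₃ ∷ v₁ ∷ []))) (compile c (ι ∘ suc)))

bodies : ∀ {F} (c : Code) → (Fin (loops c) → Fin F) → Fin (loops c) → Exp₃ F 3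
bodies (c ⨾ d)     ι i       = [ bodies c (ι ∘ (_↑ˡ loops d)) , bodies d (ι ∘ (loops c ↑ʳ_)) ]′ (splitAt (loops c) i)
bodies (pairᶜ c d) ι i       = [ bodies c (ι ∘ (_↑ˡ loops d)) , bodies d (ι ∘ (loops c ↑ʳ_)) ]′ (splitAt (loops c) i)
bodies (ifᶜ c d)   ι i       = [ bodies c (ι ∘ (_↑ˡ loops d)) , bodies d (ι ∘ (loops c ↑ʳ_)) ]′ (splitAt (loops c) i)
bodies (foldᶜ c)   ι zero    = loopBody c ι
bodies (foldᶜ c)   ι (suc i) = bodies c (ι ∘ suc) i

programOf : ∀ {F} → (Fin F → Exp₃ F 3) → Exp₃ F 1 → Program
programOf {F} body main = record { F = F ; arity = λ _ → 3 ; body = body ; main = main }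

program : Code → Program
program c = programOf (bodies c id) (compile c id)

-- Quantifying over the function table, over the place `ι` of the loops in it and over the rest of
-- the environment makes the notion composable: a code runs alike as part of any larger program and
-- under any binders.
record Computes (c : Code) (v w : Value) (b : ℕ) : Set where
  constructor computes
  field
    execute : ∀ {F} (body : Fin F → Exp₃ F 3) (main : Exp₃ F 1) (ι : Fin (loops c) → Fin F) →
          (∀ i → body (ι i) ≡ bodies c ι i) → ∀ {Γ} {ρ : Vec Value Γ} →
          let open Semantics (programOf body main) in
          Σ ℕ λ t → (v ∷ ρ) ⊢ compile c ι ⇓ w [ t ] × t ≤ b

open Computes

computes-program : ∀ {c v w b} → Computes c v w b → Σ ℕ λ t → Runs (program c) v w t × t ≤ b
computes-program {c} C = execute C (bodies c id) (compile c id) id (λ _ → refl)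

weaken : ∀ {c v w b b′} → b ≤ b′ → Computes c v w b → Computes c v w b′
weaken b≤b′ C .execute body main ι H with execute C body main ι H
... | t , d , t≤b = t , d , ≤-trans t≤b b≤b′

module _ {c d : Code} where
  private
    left : ∀ {A : Set} (f : Fin (loops c) → A) (g : Fin (loops d) → A) i →
           [ f , g ]′ (splitAt (loops c) (i ↑ˡ loops d)) ≡ f i
    left f g i rewrite splitAt-↑ˡ (loops c) i (loops d) = refl

    right : ∀ {A : Set} (f : Fin (loops c) → A) (g : Fin (loops d) → A) i →
            [ f , g ]′ (splitAt (loops c) (loops c ↑ʳ i)) ≡ g i
    right f g i rewrite splitAt-↑ʳ (loops c) (loops d) i = refl

  ⨾-computes : ∀ {u v w a b} → Computes c u v a → Computes d v w b → Computes (c ⨾ d) u w (suc (a + b))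
  ⨾-computes C D .execute body main ι H =
    let s , p , s≤ = execute C body main _ (λ i → trans (H _) (left _ _ i))
        t , q , t≤ = execute D body main _ (λ i → trans (H _) (right _ _ i))
    in _ , Semantics.lett p q , s≤s (+-mono-≤ s≤ t≤)

  pair-computes : ∀ {u v w a b} → Computes c u v a → Computes d u w b →
                  Computes (pairᶜ c d) u (pair v w) (suc (a + b))
  pair-computes C D .execute body main ι H =
    let s , p , s≤ = execute C body main _ (λ i → trans (H _) (left _ _ i))
        t , q , t≤ = execute D body main _ (λ i → trans (H _) (right _ _ i))
    in _ , Semantics.pair p q , s≤s (+-mono-≤ s≤ t≤)

  if-true-computes : ∀ {x u v b} → Computes c u v b → Computes (ifᶜ c d) (pair (nat (suc x)) u) v (6 + b)
  if-true-computes C .execute body main ι H =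
    let t , p , t≤ = execute C body main _ (λ i → trans (H _) (left _ _ i))
    in _ , Semantics.case-pair Semantics.var
             (Semantics.case-suc Semantics.var (Semantics.lett Semantics.var p))
         , +-monoʳ-≤ 6 t≤

  if-false-computes : ∀ {u v b} → Computes d u v b → Computes (ifᶜ c d) (pair (nat 0) u) v (6 + b)
  if-false-computes D .execute body main ι H =
    let t , p , t≤ = execute D body main _ (λ i → trans (H _) (right _ _ i))
    in _ , Semantics.case-pair Semantics.var
             (Semantics.case-zero Semantics.var (Semantics.lett Semantics.var p))
         , +-monoʳ-≤ 6 t≤

id-computes : ∀ {v} → Computes idᶜ v v 1
id-computes .execute _ _ _ _ = 1 , Semantics.var , ≤-refl

fst-computes : ∀ {v w} → Computes fstᶜ (pair v w) v 3
fst-computes .execute _ _ _ _ = 3 , Semantics.case-pair Semantics.var Semantics.var , ≤-refl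

snd-computes : ∀ {v w} → Computes sndᶜ (pair v w) w 3
snd-computes .execute _ _ _ _ = 3 , Semantics.case-pair Semantics.var Semantics.var , ≤-refl

lit-computes : ∀ {x v} → Computes (litᶜ x) v (nat x) 1
lit-computes .execute _ _ _ _ = 1 , Semantics.lit , ≤-refl

op-computes : ∀ {o x y} → Computes (opᶜ o) (pair (nat x) (nat y)) (nat (⟦ o ⟧ x y)) (bits x + bits y + 4)
op-computes {x = x} {y} .execute _ _ _ _ =
  _ , Semantics.case-pair Semantics.var (Semantics.op Semantics.var Semantics.var)
    , ≤-reflexive (trans (cong suc (sym (+-suc (bits x + bits y) 2))) (sym (+-suc (bits x + bits y) 3)))

data _IsTailOf_ {A : Set} (ys : List A) : List A → Set where
  here  : ys IsTailOf ys
  there : ∀ {x xs} → ys IsTailOf xs → ys IsTailOf (x ∷ xs)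

module _ {A : Set} (enc : A → Value) (state : List A → Value) {c : Code} {env : Value} {b : ℕ} where

  -- The step is assumed only at tails of `xs`, because the size of the accumulator, and with it the
  -- cost of a step, is controlled only there. A turn costs 11 besides the body, entering the loop
  -- 8, the empty list 3.
  fold-computes : (xs : List A) →
    (∀ x ys → (x ∷ ys) IsTailOf xs → Computes c (pair (pair env (enc x)) (state ys)) (state (x ∷ ys)) b) →
    Computes (foldᶜ c) (pair env (pair (state []) (encodeList (map enc xs)))) (state xs) (length xs * (11 + b) + 11)
  fold-computes xs step .execute body main ι H {ρ = ρ} =
    let t , d , t≤ = loop xs step
    in _ , Semantics.case-pair Semantics.var (Semantics.case-pair Semantics.var
             (Semantics.call (Semantics.var Semantics.∷ (Semantics.var Semantics.∷ (Semantics.var Semantics.∷ Semantics.[]))) d))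
         , ≤-trans (+-monoʳ-≤ 8 t≤) (≤-reflexive (trans (+-comm 8 _) (+-assoc _ 3 8)))
    where
    open Semantics (programOf body main)

    loop : (zs : List A) →
      (∀ x ys → (x ∷ ys) IsTailOf zs → Computes c (pair (pair env (enc x)) (state ys)) (state (x ∷ ys)) b) →
      Σ ℕ λ t → (env ∷ state [] ∷ encodeList (map enc zs) ∷ []) ⊢ body (ι zero) ⇓ state zs [ t ] ×
                t ≤ length zs * (11 + b) + 3
    loop [] _ = 3 , subst (λ e → _ ⊢ e ⇓ _ [ 3 ]) (sym (H zero)) (Semantics.case-zero Semantics.var Semantics.var) , ≤-refl
    loop (z ∷ zs) st =
      let s , d , s≤ = loop zs (λ x ys p → st x ys (there p))
          t , q , t≤ = execute (st z zs here) body main (ι ∘ suc) (H ∘ suc)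
      in 11 + (s + t) , subst (λ e → _ ⊢ e ⇓ _ [ 11 + (s + t) ]) (sym (H zero))
               (Semantics.case-pair Semantics.var (Semantics.lett (Semantics.pair (Semantics.pair Semantics.var Semantics.var)
                  (Semantics.call (Semantics.var Semantics.∷ (Semantics.var Semantics.∷ (Semantics.var Semantics.∷ Semantics.[]))) d)) q))
           , (begin
               11 + (s + t)                          ≤⟨ +-monoʳ-≤ 11 (+-mono-≤ s≤ t≤) ⟩
               11 + (length zs * (11 + b) + 3 + b)   ≡⟨ cong (11 +_) (+-comm _ b) ⟩
               11 + (b + (length zs * (11 + b) + 3)) ≡⟨ cong (11 +_) (sym (+-assoc b _ 3)) ⟩
               11 + b + length zs * (11 + b) + 3     ∎)
      where open ≤-Reasoning

-- Polynomially bounded computations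

n<2^bits : ∀ n → n < 2 ^ bits n
n<2^bits = <-rec _ step
  where
  step : ∀ n → (∀ {m} → m < n → m < 2 ^ bits m) → n < 2 ^ bits n
  step 0 _ = s≤s z≤n
  step 1 _ = ≤-refl
  step n@(suc n′@(suc n″)) rec = begin-strict
    n                           <⟨ halves n ⟩
    2 * suc ⌊ n /2⌋             ≤⟨ *-monoʳ-≤ 2 (rec (⌊n/2⌋<n n′)) ⟩
    2 * 2 ^ bits ⌊ n /2⌋        ≡⟨ cong (λ b → 2 * 2 ^ suc b) (⌊log₂⌊n/2⌋⌋≡⌊log₂n⌋∸1 n) ⟩
    2 ^ bits n                  ∎
    where
    open ≤-Reasoning
    halves : ∀ n → n < 2 * suc ⌊ n /2⌋
    halves 0 = s≤s z≤n
    halves 1 = s≤s (s≤s z≤n)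
    halves (suc (suc n)) = ≤-trans (s≤s (s≤s (halves n))) (≤-reflexive (cong suc (sym (+-suc (suc ⌊ n /2⌋) _))))

⌊n/2⌋-< : ∀ n x → n < x + x → ⌊ n /2⌋ < x
⌊n/2⌋-< n             zero    ()
⌊n/2⌋-< 0             (suc x) _ = s≤s z≤n
⌊n/2⌋-< 1             (suc x) _ = s≤s z≤n
⌊n/2⌋-< (suc (suc n)) (suc x) (s≤s p) = s≤s (⌊n/2⌋-< n x (≤-pred (≤-trans p (≤-reflexive (+-suc x x)))))

-- `bits 0` is 1, hence the demand that `b` be positive.
n<2^b⇒bits≤b : ∀ {n} b → 1 ≤ b → n < 2 ^ b → bits n ≤ b
n<2^b⇒bits≤b {n} (suc b) _ p = s≤s (log b n p)
  where
  log : ∀ b n → n < 2 ^ suc b → ⌊log₂ n ⌋ ≤ b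
  log zero    0 _ = z≤n
  log zero    1 _ = z≤n
  log zero    (suc (suc n)) (s≤s (s≤s ()))
  log (suc b) n p = ≤-trans (m≤n+m∸n ⌊log₂ n ⌋ 1) (s≤s (≤-trans (≤-reflexive (sym (⌊log₂⌊n/2⌋⌋≡⌊log₂n⌋∸1 n)))
    (log b ⌊ n /2⌋ (⌊n/2⌋-< n (2 ^ suc b) (≤-trans p (≤-reflexive (cong (2 ^ suc b +_) (+-identityʳ _))))))))

bits-* : ∀ m n → bits (m * n) ≤ bits m + bits n
bits-* m n = n<2^b⇒bits≤b (bits m + bits n) (s≤s z≤n) (begin-strict
  m * n                     <⟨ *-mono-< (n<2^bits m) (n<2^bits n) ⟩
  2 ^ bits m * 2 ^ bits n   ≡⟨ ^-distribˡ-+-* 2 (bits m) (bits n) ⟨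
  2 ^ (bits m + bits n)     ∎)
  where open ≤-Reasoning

-- Both powers of two are at least 2, so their sum is at most their product. The crude additive
-- bound lets all three operations share one cost formula.
bits-+ : ∀ m n → bits (m + n) ≤ bits m + bits n
bits-+ m n = n<2^b⇒bits≤b (bits m + bits n) (s≤s z≤n) (begin-strict
  m + n                     <⟨ +-mono-< (n<2^bits m) (n<2^bits n) ⟩
  2 ^ bits m + 2 ^ bits n   ≤⟨ sum≤product (2≤2^bits m) (2≤2^bits n) ⟩
  2 ^ bits m * 2 ^ bits n   ≡⟨ ^-distribˡ-+-* 2 (bits m) (bits n) ⟨
  2 ^ (bits m + bits n)     ∎)
  where
  open ≤-Reasoning
  2≤2^bits : ∀ n → 2 ≤ 2 ^ bits n
  2≤2^bits n = ^-monoʳ-≤ 2 {1} {bits n} (s≤s z≤n)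
  sum≤product : ∀ {x y} → 2 ≤ x → 2 ≤ y → x + y ≤ x * y
  sum≤product {x} {y} 2≤x 2≤y with ≤-total x y
  ... | inj₁ x≤y = ≤-trans (+-monoˡ-≤ y x≤y) (≤-trans (≤-reflexive (cong (y +_) (sym (+-identityʳ y)))) (*-monoˡ-≤ y 2≤x))
  ... | inj₂ y≤x = ≤-trans (+-monoʳ-≤ x y≤x) (≤-trans (≤-reflexive (cong (x +_) (sym (+-identityʳ x)))) (≤-trans (*-monoˡ-≤ x 2≤y) (≤-reflexive (*-comm y x))))

bits-mono : ∀ {m n} → m ≤ n → bits m ≤ bits n
bits-mono p = s≤s (⌊log₂⌋-mono-≤ p)

bits≤suc : ∀ n → bits n ≤ suc n
bits≤suc n = n<2^b⇒bits≤b (suc n) (s≤s z≤n) (<-trans (n<1+n n) (suc<2^ n))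
  where
  suc<2^ : ∀ n → suc n < 2 ^ suc n
  suc<2^ zero    = ≤-refl
  suc<2^ (suc n) = <-≤-trans (s≤s (suc<2^ n)) (≤-trans (+-monoˡ-≤ (2 ^ suc n) (>-nonZero⁻¹ (2 ^ suc n) {{m^n≢0 2 (suc n)}})) (≤-reflexive (cong (2 ^ suc n +_) (sym (+-identityʳ _)))))

bits-⟦⟧ : ∀ o m n → bits (⟦ o ⟧ m n) ≤ bits m + bits n
bits-⟦⟧ plus  m n = bits-+ m n
bits-⟦⟧ monus m n = ≤-trans (bits-mono (m∸n≤m m n)) (m≤m+n _ _)
bits-⟦⟧ times m n = bits-* m n

1≤size : ∀ v → 1 ≤ size v
1≤size (nat x)    = s≤s z≤n
1≤size (pair v w) = s≤s z≤n

length≤size : ∀ vs → length vs ≤ size (encodeList vs)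
length≤size []       = z≤n
length≤size (v ∷ vs) = s≤s (≤-trans (length≤size vs) (m≤n+m _ _))

size-encodeList : ∀ {A : Set} (enc : A → Value) {b} (xs : List A) → (∀ x → size (enc x) ≤ b) →
                  size (encodeList (map enc xs)) ≤ length xs * suc b + 1
size-encodeList enc []       h = ≤-refl
size-encodeList enc {b} (x ∷ xs) h = ≤-trans (s≤s (+-mono-≤ (h x) (size-encodeList enc xs h))) (≤-reflexive (sym (+-assoc (suc b) _ 1)))

length-tail : ∀ {A : Set} {ys xs : List A} → ys IsTailOf xs → length ys ≤ length xs
length-tail here      = ≤-refl
length-tail (there t) = m≤n⇒m≤1+n (length-tail t)

-- Polynomial-time maps between encoded types

module PolynomialTime {I : Set} (N : I → ℕ) (1≤N : ∀ x → 1 ≤ N x) where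

  -- A single monomial is enough: `N` is at least 1, so smaller exponents can be raised to a common
  -- one.
  record Poly (f : I → ℕ) : Set where
    constructor poly
    field
      coefficient degree : ℕ
      bound : ∀ x → f x ≤ coefficient * N x ^ degree

  open Poly public

  poly-≤ : ∀ {f g} → (∀ x → f x ≤ g x) → Poly g → Poly f
  poly-≤ f≤g (poly c d p) = poly c d (λ x → ≤-trans (f≤g x) (p x))

  poly-const : ∀ k → Poly (λ _ → k)
  poly-const k = poly k 0 (λ x → ≤-reflexive (sym (*-identityʳ k)))

  poly-N : Poly N
  poly-N = poly 1 1 (λ x → ≤-reflexive (sym (trans (*-identityˡ _) (*-identityʳ (N x)))))

  private
    N^-mono : ∀ x {d d′} → d ≤ d′ → N x ^ d ≤ N x ^ d′
    N^-mono x p = ^-monoʳ-≤ (N x) {{>-nonZero (1≤N x)}} p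

  poly-+ : ∀ {f g} → Poly f → Poly g → Poly (λ x → f x + g x)
  poly-+ (poly c d p) (poly c′ d′ p′) = poly (c + c′) (d + d′) λ x → ≤-trans
    (+-mono-≤ (≤-trans (p x) (*-monoʳ-≤ c (N^-mono x (m≤m+n d d′)))) (≤-trans (p′ x) (*-monoʳ-≤ c′ (N^-mono x (m≤n+m d′ d)))))
    (≤-reflexive (sym (*-distribʳ-+ (N x ^ (d + d′)) c c′)))

  poly-* : ∀ {f g} → Poly f → Poly g → Poly (λ x → f x * g x)
  poly-* (poly c d p) (poly c′ d′ p′) = poly (c * c′) (d + d′) λ x → ≤-trans (*-mono-≤ (p x) (p′ x))
    (≤-reflexive (trans ([m*n]*[o*p]≡[m*o]*[n*p] c _ c′ _) (cong (c * c′ *_) (sym (^-distribˡ-+-* (N x) d d′)))))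

  -- Types depend on the instance, whose nodes and edges are the elements of `Fin n` and `Fin m`.
  record Ty : Set₁ where
    no-eta-equality
    field
      El  : I → Set
      enc : ∀ x → El x → Value

  -- A type all of whose encodings are polynomially small, as is demanded of inputs. The type `natᵗ`
  -- has no such bound.
  record Ob : Set₁ where
    no-eta-equality
    field
      ty       : Ty
      sz       : I → ℕ
      sz-poly  : Poly sz
      size-enc : ∀ x a → size (Ty.enc ty x a) ≤ sz x
    open Ty ty public

  open Ty using (enc) renaming (El to ⟨_⟩)
  open Ob using (ty; sz; sz-poly; size-enc)

  -- One `cost` bounds both the running time and the size of the result, in terms of the instance
  -- rather than of the argument. Hence costs simply add under composition.
  record Hom (A : Ob) (B : Ty) (f : ∀ x → Ob.El A x → Ty.El B x) : Set where
    field
      code : Code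
      cost : I → ℕ
      cost-poly : Poly cost
      run : ∀ x a → Computes code (Ob.enc A x a) (Ty.enc B x (f x a)) (cost x)
      small : ∀ x a → size (Ty.enc B x (f x a)) ≤ cost x

  open Hom public

  infixr 6 _×ᵗ_
  infixl 6 _⊗_

  natᵗ : Ty
  ⟨ natᵗ ⟩ _   = ℕ
  enc natᵗ _ n = nat n

  boolᵗ : Ty
  ⟨ boolᵗ ⟩ _   = Bool
  enc boolᵗ _ b = encodeBool b

  _×ᵗ_ : Ty → Ty → Ty
  ⟨ A ×ᵗ B ⟩ x   = ⟨ A ⟩ x × ⟨ B ⟩ x
  enc (A ×ᵗ B) x p = pair (enc A x (proj₁ p)) (enc B x (proj₂ p))

  listᵗ : Ty → Ty
  ⟨ listᵗ A ⟩ x    = List (⟨ A ⟩ x)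
  enc (listᵗ A) x as = encodeList (map (enc A x) as)

  boolᵒ : Ob
  ty boolᵒ = boolᵗ
  sz boolᵒ _ = 1
  sz-poly boolᵒ = poly-const 1
  size-enc boolᵒ _ false = ≤-refl
  size-enc boolᵒ _ true  = ≤-refl

  _⊗_ : Ob → Ob → Ob
  ty (A ⊗ B) = ty A ×ᵗ ty B
  sz (A ⊗ B) x = 1 + (sz A x + sz B x)
  sz-poly (A ⊗ B) = poly-+ (poly-const 1) (poly-+ (sz-poly A) (sz-poly B))
  size-enc (A ⊗ B) x p = s≤s (+-mono-≤ (size-enc A x (proj₁ p)) (size-enc B x (proj₂ p)))

  -- The bound leaves no trace in the encoding, so values of any type can serve as inputs once they
  -- are known to stay small.
  _≤ᵗ_ : Ty → (I → ℕ) → Ty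
  ⟨ S ≤ᵗ p ⟩ x     = Σ (⟨ S ⟩ x) λ s → size (enc S x s) ≤ p x
  enc (S ≤ᵗ p) x s = enc S x (proj₁ s)

  upTo : (S : Ty) (p : I → ℕ) → Poly p → Ob
  ty (upTo S p P) = S ≤ᵗ p
  sz (upTo S p P) = p
  sz-poly (upTo S p P) = P
  size-enc (upTo S p P) x s = proj₂ s

  module _ {A : Ob} where

    infixr 5 _∙_ _,ʰ_ _∷ʰ_

    -- Types with equal encodings share their programs, so a change of view is free. This is how
    -- edges, sets, tables and the global data are opened and closed.
    recode : ∀ {B C f g} → (∀ x a → enc B x (f x a) ≡ enc C x (g x a)) → Hom A B f → Hom A C g
    recode e F = record
      { code = code F ; cost = cost F ; cost-poly = cost-poly F
      ; run = λ x a → subst (λ v → Computes (code F) _ v _) (e x a) (run F x a)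
      ; small = λ x a → subst (λ v → size v ≤ _) (e x a) (small F x a) }

    ext : ∀ {B f g} → (∀ x a → f x a ≡ g x a) → Hom A B f → Hom A B g
    ext {B} e = recode (λ x a → cong (enc B x) (e x a))

    idʰ : Hom A (ty A) (λ x a → a)
    idʰ = record { code = idᶜ ; cost = λ x → 1 + sz A x ; cost-poly = poly-+ (poly-const 1) (sz-poly A)
      ; run = λ x a → weaken (m≤m+n 1 _) id-computes ; small = λ x a → ≤-trans (size-enc A x a) (m≤n+m _ 1) }

    litʰ : ∀ n → Hom A natᵗ (λ _ _ → n)
    litʰ n = record { code = litᶜ n ; cost = λ _ → 1 + bits n ; cost-poly = poly-const _
      ; run = λ x a → weaken (m≤m+n 1 _) lit-computes ; small = λ x a → m≤n+m _ 1 }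

    _,ʰ_ : ∀ {B C f g} → Hom A B f → Hom A C g → Hom A (B ×ᵗ C) (λ x a → f x a , g x a)
    F ,ʰ G = record { code = pairᶜ (code F) (code G) ; cost = λ x → 1 + (cost F x + cost G x)
      ; cost-poly = poly-+ (poly-const 1) (poly-+ (cost-poly F) (cost-poly G))
      ; run = λ x a → pair-computes (run F x a) (run G x a)
      ; small = λ x a → s≤s (+-mono-≤ (small F x a) (small G x a)) }

    _∙_ : ∀ {B C f g} → Hom A (ty B) f → Hom B C g → Hom A C (λ x a → g x (f x a))
    F ∙ G = record { code = code F ⨾ code G ; cost = λ x → 1 + (cost F x + cost G x)
      ; cost-poly = poly-+ (poly-const 1) (poly-+ (cost-poly F) (cost-poly G))
      ; run = λ x a → ⨾-computes (run F x a) (run G x _)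
      ; small = λ x a → ≤-trans (small G x _) (≤-trans (m≤n+m _ (cost F x)) (m≤n+m _ 1)) }

    opʰ : ∀ o {f g} → Hom A natᵗ f → Hom A natᵗ g → Hom A natᵗ (λ x a → ⟦ o ⟧ (f x a) (g x a))
    opʰ o {f} {g} F G = record { code = code (F ,ʰ G) ⨾ opᶜ o ; cost = λ x → 1 + (cost (F ,ʰ G) x + (cost F x + cost G x + 4))
      ; cost-poly = poly-+ (poly-const 1) (poly-+ (cost-poly (F ,ʰ G)) (poly-+ (poly-+ (cost-poly F) (cost-poly G)) (poly-const 4)))
      ; run = λ x a → ⨾-computes (run (F ,ʰ G) x a) (weaken (+-monoˡ-≤ 4 (+-mono-≤ (small F x a) (small G x a))) op-computes)
      ; small = λ x a → ≤-trans (bits-⟦⟧ o (f x a) (g x a)) (≤-trans (+-mono-≤ (small F x a) (small G x a))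
          (≤-trans (m≤m+n _ 4) (≤-trans (m≤n+m _ (cost (F ,ʰ G) x)) (m≤n+m _ 1)))) }

    ifʰ : ∀ {B b f g} → Hom A boolᵗ b → Hom A B f → Hom A B g → Hom A B (λ x a → if b x a then f x a else g x a)
    ifʰ {B} {b} {f} {g} T F G = record { code = code (T ,ʰ idʰ) ⨾ ifᶜ (code F) (code G)
      ; cost = λ x → 1 + (cost (T ,ʰ idʰ) x + (6 + (cost F x + cost G x)))
      ; cost-poly = poly-+ (poly-const 1) (poly-+ (cost-poly (T ,ʰ idʰ)) (poly-+ (poly-const 6) (poly-+ (cost-poly F) (cost-poly G))))
      ; run = λ x a → ⨾-computes (run (T ,ʰ idʰ) x a) (branch x a)
      ; small = λ x a → ≤-trans (leaf x a) (≤-trans (m≤n+m _ 6) (≤-trans (m≤n+m _ (cost (T ,ʰ idʰ) x)) (m≤n+m _ 1))) }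
      where
      branch : ∀ x a → Computes (ifᶜ (code F) (code G)) (pair (encodeBool (b x a)) (Ob.enc A x a))
                                (enc B x (if b x a then f x a else g x a)) (6 + (cost F x + cost G x))
      branch x a with b x a
      ... | true  = weaken (+-monoʳ-≤ 6 (m≤m+n _ _)) (if-true-computes (run F x a))
      ... | false = weaken (+-monoʳ-≤ 6 (m≤n+m _ (cost F x))) (if-false-computes (run G x a))
      leaf : ∀ x a → size (enc B x (if b x a then f x a else g x a)) ≤ cost F x + cost G x
      leaf x a with b x a
      ... | true  = ≤-trans (small F x a) (m≤m+n _ _)
      ... | false = ≤-trans (small G x a) (m≤n+m _ _)

    -- A context is an iterated product, with `wk` and `top` as weakening and last variable. A
    -- weakened map is run anew wherever it occurs; the nesting being fixed, costs stay polynomial.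
    wk : ∀ {X C f} → Hom A C f → Hom (A ⊗ X) C (λ x p → f x (proj₁ p))
    wk {X} F = record { code = fstᶜ ⨾ code F ; cost = λ x → 1 + (3 + cost F x)
      ; cost-poly = poly-+ (poly-const 1) (poly-+ (poly-const 3) (cost-poly F))
      ; run = λ x p → ⨾-computes fst-computes (run F x (proj₁ p))
      ; small = λ x p → ≤-trans (small F x (proj₁ p)) (m≤n+m _ 4) }

    top : ∀ {X} → Hom (A ⊗ X) (ty X) (λ x p → proj₂ p)
    top {X} = record { code = sndᶜ ; cost = λ x → 3 + sz X x ; cost-poly = poly-+ (poly-const 3) (sz-poly X)
      ; run = λ x p → weaken (m≤m+n 3 _) snd-computes
      ; small = λ x p → ≤-trans (size-enc X x (proj₂ p)) (m≤n+m _ 3) }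

    length≤cost : ∀ {B xs} (L : Hom A (listᵗ B) xs) → ∀ x a → length (xs x a) ≤ cost L x
    length≤cost {B} {xs} L x a = ≤-trans (≤-reflexive (sym (length-map (enc B x) (xs x a)))) (≤-trans (length≤size _) (small L x a))

    []ʰ : ∀ {B} → Hom A (listᵗ B) (λ _ _ → [])
    []ʰ = recode (λ _ _ → refl) (litʰ 0)

    _∷ʰ_ : ∀ {B f g} → Hom A B f → Hom A (listᵗ B) g → Hom A (listᵗ B) (λ x a → f x a ∷ g x a)
    F ∷ʰ G = recode (λ _ _ → refl) (F ,ʰ G)

  acc : ∀ {A S p} {P : Poly p} → Hom (A ⊗ upTo S p P) S (λ x q → proj₁ (proj₂ q))
  acc {A} {S} {p} {P} = recode (λ _ _ → refl) top

  module _ {A : Ob} where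

    -- The results on all tails must be bounded in advance: a polynomial-time step alone could
    -- double the accumulator in each turn. Through `upTo` the bound also makes the accumulator an
    -- admissible input of the step.
    foldʰ : ∀ {X S xs i} {g : ∀ x → Ob.El A x → Ob.El X x → ⟨ S ⟩ x → ⟨ S ⟩ x} {p} (P : Poly p) →
      (∀ x a ys → ys IsTailOf xs x a → size (enc S x (foldr (g x a) (i x a) ys)) ≤ p x) →
      Hom A (listᵗ (ty X)) xs → Hom A S i →
      Hom ((A ⊗ X) ⊗ upTo S p P) S (λ x q → g x (proj₁ (proj₁ q)) (proj₂ (proj₁ q)) (proj₁ (proj₂ q))) →
      Hom A S (λ x a → foldr (g x a) (i x a) (xs x a))
    foldʰ {X} {S} {xs} {i} {g} {p} P bounded L J G = record
      { code = code env ⨾ foldᶜ (code G)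
      ; cost = λ x → 1 + (cost env x + (cost L x * (11 + cost G x) + 11)) + p x
      ; cost-poly = poly-+ (poly-+ (poly-const 1) (poly-+ (cost-poly env)
          (poly-+ (poly-* (cost-poly L) (poly-+ (poly-const 11) (cost-poly G))) (poly-const 11)))) P
      ; run = λ x a → weaken (≤-trans (s≤s (+-monoʳ-≤ (cost env x) (+-monoˡ-≤ 11 (*-monoˡ-≤ (11 + cost G x) (length≤cost L x a))))) (m≤m+n _ (p x)))
          (⨾-computes (run env x a) (fold-computes (Ob.enc X x) (λ ys → enc S x (foldr (g x a) (i x a) ys)) (xs x a)
            (λ e ys t → run G x ((a , e) , (foldr (g x a) (i x a) ys , bounded x a ys (tail t))))))
      ; small = λ x a → ≤-trans (bounded x a (xs x a) here) (m≤n+m _ _) }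
      where
      env = idʰ ,ʰ (J ,ʰ L)
      tail : ∀ {B : Set} {y : B} {ys zs} → (y ∷ ys) IsTailOf zs → ys IsTailOf zs
      tail here      = there here
      tail (there t) = there (tail t)

    foldᵒ : ∀ {X S xs i} {g : ∀ x → Ob.El A x → Ob.El X x → Ob.El S x → Ob.El S x} →
      Hom A (listᵗ (ty X)) xs → Hom A (ty S) i →
      Hom ((A ⊗ X) ⊗ S) (ty S) (λ x q → g x (proj₁ (proj₁ q)) (proj₂ (proj₁ q)) (proj₂ q)) →
      Hom A (ty S) (λ x a → foldr (g x a) (i x a) (xs x a))
    foldᵒ {X} {S} {g = g} L J G = foldʰ {X = X} {g = g} (sz-poly S) (λ x a ys _ → size-enc S x _) L J record
      { code = code G ; cost = cost G ; cost-poly = cost-poly G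
      ; run = λ x q → run G x (proj₁ q , proj₁ (proj₂ q)) ; small = λ x q → small G x (proj₁ q , proj₁ (proj₂ q)) }

    mapʰ : ∀ {X B xs} {h : ∀ x → Ob.El A x → Ob.El X x → ⟨ B ⟩ x} → Hom A (listᵗ (ty X)) xs →
      Hom (A ⊗ X) B (λ x q → h x (proj₁ q) (proj₂ q)) → Hom A (listᵗ B) (λ x a → map (h x a) (xs x a))
    mapʰ {X} {B} {xs} {h} L H = ext (λ x a → foldr-∷ (h x a) (xs x a))
      (foldʰ {g = λ x a e ys → h x a e ∷ ys} (poly-+ (poly-* (cost-poly L) (poly-+ (poly-const 1) (cost-poly H))) (poly-const 1))
        bounded L []ʰ (wk H ∷ʰ acc))
      where
      foldr-∷ : ∀ {A B : Set} (f : A → B) xs → foldr (λ e ys → f e ∷ ys) [] xs ≡ map f xs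
      foldr-∷ f []       = refl
      foldr-∷ f (x ∷ xs) = cong (f x ∷_) (foldr-∷ f xs)
      bounded : ∀ x a ys → ys IsTailOf xs x a →
                size (encodeList (map (enc B x) (foldr (λ e ys → h x a e ∷ ys) [] ys))) ≤ cost L x * (1 + cost H x) + 1
      bounded x a ys t = begin
        size (encodeList (map (enc B x) (foldr (λ e ys → h x a e ∷ ys) [] ys))) ≡⟨ cong (size ∘ encodeList ∘ map (enc B x)) (foldr-∷ (h x a) ys) ⟩
        size (encodeList (map (enc B x) (map (h x a) ys)))   ≡⟨ cong (size ∘ encodeList) (map-∘ ys) ⟨
        size (encodeList (map (enc B x ∘ h x a) ys))         ≤⟨ size-encodeList _ ys (λ e → small H x (a , e)) ⟩
        length ys * suc (cost H x) + 1                       ≤⟨ +-monoˡ-≤ 1 (*-monoˡ-≤ (suc (cost H x)) (≤-trans (length-tail t) (length≤cost L x a))) ⟩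
        cost L x * (1 + cost H x) + 1                        ∎
        where open ≤-Reasoning

  module _ {A : Ob} where

    fstʰ : ∀ {B C f} → Hom A (B ×ᵗ C) f → Hom A B (λ x a → proj₁ (f x a))
    code (fstʰ F) = code F ⨾ fstᶜ
    cost (fstʰ F) x = 1 + (cost F x + 3)
    cost-poly (fstʰ F) = poly-+ (poly-const 1) (poly-+ (cost-poly F) (poly-const 3))
    run (fstʰ F) x a = ⨾-computes (run F x a) fst-computes
    small (fstʰ F) x a = ≤-trans (m≤m+n _ _) (≤-trans (n≤1+n _) (≤-trans (small F x a) (≤-trans (m≤m+n _ 3) (n≤1+n _))))

    sndʰ : ∀ {B C f} → Hom A (B ×ᵗ C) f → Hom A C (λ x a → proj₂ (f x a))
    code (sndʰ F) = code F ⨾ sndᶜ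
    cost (sndʰ F) x = 1 + (cost F x + 3)
    cost-poly (sndʰ F) = poly-+ (poly-const 1) (poly-+ (cost-poly F) (poly-const 3))
    run (sndʰ F) x a = ⨾-computes (run F x a) snd-computes
    small (sndʰ {B} {f = f} F) x a = ≤-trans (m≤n+m _ (size (enc B x (proj₁ (f x a))))) (≤-trans (n≤1+n _) (≤-trans (small F x a) (≤-trans (m≤m+n _ 3) (n≤1+n _))))

    -- The machine compares numbers only with zero; all comparisons are reduced to this one by
    -- truncated subtraction.
    positiveʰ : ∀ {f} → Hom A natᵗ f → Hom A boolᵗ (λ x a → 0 <ᵇ f x a)
    code (positiveʰ F) = code (F ,ʰ litʰ 0) ⨾ ifᶜ (litᶜ 1) (litᶜ 0)
    cost (positiveʰ F) x = 1 + (cost (F ,ʰ litʰ 0) x + 7)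
    cost-poly (positiveʰ F) = poly-+ (poly-const 1) (poly-+ (cost-poly (F ,ʰ litʰ 0)) (poly-const 7))
    run (positiveʰ {f} F) x a = ⨾-computes (run (F ,ʰ litʰ 0) x a) (test (f x a))
      where
      test : ∀ n → Computes (ifᶜ (litᶜ 1) (litᶜ 0)) (pair (nat n) (nat 0)) (encodeBool (0 <ᵇ n)) 7
      test zero    = if-false-computes lit-computes
      test (suc n) = if-true-computes lit-computes
    small (positiveʰ {f} F) x a = ≤-trans (size-enc boolᵒ x (0 <ᵇ f x a)) (s≤s z≤n)

    trueʰ : Hom A boolᵗ (λ _ _ → true)
    trueʰ = recode (λ _ _ → refl) (litʰ 1)

    falseʰ : Hom A boolᵗ (λ _ _ → false)
    falseʰ = recode (λ _ _ → refl) (litʰ 0)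

    notʰ : ∀ {f} → Hom A boolᵗ f → Hom A boolᵗ (λ x a → not (f x a))
    notʰ {f} F = ext (λ x a → if-not (f x a)) (ifʰ F falseʰ trueʰ)
      where
      if-not : ∀ b → (if b then false else true) ≡ not b
      if-not false = refl
      if-not true  = refl

    _∧ʰ_ : ∀ {f g} → Hom A boolᵗ f → Hom A boolᵗ g → Hom A boolᵗ (λ x a → f x a ∧ g x a)
    _∧ʰ_ {f} {g} F G = ext (λ x a → if-∧ (f x a) (g x a)) (ifʰ F G falseʰ)
      where
      if-∧ : ∀ b c → (if b then c else false) ≡ b ∧ c
      if-∧ false c = refl
      if-∧ true  c = refl

    _∨ʰ_ : ∀ {f g} → Hom A boolᵗ f → Hom A boolᵗ g → Hom A boolᵗ (λ x a → f x a ∨ g x a)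
    _∨ʰ_ {f} {g} F G = ext (λ x a → if-∨ (f x a) (g x a)) (ifʰ F trueʰ G)
      where
      if-∨ : ∀ b c → (if b then true else c) ≡ b ∨ c
      if-∨ false c = refl
      if-∨ true  c = refl

    _xorʰ_ : ∀ {f g} → Hom A boolᵗ f → Hom A boolᵗ g → Hom A boolᵗ (λ x a → f x a xor g x a)
    _xorʰ_ {f} {g} F G = ext (λ x a → if-xor (f x a) (g x a)) (ifʰ F (notʰ G) G)
      where
      if-xor : ∀ b c → (if b then not c else c) ≡ b xor c
      if-xor false c = refl
      if-xor true  c = refl

    _<ʰ_ : ∀ {f g} → Hom A natᵗ f → Hom A natᵗ g → Hom A boolᵗ (λ x a → f x a <ᵇ g x a)
    _<ʰ_ {f} {g} F G = ext (λ x a → 0<∸ (f x a) (g x a)) (positiveʰ (opʰ monus G F))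
      where
      0<∸ : ∀ m n → (0 <ᵇ n ∸ m) ≡ (m <ᵇ n)
      0<∸ zero    n       = refl
      0<∸ (suc m) zero    = refl
      0<∸ (suc m) (suc n) = 0<∸ m n

    _≡ʰ_ : ∀ {f g} → Hom A natᵗ f → Hom A natᵗ g → Hom A boolᵗ (λ x a → f x a ≡ᵇ g x a)
    _≡ʰ_ {f} {g} F G = ext (λ x a → ≮∧≯ (f x a) (g x a)) (notʰ ((F <ʰ G) ∨ʰ (G <ʰ F)))
      where
      ≮∧≯ : ∀ m n → not ((m <ᵇ n) ∨ (n <ᵇ m)) ≡ (m ≡ᵇ n)
      ≮∧≯ zero    zero    = refl
      ≮∧≯ zero    (suc n) = refl
      ≮∧≯ (suc m) zero    = refl
      ≮∧≯ (suc m) (suc n) = ≮∧≯ m n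

-- The algorithm

_==_ : ∀ {n} → Fin n → Fin n → Bool
u == v = toℕ u ≡ᵇ toℕ v

-- This is how sets and tables are stored: a loop sees each argument together with its value and
-- needs no lookup.
graphOf : ∀ {n} {A : Set} → (Fin n → A) → List (Fin n × A)
graphOf {n} f = map (λ i → i , f i) (allFin n)

module Algorithm {n m : ℕ} (src tgt : Fin m → Fin n) (W : Fin m → ℕ) (k : ℕ) where

  Edges : Set
  Edges = Fin m → Bool

  ∅ : Edges
  ∅ _ = false

  -- The program knows an edge by its endpoints; in a simple graph they determine it.
  _≈_ : Fin m → Fin m → Bool
  e ≈ f = (src e == src f) ∧ (tgt e == tgt f)

  add : Fin m → Edges → Edges
  add e F f = (e ≈ f) ∨ F f

  joins : Fin m → Fin n → Fin n → Bool
  joins e u v = ((src e == u) ∧ (tgt e == v)) ∨ ((src e == v) ∧ (tgt e == u))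

  touches : Fin m → Fin n → Bool
  touches e u = (src e == u) ∨ (tgt e == u)

  -- A tree is represented by its root r and its edge set F.
  covers : Fin n → Edges → Fin n → Bool
  covers r F u = foldr (λ p b → (proj₂ p ∧ touches (proj₁ p) u) ∨ b) (u == r) (graphOf F)

  count : Fin n → Edges → ℕ
  count r F = foldr (λ v c → if covers r F v then 1 + c else c) 0 (allFin n)

  wt : Edges → ℕ
  wt F = foldr (λ p w → if proj₂ p then W (proj₁ p) + w else w) 0 (graphOf F)

  -- The exclusive or asks for exactly one endpoint in the tree, so the edge hangs a leaf and closes
  -- no cycle. The last conjunct stops growth at `k` nodes, which limits the light edges to be paid
  -- for.
  addable : Fin n → ℕ → Fin m × Bool → Edges → Bool
  addable r δ (e , p) F =
    (p ∨ not (δ <ᵇ W e)) ∧ ((covers r F (src e) xor covers r F (tgt e)) ∧ (count r F <ᵇ k))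

  growStep : Fin n → ℕ → Fin m × Bool → Edges → Edges
  growStep r δ p F = if addable r δ p F then add (proj₁ p) F else F

  pass : Fin n → ℕ → Edges → Edges → Edges
  pass r δ P F = foldr (growStep r δ) F (graphOf P)

  -- Edges of `P` are permitted whatever their weight, not inserted. As many passes as nodes
  -- suffice, because a pass that changes anything adds a node.
  grow : Fin n → ℕ → Edges → Edges → Edges
  grow r δ P F = foldr (λ _ → pass r δ P) F (allFin n)

  Table : Set
  Table = Fin n → Edges

  relaxStep : Fin n → Fin n × Edges → Fin m → Edges → Edges
  relaxStep v (u , P) e Q = if joins e u v ∧ (wt (add e P) <ᵇ wt Q) then add e P else Q

  relaxRow : Fin n → Fin n × Edges → Edges → Edges
  relaxRow v row Q = foldr (relaxStep v row) Q (allFin m)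

  relax : Table → Table
  relax T v = foldr (relaxRow v) (T v) (graphOf T)

  initial : Fin n → Table
  initial r v e = not (v == r)

  -- Bellman–Ford with edge sets for distances; the set of all edges stands for ∞.
  paths : Fin n → Table
  paths r = foldr (λ _ → relax) (initial r) (allFin n)

  -- The budget is given by an edge set `D`, an entry of the table, of which only the weight
  -- matters. All candidates grow from the same `F`; `B` is the best one so far.
  enlargeStep : Fin n → ℕ → Edges → Edges → Fin n × Edges → Edges → Edges
  enlargeStep r δ D F (_ , P) B =
    if not (wt D <ᵇ wt P) ∧ (count r B <ᵇ count r (grow r δ P F)) then grow r δ P F else B

  enlarge : Fin n → ℕ → Edges → Table → Edges → Edges
  enlarge r δ D T F = foldr (enlargeStep r δ D F) F (graphOf T)

  -- Only `h` rounds are needed for the bound, but `n` are made so that no root is computed; once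
  -- `k` nodes are reached, a round changes nothing.
  greedy : Fin n → ℕ → Edges → Table → Edges
  greedy r δ D T = foldr (λ _ → enlarge r δ D T) (grow r δ ∅ ∅) (allFin n)

  Rooted : Set
  Rooted = Fin n × Edges

  pick : Rooted → Rooted → Rooted
  pick (r , F) (s , B) =
    if not (count r F <ᵇ k) ∧ ((count s B <ᵇ k) ∨ (wt F <ᵇ wt B)) then (r , F) else (s , B)

  attempt : Fin n → Table → Edges → ℕ → Rooted → Rooted
  attempt r T D δ = pick (r , greedy r δ D T)

  searchδ : Fin n → Table → Edges → Rooted → Rooted
  searchδ r T D B = foldr (λ e → attempt r T D (W e)) (attempt r T D 0 B) (allFin m)

  searchD : Fin n → Table → Rooted → Rooted
  searchD r T B = foldr (λ row → searchδ r T (proj₂ row)) B (graphOf T)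

  search : Fin n → Rooted
  search r₀ = foldr (λ r → searchD r (paths r)) (r₀ , ∅) (allFin n)

-- Weights of finite sets

≡true⇒T : ∀ {b} → b ≡ true → Bool.T b
≡true⇒T refl = _

T⇒≡true : ∀ {b} → Bool.T b → b ≡ true
T⇒≡true {true} _ = refl

==⇒≡ : ∀ {n} {u v : Fin n} → (u == v) ≡ true → u ≡ v
==⇒≡ {u = u} {v} p = toℕ-injective (≡ᵇ⇒≡ (toℕ u) (toℕ v) (≡true⇒T p))

==-refl : ∀ {n} (u : Fin n) → (u == u) ≡ true
==-refl u = T⇒≡true (≡⇒≡ᵇ (toℕ u) (toℕ u) refl)

<ᵇ-true : ∀ {m n} → (m <ᵇ n) ≡ true → m < n
<ᵇ-true {m} {n} p = <ᵇ⇒< m n (≡true⇒T p)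

<ᵇ-false : ∀ {m n} → (m <ᵇ n) ≡ false → n ≤ m
<ᵇ-false {m} {n} p = ≮⇒≥ λ m<n → contradiction (trans (sym p) (T⇒≡true (<⇒<ᵇ m<n))) λ ()

<⇒<ᵇ-true : ∀ {m n} → m < n → (m <ᵇ n) ≡ true
<⇒<ᵇ-true p = T⇒≡true (<⇒<ᵇ p)

≤⇒<ᵇ-false : ∀ {m n} → n ≤ m → (m <ᵇ n) ≡ false
≤⇒<ᵇ-false {m} {n} p with m <ᵇ n in eq
... | false = refl
... | true  = contradiction (<ᵇ-true {m} eq) (≤⇒≯ p)

∨-true : ∀ {a b} → a ∨ b ≡ true → a ≡ true ⊎ b ≡ true
∨-true {true}  _ = inj₁ refl
∨-true {false} p = inj₂ p

∨-introˡ : ∀ {a b} → a ≡ true → a ∨ b ≡ true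
∨-introˡ refl = refl

∨-introʳ : ∀ {a b} → b ≡ true → a ∨ b ≡ true
∨-introʳ {true}  _ = refl
∨-introʳ {false} p = p

∧-true : ∀ {a b} → a ∧ b ≡ true → a ≡ true × b ≡ true
∧-true {true} p = refl , p

∧-intro : ∀ {a b} → a ≡ true → b ≡ true → a ∧ b ≡ true
∧-intro refl p = p

foldr-preserves : ∀ {A B : Set} (P : B → Set) (f : A → B → B) {b} xs →
                  (∀ x b → x ∈ xs → P b → P (f x b)) → P b → P (foldr f b xs)
foldr-preserves P f []       step p = p
foldr-preserves P f (x ∷ xs) step p = step x _ (here refl) (foldr-preserves P f xs (λ y b m → step y b (there m)) p)

foldr-establishes : ∀ {A B : Set} (P : B → Set) (f : A → B → B) {b x} {xs} → (∀ x b → P b → P (f x b)) →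
                    x ∈ xs → (∀ b → P (f x b)) → P (foldr f b xs)
foldr-establishes P f step (here refl) p = p _
foldr-establishes P f step (there m)   p = step _ _ (foldr-establishes P f step m p)

length-allFin : ∀ n → length (allFin n) ≡ n
length-allFin n = length-tabulate {n = n} id

∈-graphOf : ∀ {n} {A : Set} (f : Fin n → A) i → (i , f i) ∈ graphOf f
∈-graphOf f i = ∈-map⁺ _ (∈-allFin i)

∈-graphOf⁻ : ∀ {n} {A : Set} (f : Fin n → A) {p} → p ∈ graphOf f → proj₂ p ≡ f (proj₁ p)
∈-graphOf⁻ f m with ∈-map⁻ _ m
... | i , _ , refl = refl

module _ {A : Set} (f : A → ℕ) where

  -- With `f` constantly 1 this is a cardinality, so the same lemmas serve edge weights and node
  -- counts.
  weigh : (A → Bool) → List A → ℕ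
  weigh p = foldr (λ x w → if p x then f x + w else w) 0

  weigh-mono : ∀ {p q} → (∀ x → p x ≡ true → q x ≡ true) → ∀ xs → weigh p xs ≤ weigh q xs
  weigh-mono p⊆q [] = z≤n
  weigh-mono {p} {q} p⊆q (x ∷ xs) with p x in px | q x in qx
  ... | true  | true  = +-monoʳ-≤ (f x) (weigh-mono p⊆q xs)
  ... | true  | false = contradiction (trans (sym (p⊆q x px)) qx) λ ()
  ... | false | true  = ≤-trans (weigh-mono p⊆q xs) (m≤n+m _ (f x))
  ... | false | false = weigh-mono p⊆q xs

  weigh-∪ : ∀ p q xs → weigh (λ x → p x ∨ q x) xs ≤ weigh p xs + weigh q xs
  weigh-∪ p q [] = z≤n
  weigh-∪ p q (x ∷ xs) with p x | q x
  ... | true  | true  = ≤-trans (+-monoʳ-≤ (f x) (≤-trans (weigh-∪ p q xs) (+-monoʳ-≤ (weigh p xs) (m≤n+m _ (f x))))) (≤-reflexive (sym (+-assoc (f x) _ _)))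
  ... | true  | false = ≤-trans (+-monoʳ-≤ (f x) (weigh-∪ p q xs)) (≤-reflexive (sym (+-assoc (f x) _ _)))
  ... | false | true  = ≤-trans (+-monoʳ-≤ (f x) (weigh-∪ p q xs)) (≤-reflexive (x∙yz≈y∙xz (f x) (weigh p xs) (weigh q xs)))
    where x∙yz≈y∙xz : ∀ a b c → a + (b + c) ≡ b + (a + c)
          x∙yz≈y∙xz a b c = trans (sym (+-assoc a b c)) (trans (cong (_+ c) (+-comm a b)) (+-assoc b a c))
  ... | false | false = weigh-∪ p q xs

  weigh-disjoint : ∀ p q → (∀ x → p x ≡ true → q x ≡ false) → ∀ xs → weigh p xs + weigh q xs ≤ weigh (λ x → p x ∨ q x) xs
  weigh-disjoint p q d [] = z≤n
  weigh-disjoint p q d (x ∷ xs) with p x in px | q x in qx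
  ... | true  | true  = contradiction (trans (sym qx) (d x px)) λ ()
  ... | true  | false = ≤-trans (≤-reflexive (+-assoc (f x) _ _)) (+-monoʳ-≤ (f x) (weigh-disjoint p q d xs))
  ... | false | true  = ≤-trans (≤-reflexive (trans (sym (+-assoc (weigh p xs) (f x) _)) (trans (cong (_+ weigh q xs) (+-comm _ (f x))) (+-assoc (f x) _ _)))) (+-monoʳ-≤ (f x) (weigh-disjoint p q d xs))
  ... | false | false = weigh-disjoint p q d xs

  weigh-∈ : ∀ {p x xs} → x ∈ xs → p x ≡ true → f x ≤ weigh p xs
  weigh-∈ (here refl) px rewrite px = m≤m+n _ _
  weigh-∈ {p} (there {x = y} m) px with p y
  ... | true  = ≤-trans (weigh-∈ m px) (m≤n+m _ (f y))
  ... | false = weigh-∈ m px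

  weigh-none : ∀ {p} xs → (∀ x → x ∈ xs → p x ≡ false) → weigh p xs ≡ 0
  weigh-none [] h = refl
  weigh-none (x ∷ xs) h rewrite h x (here refl) = weigh-none xs (λ y m → h y (there m))

  weigh-single : ∀ {p x xs} → Unique xs → (∀ y → p y ≡ true → y ≡ x) → weigh p xs ≤ f x
  weigh-single [] h = z≤n
  weigh-single {p} {xs = y ∷ ys} (y∉ ∷ u) h with p y in py
  ... | false = weigh-single u h
  ... | true with refl ← h y py = ≤-reflexive (trans (cong (f y +_) (weigh-none ys none)) (+-identityʳ _))
    where
    none : ∀ z → z ∈ ys → p z ≡ false
    none z m with p z in pz
    ... | false = refl
    ... | true with refl ← h z pz = contradiction refl (All.lookup y∉ m)

  weigh-cong : ∀ {p q} → (∀ x → p x ≡ q x) → ∀ xs → weigh p xs ≡ weigh q xs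
  weigh-cong p≡q xs = ≤-antisym (weigh-mono (λ x → trans (sym (p≡q x))) xs) (weigh-mono (λ x → trans (p≡q x)) xs)

weigh-1≤length : ∀ {A : Set} (p : A → Bool) xs → weigh (λ _ → 1) p xs ≤ length xs
weigh-1≤length p [] = z≤n
weigh-1≤length p (x ∷ xs) with p x
... | true  = s≤s (weigh-1≤length p xs)
... | false = m≤n⇒m≤1+n (weigh-1≤length p xs)

size≡weigh : ∀ {n} (p : Subset n) → ∣ p ∣ ≡ weigh (λ _ → 1) (Vec.lookup p) (allFin n)
size≡weigh p = go p id (Vec.lookup p) λ _ → refl
  where
  go : ∀ {n N} (p : Subset n) (ι : Fin n → Fin N) (q : Fin N → Bool) → (∀ i → q (ι i) ≡ Vec.lookup p i) →
       ∣ p ∣ ≡ weigh (λ _ → 1) q (tabulate ι)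
  go Vec.[] ι q h = refl
  go (true  Vec.∷ p) ι q h rewrite h Fin.zero = cong suc (go p (ι ∘ Fin.suc) q (h ∘ Fin.suc))
  go (false Vec.∷ p) ι q h rewrite h Fin.zero = go p (ι ∘ Fin.suc) q (h ∘ Fin.suc)

-- Growing a tree

module Growth {n m : ℕ} (src tgt : Fin m → Fin n) (W : Fin m → ℕ) (k : ℕ)
              (simple : ∀ e f → src e ≡ src f → tgt e ≡ tgt f → e ≡ f) where

  open Algorithm src tgt W k

  Joins : Fin m → Fin n → Fin n → Set
  Joins e u v = (src e ≡ u × tgt e ≡ v) ⊎ (src e ≡ v × tgt e ≡ u)

  _⊆_ : ∀ {A : Set} → (A → Bool) → (A → Bool) → Set
  p ⊆ q = ∀ x → p x ≡ true → q x ≡ true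

  -- The edge does not cross the boundary of `s`. Saturation gives exactly this for all permitted
  -- edges, so the analysis argues with closed sets in place of paths.
  Closed : (Fin n → Bool) → Fin m → Set
  Closed s e = s (src e) ≡ s (tgt e)

  joins⇒Joins : ∀ {e u v} → joins e u v ≡ true → Joins e u v
  joins⇒Joins p with ∨-true p
  ... | inj₁ q = inj₁ (==⇒≡ (proj₁ (∧-true q)) , ==⇒≡ (proj₂ (∧-true q)))
  ... | inj₂ q = inj₂ (==⇒≡ (proj₁ (∧-true q)) , ==⇒≡ (proj₂ (∧-true q)))

  Joins⇒joins : ∀ {e u v} → Joins e u v → joins e u v ≡ true
  Joins⇒joins {e} (inj₁ (refl , refl)) = ∨-introˡ (∧-intro (==-refl (src e)) (==-refl (tgt e)))
  Joins⇒joins {e} (inj₂ (refl , refl)) = ∨-introʳ {(src e == tgt e) ∧ (tgt e == src e)} (∧-intro (==-refl (src e)) (==-refl (tgt e)))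

  closed-Joins : ∀ {s e u v} → Joins e u v → Closed s e → s u ≡ s v
  closed-Joins (inj₁ (refl , refl)) c = c
  closed-Joins (inj₂ (refl , refl)) c = sym c

  ≈⇒≡ : ∀ {e f} → (e ≈ f) ≡ true → e ≡ f
  ≈⇒≡ p = simple _ _ (==⇒≡ (proj₁ (∧-true p))) (==⇒≡ (proj₂ (∧-true p)))

  ≈-refl : ∀ e → (e ≈ e) ≡ true
  ≈-refl e = ∧-intro (==-refl (src e)) (==-refl (tgt e))

  add-new : ∀ e F → add e F e ≡ true
  add-new e F = ∨-introˡ (≈-refl e)

  add-⊇ : ∀ e F → F ⊆ add e F
  add-⊇ e F f = ∨-introʳ {e ≈ f}

  add⁻ : ∀ {e F f} → add e F f ≡ true → e ≡ f ⊎ F f ≡ true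
  add⁻ p with ∨-true p
  ... | inj₁ q = inj₁ (≈⇒≡ q)
  ... | inj₂ q = inj₂ q

  module _ {r : Fin n} where

    covers⁻ : ∀ F {u} → covers r F u ≡ true → u ≡ r ⊎ Σ (Fin m) λ e → F e ≡ true × (src e ≡ u ⊎ tgt e ≡ u)
    covers⁻ F {u} = foldr-preserves
      (λ b → b ≡ true → u ≡ r ⊎ Σ (Fin m) λ e → F e ≡ true × (src e ≡ u ⊎ tgt e ≡ u)) _ (graphOf F) step (inj₁ ∘ ==⇒≡)
      where
      step : ∀ p b → p ∈ graphOf F → _ → (proj₂ p ∧ touches (proj₁ p) u) ∨ b ≡ true → _
      step (e , x) b m ih q with ∨-true q
      ... | inj₂ z = ih z
      ... | inj₁ z with ∧-true z
      ...   | Fe , t with ∨-true t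
      ...     | inj₁ s = inj₂ (e , trans (sym (∈-graphOf⁻ F m)) Fe , inj₁ (==⇒≡ s))
      ...     | inj₂ s = inj₂ (e , trans (sym (∈-graphOf⁻ F m)) Fe , inj₂ (==⇒≡ s))

    covers-root : ∀ F → covers r F r ≡ true
    covers-root F = foldr-preserves (_≡ true) _ (graphOf F) (λ p b _ q → ∨-introʳ {proj₂ p ∧ touches (proj₁ p) r} q) (==-refl r)

    covers-edge : ∀ F {e u} → F e ≡ true → src e ≡ u ⊎ tgt e ≡ u → covers r F u ≡ true
    covers-edge F {e} {u} Fe end = foldr-establishes (_≡ true) _ (λ p b q → ∨-introʳ {proj₂ p ∧ touches (proj₁ p) u} q)
      (∈-graphOf F e) (λ b → ∨-introˡ (∧-intro Fe (touch end)))
      where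
      touch : src e ≡ u ⊎ tgt e ≡ u → touches e u ≡ true
      touch (inj₁ refl) = ∨-introˡ (==-refl (src e))
      touch (inj₂ refl) = ∨-introʳ {src e == u} (==-refl (tgt e))

    covers-src : ∀ F {e} → F e ≡ true → covers r F (src e) ≡ true
    covers-src F Fe = covers-edge F Fe (inj₁ refl)

    covers-tgt : ∀ F {e} → F e ≡ true → covers r F (tgt e) ≡ true
    covers-tgt F Fe = covers-edge F Fe (inj₂ refl)

    covers-mono : ∀ {F F′} → F ⊆ F′ → covers r F ⊆ covers r F′
    covers-mono {F} {F′} F⊆F′ u p with covers⁻ F p
    ... | inj₁ refl = covers-root F′
    ... | inj₂ (e , Fe , end) = covers-edge F′ (F⊆F′ e Fe) end

    count-mono : ∀ {F F′} → F ⊆ F′ → count r F ≤ count r F′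
    count-mono F⊆F′ = weigh-mono (λ _ → 1) (covers-mono F⊆F′) (allFin n)

    1≤count : ∀ F → 1 ≤ count r F
    1≤count F = weigh-∈ (λ _ → 1) (∈-allFin r) (covers-root F)

    count≤n : ∀ F → count r F ≤ n
    count≤n F = ≤-trans (weigh-1≤length (covers r F) (allFin n)) (≤-reflexive (length-allFin n))

  wt≡weigh : ∀ F → wt F ≡ weigh W F (allFin m)
  wt≡weigh F = foldr-map _ _ 0 (allFin m)

  wt-mono : ∀ {F F′} → F ⊆ F′ → wt F ≤ wt F′
  wt-mono {F} {F′} F⊆F′ = subst₂ _≤_ (sym (wt≡weigh F)) (sym (wt≡weigh F′)) (weigh-mono W F⊆F′ (allFin m))

  wt-∪ : ∀ F F′ → wt (λ e → F e ∨ F′ e) ≤ wt F + wt F′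
  wt-∪ F F′ = subst₂ _≤_ (sym (wt≡weigh _)) (cong₂ _+_ (sym (wt≡weigh F)) (sym (wt≡weigh F′))) (weigh-∪ W F F′ (allFin m))

  wt-∅ : ∀ F → (∀ e → F e ≡ false) → wt F ≡ 0
  wt-∅ F h = trans (wt≡weigh F) (weigh-none W (allFin m) (λ e _ → h e))

  wt-add : ∀ e F → wt (add e F) ≤ W e + wt F
  wt-add e F = ≤-trans (wt-∪ (e ≈_) F) (+-monoˡ-≤ (wt F)
    (≤-trans (≤-reflexive (wt≡weigh _)) (weigh-single W (allFin⁺ m) (λ f p → sym (≈⇒≡ p)))))

  xor-true : ∀ {a b} → a xor b ≡ true → (a ≡ true × b ≡ false) ⊎ (a ≡ false × b ≡ true)
  xor-true {true}  {false} _ = inj₁ (refl , refl)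
  xor-true {false} {true}  _ = inj₂ (refl , refl)

  xor-false : ∀ {a b} → a xor b ≡ false → a ≡ b
  xor-false {true}  {true}  _ = refl
  xor-false {false} {false} _ = refl

  Leaf : Fin n → Edges → Fin m → Set
  Leaf r F e = Σ (Fin n) λ u → Σ (Fin n) λ v → Joins e u v × covers r F u ≡ true × covers r F v ≡ false

  count-leaf : ∀ {r F e} → Leaf r F e → count r F < count r (add e F)
  count-leaf {r} {F} {e} (u , v , j , _ , v∉) = begin
    1 + count r F                                              ≤⟨ +-monoˡ-≤ _ (weigh-∈ (λ _ → 1) (∈-allFin v) (==-refl v)) ⟩
    weigh (λ _ → 1) (v ==_) (allFin n) + count r F             ≤⟨ weigh-disjoint (λ _ → 1) (v ==_) (covers r F) (λ w p → subst (λ w → covers r F w ≡ false) (==⇒≡ p) v∉) (allFin n) ⟩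
    weigh (λ _ → 1) (λ w → (v == w) ∨ covers r F w) (allFin n) ≤⟨ weigh-mono (λ _ → 1) sub (allFin n) ⟩
    count r (add e F)                                          ∎
    where
    open ≤-Reasoning
    end : Joins e u v → src e ≡ v ⊎ tgt e ≡ v
    end (inj₁ (_ , p)) = inj₂ p
    end (inj₂ (p , _)) = inj₁ p
    sub : (λ w → (v == w) ∨ covers r F w) ⊆ covers r (add e F)
    sub w p with ∨-true p
    ... | inj₁ q = subst (λ w → covers r (add e F) w ≡ true) (==⇒≡ q) (covers-edge (add e F) (add-new e F) (end j))
    ... | inj₂ q = covers-mono (add-⊇ e F) w q

  -- The history of a tree as a sequence of hung leaves, from which connectedness and acyclicity
  -- follow by induction.
  data Grown (r : Fin n) : Edges → Set where
    root : Grown r ∅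
    leaf : ∀ {F e} → Grown r F → Leaf r F e → Grown r (add e F)

  addable⇒Leaf : ∀ {r δ p F} → addable r δ p F ≡ true → Leaf r F (proj₁ p)
  addable⇒Leaf {r} {δ} {e , b} {F} q with xor-true (proj₁ (∧-true (proj₂ (∧-true {b ∨ not (δ <ᵇ W e)} q))))
  ... | inj₁ (s , t) = src e , tgt e , inj₁ (refl , refl) , s , t
  ... | inj₂ (s , t) = tgt e , src e , inj₂ (refl , refl) , t , s

  addable⇒count< : ∀ {r δ p F} → addable r δ p F ≡ true → count r F < k
  addable⇒count< {r} {δ} {e , b} {F} q =
    <ᵇ-true (proj₂ (∧-true {covers r F (src e) xor covers r F (tgt e)} (proj₂ (∧-true {b ∨ not (δ <ᵇ W e)} q))))

  addable⇒allowed : ∀ {r δ p F} → addable r δ p F ≡ true → proj₂ p ≡ true ⊎ W (proj₁ p) ≤ δ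
  addable⇒allowed {r} {δ} {e , b} {F} q with ∨-true {b} (proj₁ (∧-true q))
  ... | inj₁ z = inj₁ z
  ... | inj₂ z with δ <ᵇ W e in eq
  ...   | false = inj₂ (<ᵇ-false {δ} eq)

  module _ {r : Fin n} {δ : ℕ} where

    growStep-preserves : ∀ (I : Edges → Set) → (∀ p F → addable r δ p F ≡ true → I F → I (add (proj₁ p) F)) →
                         ∀ p F → I F → I (growStep r δ p F)
    growStep-preserves I h p F i with addable r δ p F in eq
    ... | true  = h p F eq i
    ... | false = i

    grow-preserves : ∀ (I : Edges → Set) P → (∀ p F → p ∈ graphOf P → addable r δ p F ≡ true → I F → I (add (proj₁ p) F)) →
                     ∀ {F} → I F → I (grow r δ P F)
    grow-preserves I P h = foldr-preserves I _ (allFin n) λ _ F _ →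
      foldr-preserves I _ (graphOf P) λ p F′ p∈ i → step p F′ p∈ i
      where
      step : ∀ p F → p ∈ graphOf P → I F → I (growStep r δ p F)
      step p F p∈ i with addable r δ p F in eq
      ... | true  = h p F p∈ eq i
      ... | false = i

    grow-⊇ : ∀ P F → F ⊆ grow r δ P F
    grow-⊇ P F = grow-preserves (F ⊆_) P (λ p F′ _ _ h e z → add-⊇ (proj₁ p) F′ e (h e z)) (λ e z → z)

    grow-Grown : ∀ P {F} → Grown r F → Grown r (grow r δ P F)
    grow-Grown P = grow-preserves (Grown r) P (λ p F _ a g → leaf g (addable⇒Leaf {δ = δ} {p = p} a))

    Stuck : Edges → Edges → Set
    Stuck P F = ∀ p → p ∈ graphOf P → addable r δ p F ≡ false

    private
      Progress : List (Fin m × Bool) → Edges → Edges → Set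
      Progress ps F F′ = (F′ ≡ F × (∀ p → p ∈ ps → addable r δ p F ≡ false)) ⊎ count r F < count r F′

    pass-progress : ∀ ps F → Progress ps F (foldr (growStep r δ) F ps)
    pass-progress [] F = inj₁ (refl , λ p ())
    pass-progress (p ∷ ps) F with pass-progress ps F
    ... | inj₂ lt = inj₂ (<-≤-trans lt (growStep-preserves (λ F′ → count r (foldr (growStep r δ) F ps) ≤ count r F′)
            (λ q F′ _ h → ≤-trans h (count-mono (add-⊇ (proj₁ q) F′))) p _ ≤-refl))
    ... | inj₁ (eq , none) rewrite eq with addable r δ p F in a
    ...   | true  = inj₂ (count-leaf (addable⇒Leaf {δ = δ} {p = p} a))
    ...   | false = inj₁ (refl , λ { q (here refl) → a ; q (there z) → none q z })

    pass-stuck : ∀ ps F → (∀ p → p ∈ ps → addable r δ p F ≡ false) → foldr (growStep r δ) F ps ≡ F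
    pass-stuck [] F h = refl
    pass-stuck (p ∷ ps) F h rewrite pass-stuck ps F (λ q z → h q (there z)) | h p (here refl) = refl

    grow-progress : ∀ P F (vs : List (Fin n)) → let F′ = foldr (λ _ → pass r δ P) F vs in
                    Stuck P F′ ⊎ length vs + count r F ≤ count r F′
    grow-progress P F [] = inj₂ ≤-refl
    grow-progress P F (v ∷ vs) with grow-progress P F vs
    ... | inj₁ s = inj₁ (subst (Stuck P) (sym (pass-stuck (graphOf P) _ s)) s)
    ... | inj₂ c with pass-progress (graphOf P) (foldr (λ _ → pass r δ P) F vs)
    ...   | inj₁ (eq , s) = inj₁ (subst (Stuck P) (sym eq) s)
    ...   | inj₂ lt = inj₂ (≤-trans (s≤s c) lt)

    -- There is at least one node at the start, so `n` passes that each add a node would give more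
    -- than `n` nodes; hence some pass was idle.
    grow-stuck : ∀ P F → Stuck P (grow r δ P F)
    grow-stuck P F with grow-progress P F (allFin n)
    ... | inj₁ s = s
    ... | inj₂ c = contradiction (≤-trans (≤-trans (≤-reflexive (+-comm 1 n)) (≤-trans (+-monoʳ-≤ n (1≤count F))
      (≤-trans (≤-reflexive (cong (_+ count r F) (sym (length-allFin n)))) c))) (count≤n (grow r δ P F))) (<-irrefl refl)

    -- Below `k` nodes, the only conjunct of `addable` that can fail for a permitted edge is the
    -- crossing test.
    grow-closed : ∀ P F → count r (grow r δ P F) < k → ∀ e → P e ≡ true ⊎ W e ≤ δ → Closed (covers r (grow r δ P F)) e
    grow-closed P F c e ok = xor-false (stuck⇒ (grow-stuck P F (e , P e) (∈-graphOf P e)))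
      where
      allowed : P e ≡ true ⊎ W e ≤ δ → P e ∨ not (δ <ᵇ W e) ≡ true
      allowed (inj₁ p) = ∨-introˡ p
      allowed (inj₂ p) = ∨-introʳ {P e} (cong not (≤⇒<ᵇ-false p))
      stuck⇒ : ∀ {x} → (P e ∨ not (δ <ᵇ W e)) ∧ (x ∧ (count r (grow r δ P F) <ᵇ k)) ≡ false → x ≡ false
      stuck⇒ {x} z rewrite allowed ok | <⇒<ᵇ-true c with x
      ... | false = refl

    full-stuck : ∀ P F → k ≤ count r F → Stuck P F
    full-stuck P F c p p∈ with addable r δ p F in a
    ... | false = refl
    ... | true  = contradiction (addable⇒count< {δ = δ} {p = p} a) (≤⇒≯ c)

    grow-full : ∀ P F → k ≤ count r F → grow r δ P F ≡ F
    grow-full P F c = foldr-preserves (_≡ F) _ (allFin n)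
      (λ { _ .F _ refl → pass-stuck (graphOf P) F (full-stuck P F c) }) refl

    -- Every added edge outside P weighs at most δ and raises the count while it is below k.
    grow-wt : ∀ P {F X} → wt (λ e → F e ∨ P e) ≤ X + (count r F ⊓ k) * δ →
              wt (grow r δ P F) ≤ X + (count r (grow r δ P F) ⊓ k) * δ
    -- The invariant charges all of `P` in advance, so edges taken from `P` come free and only light
    -- edges raise the bound.
    grow-wt P {F} {X} h = ≤-trans (wt-mono (λ e → ∨-introˡ)) (grow-preserves
      (λ F → wt (λ e → F e ∨ P e) ≤ X + (count r F ⊓ k) * δ) P step h)
      where
      step : ∀ p F → p ∈ graphOf P → addable r δ p F ≡ true → wt (λ e → F e ∨ P e) ≤ X + (count r F ⊓ k) * δ →
             wt (λ e → add (proj₁ p) F e ∨ P e) ≤ X + (count r (add (proj₁ p) F) ⊓ k) * δ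
      step (e , b) F p∈ a h with addable⇒allowed {δ = δ} {F = F} a
      ... | inj₁ Pe = ≤-trans (wt-mono sub) (≤-trans h (+-monoʳ-≤ X (*-monoˡ-≤ δ (⊓-monoˡ-≤ k (count-mono (add-⊇ e F))))))
        where
        sub : (λ f → add e F f ∨ P f) ⊆ (λ f → F f ∨ P f)
        sub f z with ∨-true {add e F f} z
        ... | inj₂ y = ∨-introʳ {F f} y
        ... | inj₁ y with add⁻ {F = F} y
        ...   | inj₁ refl = ∨-introʳ {F f} (trans (sym (∈-graphOf⁻ P p∈)) Pe)
        ...   | inj₂ x = ∨-introˡ x
      ... | inj₂ We≤δ = begin
        wt (λ f → add e F f ∨ P f)               ≤⟨ wt-mono sub ⟩
        wt (add e (λ f → F f ∨ P f))             ≤⟨ wt-add e _ ⟩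
        W e + wt (λ f → F f ∨ P f)               ≤⟨ +-mono-≤ We≤δ h ⟩
        δ + (X + (count r F ⊓ k) * δ)            ≡⟨ trans (sym (+-assoc δ X _)) (trans (cong (_+ (count r F ⊓ k) * δ) (+-comm δ X)) (+-assoc X δ _)) ⟩
        X + suc (count r F ⊓ k) * δ              ≤⟨ +-monoʳ-≤ X (*-monoˡ-≤ δ count⊓) ⟩
        X + (count r (add e F) ⊓ k) * δ          ∎
        where
        open ≤-Reasoning
        sub : (λ f → add e F f ∨ P f) ⊆ add e (λ f → F f ∨ P f)
        sub f z with ∨-true {add e F f} z
        ... | inj₂ y = ∨-introʳ {e ≈ f} (∨-introʳ {F f} y)
        ... | inj₁ y with ∨-true {e ≈ f} y
        ...   | inj₁ x = ∨-introˡ x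
        ...   | inj₂ x = ∨-introʳ {e ≈ f} (∨-introˡ x)
        count⊓ : suc (count r F ⊓ k) ≤ count r (add e F) ⊓ k
        count⊓ = ⊓-glb (≤-trans (s≤s (m⊓n≤m _ k)) (count-leaf (addable⇒Leaf {δ = δ} {p = e , b} a)))
                       (≤-trans (s≤s (m⊓n≤m _ k)) (addable⇒count< {δ = δ} {p = e , b} a))

-- Shortest paths and the pieces of the optimal tree

module Targets {n m : ℕ} (src tgt : Fin m → Fin n) (W : Fin m → ℕ) (k : ℕ)
              (simple : ∀ e f → src e ≡ src f → tgt e ≡ tgt f → e ≡ f) (r : Fin n) where

  open Algorithm src tgt W k
  open Growth src tgt W k simple

  -- A branch (e , u , v) hangs the new node v on u by the edge e; the latest branch comes first.
  Branch : Set
  Branch = Fin m × Fin n × Fin n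

  onto : List Branch → Fin n → Bool
  onto []                z = r == z
  onto ((e , u , v) ∷ L) z = (v == z) ∨ onto L z

  used : List Branch → Edges
  used []                f = false
  used ((e , u , v) ∷ L) f = (e == f) ∨ used L f

  total : List Branch → ℕ
  total []                = 0
  total ((e , u , v) ∷ L) = W e + total L

  -- The list is a leaf order of a tree inside `F`, so weights, distances and pieces can all be
  -- treated by induction on it.
  data Built (F : Edges) : List Branch → Set where
    []   : Built F []
    hang : ∀ {e u v L} → Built F L → F e ≡ true → Joins e u v → onto L u ≡ true → onto L v ≡ false →
           Built F ((e , u , v) ∷ L)

  used-onto : ∀ {F L e} → Built F L → used L e ≡ true → onto L (src e) ≡ true × onto L (tgt e) ≡ true
  used-onto {L = (f , u , v) ∷ L} {e} (hang B _ j u∈ _) p with ∨-true {f == e} p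
  ... | inj₂ q = ∨-introʳ {v == src e} (proj₁ (used-onto B q)) , ∨-introʳ {v == tgt e} (proj₂ (used-onto B q))
  ... | inj₁ q with refl ← ==⇒≡ {u = f} {e} q with j
  ...   | inj₁ (refl , refl) = ∨-introʳ {v == src e} u∈ , ∨-introˡ (==-refl v)
  ...   | inj₂ (refl , refl) = ∨-introˡ (==-refl v) , ∨-introʳ {v == tgt e} u∈

  used-⊆ : ∀ {F L} → Built F L → used L ⊆ F
  used-⊆ (hang {e} {L = L} B Fe _ _ _) f p with ∨-true {e == f} p
  ... | inj₁ q with refl ← ==⇒≡ {u = e} {f} q = Fe
  ... | inj₂ q = used-⊆ B f q

  -- Edges of `used L` have both ends in `onto L`, whereas each branch ends in a new node; so no
  -- edge is counted twice.
  total≤weigh : ∀ {F L} → Built F L → total L ≤ weigh W (used L) (allFin m)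
  total≤weigh [] = z≤n
  total≤weigh (hang {e} {u} {v} {L} B _ j _ v∉) = begin
    W e + total L                                              ≤⟨ +-mono-≤ (weigh-∈ W (∈-allFin e) (==-refl e)) (total≤weigh B) ⟩
    weigh W (e ==_) (allFin m) + weigh W (used L) (allFin m)   ≤⟨ weigh-disjoint W (e ==_) (used L) fresh (allFin m) ⟩
    weigh W (used ((e , u , v) ∷ L)) (allFin m)                ∎
    where
    open ≤-Reasoning
    fresh : ∀ f → (e == f) ≡ true → used L f ≡ false
    fresh f p with refl ← ==⇒≡ {u = e} {f} p with used L e in q
    ... | false = refl
    ... | true = contradiction (trans (sym v∉) (end j)) λ ()
      where
      end : Joins e u v → onto L v ≡ true
      end (inj₁ (_ , refl)) = proj₂ (used-onto B q)
      end (inj₂ (refl , _)) = proj₁ (used-onto B q)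

  total≤wt : ∀ {F L} → Built F L → total L ≤ wt F
  total≤wt {F} B = ≤-trans (total≤weigh B) (≤-trans (weigh-mono W (used-⊆ B) (allFin m)) (≤-reflexive (sym (wt≡weigh F))))

  size-onto≤ : ∀ L → weigh (λ _ → 1) (onto L) (allFin n) ≤ suc (length L)
  size-onto≤ [] = weigh-single (λ _ → 1) {x = r} (allFin⁺ n) (λ z p → sym (==⇒≡ p))
  size-onto≤ ((e , u , v) ∷ L) = ≤-trans (weigh-∪ (λ _ → 1) (v ==_) (onto L) (allFin n))
    (+-mono-≤ (weigh-single (λ _ → 1) {x = v} (allFin⁺ n) (λ z p → sym (==⇒≡ p))) (size-onto≤ L))

  size-onto≥ : ∀ {F L} → Built F L → suc (length L) ≤ weigh (λ _ → 1) (onto L) (allFin n)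
  size-onto≥ [] = weigh-∈ (λ _ → 1) (∈-allFin r) (==-refl r)
  size-onto≥ (hang {v = v} {L} B _ _ _ v∉) = ≤-trans
    (+-mono-≤ (weigh-∈ (λ _ → 1) (∈-allFin v) (==-refl v)) (size-onto≥ B))
    (weigh-disjoint (λ _ → 1) (v ==_) (onto L) (λ z p → subst (λ z → onto L z ≡ false) (==⇒≡ p) v∉) (allFin n))

  onto-root : ∀ L → onto L r ≡ true
  onto-root []                = ==-refl r
  onto-root ((e , u , v) ∷ L) = ∨-introʳ {v == r} (onto-root L)

  module _ (N : Fin n → Bool) (F : Edges)
           (walk : ∀ z → N z ≡ true → Star (λ u v → Σ (Fin m) λ e → F e ≡ true × Joins e u v) r z) where

    private
      exit : ∀ L {u z} → Star (λ u v → Σ (Fin m) λ e → F e ≡ true × Joins e u v) u z → onto L u ≡ true → onto L z ≡ false →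
             Σ Branch λ (e , a , b) → F e ≡ true × Joins e a b × onto L a ≡ true × onto L b ≡ false
      exit L ε p q = contradiction (trans (sym p) q) λ ()
      exit L {u} (_◅_ {j = v} (e , Fe , j) w) p q with onto L v in v∈
      ... | true  = exit L w v∈ q
      ... | false = (e , u , v) , Fe , j , p , v∈

    -- While a node of `N` is missing, the walk to it leaves the set reached so far, and the first
    -- edge on which it does so is the next branch. The new node may lie outside `N`: what matters
    -- is the number of branches.
    build : ∀ j → j < weigh (λ _ → 1) N (allFin n) → Σ (List Branch) λ L → Built F L × length L ≡ j
    build zero    _ = [] , [] , refl
    build (suc j) j< with build j (<-trans (n<1+n j) j<)
    ... | L , B , refl with any? (λ z → (N z ∧ not (onto L z)) Bool.≟ true)
    ...   | no none = contradiction j< (≤⇒≯ (≤-trans (weigh-mono (λ _ → 1) N⊆ (allFin n)) (size-onto≤ L)))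
      where
      N⊆ : N ⊆ onto L
      N⊆ z p with onto L z in q
      ... | true  = refl
      ... | false = contradiction (z , ∧-intro p (cong not q)) none
    ...   | yes (z , p) with onto L z in z∉
    ...     | true  = contradiction (proj₂ (∧-true {N z} p)) λ ()
    ...     | false with exit L (walk z (proj₁ (∧-true p))) (onto-root L) z∉
    ...       | (e , a , b) , Fe , j , a∈ , b∉ = (e , a , b) ∷ L , hang B Fe j a∈ b∉ , refl

  -- Membership in every closed set around `r`, which is what a saturated tree can be tested against
  -- directly.
  Reachable : Fin n → Set
  Reachable v = ∀ s → s r ≡ true → (∀ e → Closed s e) → s v ≡ true

  built-reachable : ∀ {F L z} → Built F L → onto L z ≡ true → Reachable z
  built-reachable [] p s sr c with refl ← ==⇒≡ {u = r} p = sr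
  built-reachable {z = z} (hang {e} {v = v} {L} B Fe j u∈ v∉) p s sr c with ∨-true {v == z} p
  ... | inj₂ q = built-reachable B q s sr c
  ... | inj₁ q with refl ← ==⇒≡ {u = v} {z} q = trans (sym (closed-Joins {s} j (c e))) (built-reachable B u∈ s sr c)

  -- What remains of "`P` contains a path from `r` to `v`": saturating with the edges of `P`
  -- permitted must draw in `v`.
  Leads : Fin n → Edges → Set
  Leads v P = ∀ s → s r ≡ true → (∀ e → P e ≡ true → Closed s e) → s v ≡ true

  relax-≤ : ∀ T v → wt (relax T v) ≤ wt (T v)
  relax-≤ T v = foldr-preserves (λ Q → wt Q ≤ wt (T v)) _ (graphOf T)
    (λ row Q _ → foldr-preserves (λ Q → wt Q ≤ wt (T v)) _ (allFin m) (λ e Q′ _ → step row e Q′)) ≤-refl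
    where
    step : ∀ row e Q → wt Q ≤ wt (T v) → wt (relaxStep v row e Q) ≤ wt (T v)
    step (u , P) e Q h with joins e u v ∧ (wt (add e P) <ᵇ wt Q) in eq
    ... | false = h
    ... | true  = ≤-trans (<⇒≤ (<ᵇ-true (proj₂ (∧-true {joins e u v} eq)))) h

  relax-edge : ∀ T {e u v} → Joins e u v → wt (relax T v) ≤ W e + wt (T u)
  relax-edge T {e} {u} {v} j = foldr-establishes Cheap _ (λ row Q → foldr-preserves Cheap _ (allFin m) (λ f Q _ → keep row f Q))
    (∈-graphOf T u) (λ Q → foldr-establishes Cheap _ (λ f Q → keep (u , T u) f Q) (∈-allFin e) improve)
    where
    Cheap : Edges → Set
    Cheap Q = wt Q ≤ W e + wt (T u)
    keep : ∀ row f Q → Cheap Q → Cheap (relaxStep v row f Q)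
    keep (a , P) f Q h with joins f a v ∧ (wt (add f P) <ᵇ wt Q) in eq
    ... | false = h
    ... | true  = ≤-trans (<⇒≤ (<ᵇ-true (proj₂ (∧-true {joins f a v} eq)))) h
    improve : ∀ Q → Cheap (relaxStep v (u , T u) e Q)
    improve Q rewrite Joins⇒joins j with wt (add e (T u)) <ᵇ wt Q in eq
    ... | true  = wt-add e (T u)
    ... | false = ≤-trans (<ᵇ-false {wt (add e (T u))} eq) (wt-add e (T u))

  -- Each branch costs one round of relaxation. The bound is the weight of the whole tree instead of
  -- the path to `z`, which is what D ≤ L asks for.
  paths-wt : ∀ {F L z} (vs : List (Fin n)) → Built F L → length L ≤ length vs → onto L z ≡ true →
             wt (foldr (λ _ → relax) (initial r) vs z) ≤ total L
  paths-wt {z = z} [] [] _ p with refl ← ==⇒≡ {u = r} {z} p = ≤-reflexive (wt-∅ (initial r r) (λ e → cong not (==-refl r)))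
  paths-wt {F} (v ∷ vs) [] _ p = ≤-trans (relax-≤ (foldr (λ _ → relax) (initial r) vs) _) (paths-wt {F} vs [] z≤n p)
  paths-wt {z = z} (w ∷ vs) (hang {e} {u} {v} {L} B Fe j u∈ v∉) (s≤s l≤) p with ∨-true {v == z} p
  ... | inj₂ q = ≤-trans (paths-wt (w ∷ vs) B (m≤n⇒m≤1+n l≤) q) (m≤n+m _ (W e))
  ... | inj₁ q with refl ← ==⇒≡ {u = v} {z} q = ≤-trans (relax-edge _ j) (+-monoʳ-≤ (W e) (paths-wt vs B l≤ u∈))

  -- Entries are not known to be paths, but leading to their node is invariant: the set of all edges
  -- leads to every reachable node, and an added edge carries this on to its other end.
  paths-lead : ∀ v → Reachable v → Leads v (paths r v)
  paths-lead = foldr-preserves (λ T → ∀ v → Reachable v → Leads v (T v)) _ (allFin n) (λ _ T _ ih v → relaxed T ih v) start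
    where
    start : ∀ v → Reachable v → Leads v (initial r v)
    start v reach s sr c with v == r in eq
    ... | true  = subst (λ v → s v ≡ true) (sym (==⇒≡ eq)) sr
    ... | false = reach s sr (λ e → c e refl)
    relaxed : ∀ T → (∀ v → Reachable v → Leads v (T v)) → ∀ v → Reachable v → Leads v (relax T v)
    relaxed T ih v reach = foldr-preserves (Leads v) _ (graphOf T)
      (λ row Q row∈ → foldr-preserves (Leads v) _ (allFin m) (λ e Q _ → step row row∈ e Q)) (ih v reach)
      where
      step : ∀ row → row ∈ graphOf T → ∀ e Q → Leads v Q → Leads v (relaxStep v row e Q)
      step (u , P) row∈ e Q h s sr c with joins e u v ∧ (wt (add e P) <ᵇ wt Q) in eq
      ... | false = h s sr c
      ... | true  = trans (sym (closed-Joins {s} j (c e (add-new e P))))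
                          (subst (Leads u) (sym (∈-graphOf⁻ T row∈)) (ih u (λ s sr c → trans (closed-Joins {s} j (c e)) (reach s sr c)))
                            s sr (λ f Pf → c f (add-⊇ e P f Pf)))
        where j = joins⇒Joins (proj₁ (∧-true eq))

  -- Cutting the heavy branches

  module Threshold (δ : ℕ) where

    reps : List Branch → List (Fin n)
    reps []                = []
    reps ((e , u , v) ∷ L) = if δ <ᵇ W e then v ∷ reps L else reps L

    -- Cutting the branches heavier than δ leaves pieces; each is named by its first node.
    label : List Branch → Fin n → Fin n
    label []                z = r
    label ((e , u , v) ∷ L) z = if v == z then (if δ <ᵇ W e then v else label L u) else label L z

    -- The way from a node back to the first node of its piece uses light branches only, so a set
    -- closed under light edges contains a piece entirely or not at all.
    label-closed : ∀ {F L z} s → (∀ e → W e ≤ δ → Closed s e) → Built F L → onto L z ≡ true → s z ≡ s (label L z)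
    label-closed {z = z} s c [] p with refl ← ==⇒≡ {u = r} {z} p = refl
    label-closed {z = z} s c (hang {e} {u} {v} {L} B Fe j u∈ v∉) p with v == z in eq
    ... | false = label-closed s c B p
    ... | true with refl ← ==⇒≡ {u = v} {z} eq with δ <ᵇ W e in h
    ...   | true  = refl
    ...   | false = trans (sym (closed-Joins {s} j (c e (<ᵇ-false {δ} h)))) (label-closed s c B u∈)

    label-reps : ∀ {F L z} → Built F L → onto L z ≡ true → label L z ≡ r ⊎ label L z ∈ reps L
    label-reps [] p = inj₁ refl
    label-reps {z = z} (hang {e} {u} {v} {L} B Fe j u∈ v∉) p with v == z in eq
    ... | false with δ <ᵇ W e | label-reps B p
    ...   | _     | inj₁ q = inj₁ q
    ...   | true  | inj₂ q = inj₂ (there q)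
    ...   | false | inj₂ q = inj₂ q
    label-reps {z = z} (hang {e} {u} {v} {L} B Fe j u∈ v∉) p | true with δ <ᵇ W e
    ...   | true  = inj₂ (here refl)
    ...   | false = label-reps B u∈

    reps-onto : ∀ {b} L → b ∈ reps L → onto L b ≡ true
    reps-onto {b} ((e , u , v) ∷ L) p with δ <ᵇ W e | p
    ... | true  | here refl = ∨-introˡ (==-refl v)
    ... | true  | there q   = ∨-introʳ {v == b} (reps-onto L q)
    ... | false | q         = ∨-introʳ {v == b} (reps-onto L q)

  open Threshold

  reps-total : ∀ t L → length (reps t L) * suc t ≤ total L
  reps-total t [] = z≤n
  reps-total t ((e , u , v) ∷ L) with t <ᵇ W e in eq
  ... | true  = +-mono-≤ (<ᵇ-true eq) (reps-total t L)
  ... | false = ≤-trans (reps-total t L) (m≤n+m _ (W e))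

  -- A branch that becomes heavy when the threshold falls from `t + 1` to `t` weighs exactly
  -- `t + 1`. Hence the threshold found is one that the search tries.
  reps-drop : ∀ t L → length (reps (suc t) L) < length (reps t L) → Σ (Fin m) λ e → suc t ≡ W e
  reps-drop t ((e , u , v) ∷ L) p with suc t <ᵇ W e in eq | t <ᵇ W e in eq′
  ... | true  | true  = reps-drop t L (≤-pred p)
  ... | true  | false = contradiction (<-≤-trans (<-trans (n<1+n t) (<ᵇ-true {suc t} {W e} eq)) (<ᵇ-false {t} {W e} eq′)) (<-irrefl refl)
  ... | false | true  = e , ≤-antisym (<ᵇ-true {t} {W e} eq′) (<ᵇ-false {suc t} {W e} eq)
  ... | false | false = reps-drop t L p

  reps-none : ∀ t L → total L ≤ t → reps t L ≡ []
  reps-none t [] _ = refl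
  reps-none t ((e , u , v) ∷ L) h rewrite ≤⇒<ᵇ-false {t} {W e} (≤-trans (m≤m+n _ (total L)) h) =
    reps-none t L (≤-trans (m≤n+m _ (W e)) h)

  -- Descend from `total L`, which no branch exceeds, until 0 is reached or the next lower threshold
  -- would make more than `h` branches heavy. In the latter case `h + 1` branches weigh `δ` or more.
  threshold : ∀ h L → Σ ℕ λ δ → (δ ≡ 0 ⊎ Σ (Fin m) λ e → δ ≡ W e) × length (reps δ L) ≤ h × suc h * δ ≤ total L
  threshold h L = descend (total L) (≤-trans (≤-reflexive (cong length (reps-none (total L) L ≤-refl))) z≤n)
    where
    descend : ∀ t → length (reps t L) ≤ h →
              Σ ℕ λ δ → (δ ≡ 0 ⊎ Σ (Fin m) λ e → δ ≡ W e) × length (reps δ L) ≤ h × suc h * δ ≤ total L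
    descend zero    p = 0 , inj₁ refl , p , ≤-trans (≤-reflexive (*-zeroʳ (suc h))) z≤n
    descend (suc t) p with length (reps t L) ≤? h
    ... | yes q = descend t q
    ... | no  q = suc t , inj₂ (reps-drop t L (<-≤-trans (s≤s p) (≰⇒> q))) , p ,
                  ≤-trans (*-monoˡ-≤ (suc t) (≰⇒> q)) (reps-total t L)

-- The approximation guarantee

-- Both inequalities may be weak: the first bounds h by √k, the second turns k δ into at most √k (h
-- + 1) δ. At a positive perfect square the recursion keeps the number one below the root.
√-floor : ∀ k → Σ ℕ λ h → h * h ≤ k × k ≤ suc h * suc h
√-floor zero = 0 , z≤n , z≤n
√-floor (suc k) with √-floor k
... | h , l , u with suc k ≤? suc h * suc h
...   | yes p = h , m≤n⇒m≤1+n l , p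
...   | no  p = suc h , m≤n⇒m≤1+n (≤-pred (≰⇒> p)) ,
                ≤-trans (s≤s u) (≤-trans (m≤m+n _ (2 + (h + h))) (≤-reflexive (next h)))
  where
  next : ∀ h → suc (suc h * suc h) + (2 + (h + h)) ≡ suc (suc h) * suc (suc h)
  next = solve-∀

-- The two sides differ by the square of the difference; the larger number is written as the smaller
-- plus `c` to avoid subtraction.
m+n-squared : ∀ a b → (a + b) * (a + b) ≤ 2 * (a * a + b * b)
m+n-squared a b with ≤-total a b
... | inj₁ a≤b with c , refl ← m≤n⇒∃[o]m+o≡n a≤b = ≤-trans (m≤m+n _ (c * c)) (≤-reflexive (eq a c))
  where eq : ∀ a c → (a + (a + c)) * (a + (a + c)) + c * c ≡ 2 * (a * a + (a + c) * (a + c))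
        eq = solve-∀
... | inj₂ b≤a with c , refl ← m≤n⇒∃[o]m+o≡n b≤a = ≤-trans (m≤m+n _ (c * c)) (≤-reflexive (eq b c))
  where eq : ∀ b c → ((b + c) + b) * ((b + c) + b) + c * c ≡ 2 * ((b + c) * (b + c) + b * b)
        eq = solve-∀

-- Both h D and k δ are at most √k L.
√-bound : ∀ {h k D δ L} → h * h ≤ k → k ≤ suc h * suc h → D ≤ L → suc h * δ ≤ L →
          (h * D + k * δ) * (h * D + k * δ) ≤ 4 * k * (L * L)
√-bound {h} {k} {D} {δ} {L} h²≤k k≤ D≤L δ≤ = begin
  (h * D + k * δ) * (h * D + k * δ)                       ≤⟨ m+n-squared (h * D) (k * δ) ⟩
  2 * ((h * D) * (h * D) + (k * δ) * (k * δ))             ≤⟨ *-monoʳ-≤ 2 (+-mono-≤ left right) ⟩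
  2 * (k * (L * L) + k * (L * L))                         ≡⟨ eq₃ k L ⟩
  4 * k * (L * L)                                         ∎
  where
  open ≤-Reasoning
  eq₁ : ∀ a b → (a * b) * (a * b) ≡ (a * a) * (b * b)
  eq₁ = solve-∀
  eq₂ : ∀ k s d → (k * k) * (d * d) ≡ k * (k * (d * d))
  eq₂ = solve-∀
  eq₃ : ∀ k L → 2 * (k * (L * L) + k * (L * L)) ≡ 4 * k * (L * L)
  eq₃ = solve-∀
  left : (h * D) * (h * D) ≤ k * (L * L)
  left = ≤-trans (≤-reflexive (eq₁ h D)) (*-mono-≤ h²≤k (*-mono-≤ D≤L D≤L))
  right : (k * δ) * (k * δ) ≤ k * (L * L)
  right = begin
    (k * δ) * (k * δ)                     ≡⟨ trans (eq₁ k δ) (eq₂ k k δ) ⟩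
    k * (k * (δ * δ))                     ≤⟨ *-monoʳ-≤ k (*-monoˡ-≤ (δ * δ) k≤) ⟩
    k * ((suc h * suc h) * (δ * δ))       ≡⟨ cong (k *_) (eq₁ (suc h) δ) ⟨
    k * ((suc h * δ) * (suc h * δ))       ≤⟨ *-monoʳ-≤ k (*-mono-≤ δ≤ δ≤) ⟩
    k * (L * L)                           ∎

module Approximation {n m : ℕ} (src tgt : Fin m → Fin n) (W : Fin m → ℕ) (k : ℕ)
                     (simple : ∀ e f → src e ≡ src f → tgt e ≡ tgt f → e ≡ f) where

  open Algorithm src tgt W k
  open Growth src tgt W k simple

  module _ {r : Fin n} {δ : ℕ} {D : Edges} {T : Table} where

    enlarge-cases : ∀ F → enlarge r δ D T F ≡ F ⊎
                    Σ Edges λ P → wt P ≤ wt D × enlarge r δ D T F ≡ grow r δ P F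
    enlarge-cases F = foldr-preserves (λ B → B ≡ F ⊎ Σ Edges λ P → wt P ≤ wt D × B ≡ grow r δ P F) _ (graphOf T) step (inj₁ refl)
      where
      step : ∀ row B → row ∈ graphOf T → B ≡ F ⊎ (Σ Edges λ P → wt P ≤ wt D × B ≡ grow r δ P F) →
             enlargeStep r δ D F row B ≡ F ⊎ (Σ Edges λ P → wt P ≤ wt D × enlargeStep r δ D F row B ≡ grow r δ P F)
      step (v , P) B _ ih with not (wt D <ᵇ wt P) ∧ (count r B <ᵇ count r (grow r δ P F)) in eq
      ... | false = ih
      ... | true  = inj₂ (P , affordable (proj₁ (∧-true {not (wt D <ᵇ wt P)} eq)) , refl)
        where
        affordable : not (wt D <ᵇ wt P) ≡ true → wt P ≤ wt D
        affordable p with wt D <ᵇ wt P in q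
        ... | false = <ᵇ-false {wt D} q

    enlarge-best : ∀ F v → wt (T v) ≤ wt D → count r (grow r δ (T v) F) ≤ count r (enlarge r δ D T F)
    enlarge-best F v cheap = foldr-establishes (λ B → count r (grow r δ (T v) F) ≤ count r B) _ keep (∈-graphOf T v) take
      where
      keep : ∀ row B → count r (grow r δ (T v) F) ≤ count r B → count r (grow r δ (T v) F) ≤ count r (enlargeStep r δ D F row B)
      keep (u , P) B h with not (wt D <ᵇ wt P) ∧ (count r B <ᵇ count r (grow r δ P F)) in eq
      ... | false = h
      ... | true  = ≤-trans h (<⇒≤ (<ᵇ-true (proj₂ (∧-true {not (wt D <ᵇ wt P)} eq))))
      take : ∀ B → count r (grow r δ (T v) F) ≤ count r (enlargeStep r δ D F (v , T v) B)
      take B rewrite ≤⇒<ᵇ-false cheap with count r B <ᵇ count r (grow r δ (T v) F) in eq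
      ... | true  = ≤-refl
      ... | false = <ᵇ-false {count r B} eq

    enlarge-preserves : ∀ (I : Edges → Set) → (∀ P {F} → I F → I (grow r δ P F)) → ∀ {F} → I F → I (enlarge r δ D T F)
    enlarge-preserves I h {F} i with enlarge-cases F
    ... | inj₁ eq = subst I (sym eq) i
    ... | inj₂ (P , _ , eq) = subst I (sym eq) (h P i)

    enlarge-full : ∀ F → k ≤ count r F → enlarge r δ D T F ≡ F
    enlarge-full F full with enlarge-cases F
    ... | inj₁ eq = eq
    ... | inj₂ (P , _ , eq) = trans eq (grow-full {r} {δ} P F full)

    greedy-Grown : Grown r (greedy r δ D T)
    greedy-Grown = foldr-preserves (Grown r) _ (allFin n)
      (λ _ F _ → enlarge-preserves (Grown r) (grow-Grown {r} {δ})) (grow-Grown {r} {δ} ∅ root)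

  -- The exchange argument

  module _ (r : Fin n) {F* : Edges} {L : List (Targets.Branch src tgt W k simple r)}
           (built : Targets.Built src tgt W k simple r F* L) (long : k ≤ suc (length L)) (short : length L ≤ n)
           (δ : ℕ) {h : ℕ} where

    open Targets src tgt W k simple r
    open Threshold δ

    module _ (few : length (reps L) ≤ h) (h≤n : h ≤ n) (D : Edges)
             (cheap : ∀ z → onto L z ≡ true → wt (paths r z) ≤ wt D) where

      private
        T : Table
        T = paths r

        S : Edges → Fin n → Bool
        S = covers r

        nodeCount : (Fin n → Bool) → ℕ
        nodeCount p = weigh (λ _ → 1) p (allFin n)

      piece : Fin n → Fin n → Bool
      piece b z = onto L z ∧ (b == label L z)

      pieces : List (Fin n) → Fin n → Bool
      pieces []      z = false
      pieces (b ∷ B) z = piece b z ∨ pieces B z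

      LightClosed : Edges → Set
      LightClosed F = ∀ e → W e ≤ δ → Closed (S F) e

      same-piece : ∀ {F b z} → LightClosed F → piece b z ≡ true → S F z ≡ S F b
      same-piece {F} {b} {z} c p = trans (label-closed (S F) c built (proj₁ (∧-true p)))
        (cong (S F) (sym (==⇒≡ (proj₂ (∧-true {onto L z} p)))))

      uncovered : (Fin n → Bool) → List (Fin n) → List (Fin n)
      uncovered s []      = []
      uncovered s (b ∷ B) = if s b then uncovered s B else b ∷ uncovered s B

      uncovered-⊆ : ∀ s B {b} → b ∈ uncovered s B → b ∈ B
      uncovered-⊆ s (c ∷ B) m with s c | m
      ... | true  | m′        = there (uncovered-⊆ s B m′)
      ... | false | here refl = here refl
      ... | false | there m′  = there (uncovered-⊆ s B m′)

      length-uncovered : ∀ s B → length (uncovered s B) ≤ length B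
      length-uncovered s [] = z≤n
      length-uncovered s (b ∷ B) with s b
      ... | true  = m≤n⇒m≤1+n (length-uncovered s B)
      ... | false = s≤s (length-uncovered s B)

      uncovered-shrinks : ∀ s B → length (uncovered s B) < length B ⊎ (∀ b → b ∈ B → s b ≡ false)
      uncovered-shrinks s [] = inj₂ λ b ()
      uncovered-shrinks s (b ∷ B) with s b in sb | uncovered-shrinks s B
      ... | true  | _      = inj₁ (s≤s (length-uncovered s B))
      ... | false | inj₁ p = inj₁ (s≤s p)
      ... | false | inj₂ q = inj₂ λ { c (here refl) → sb ; c (there m) → q c m }

      pieces-uncovered : ∀ {F} → LightClosed F → ∀ B z → pieces B z ≡ true → S F z ∨ pieces (uncovered (S F) B) z ≡ true
      pieces-uncovered {F} c (b ∷ B) z p with ∨-true {piece b z} p | S F b in Sb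
      ... | inj₁ q | true  = ∨-introˡ (trans (same-piece {F} c q) Sb)
      ... | inj₁ q | false = ∨-introʳ {S F z} (∨-introˡ q)
      ... | inj₂ q | true  = pieces-uncovered c B z q
      ... | inj₂ q | false with ∨-true {S F z} (pieces-uncovered c B z q)
      ...   | inj₁ x = ∨-introˡ x
      ...   | inj₂ x = ∨-introʳ {S F z} (∨-introʳ {piece b z} x)

      pieces-none : ∀ {F} → LightClosed F → ∀ B → (∀ b → b ∈ B → S F b ≡ false) → ∀ z → S F z ≡ true → pieces B z ≡ false
      pieces-none c [] h z p = refl
      pieces-none {F} c (b ∷ B) h z p with piece b z in q
      ... | true  = contradiction (trans (sym p) (trans (same-piece {F} c q) (h b (here refl)))) λ ()
      ... | false = pieces-none c B (λ b m → h b (there m)) z p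

      -- Nodes in the tree or in a piece still listed, overlaps counted once. With no piece listed
      -- this is the size of the tree.
      potential : Edges → List (Fin n) → ℕ
      potential F B = nodeCount (λ z → S F z ∨ pieces B z)

      potential-[] : ∀ F → potential F [] ≤ count r F
      potential-[] F = weigh-mono (λ _ → 1) (λ z p → drop p) (allFin n)
        where
        drop : ∀ {a} → a ∨ false ≡ true → a ≡ true
        drop {true} _ = refl

      -- Below `k` nodes the saturated set is closed under the edges of `T b`, which draw in `b`,
      -- and under light edges, which draw in the rest of its piece.
      grow-covers-piece : ∀ F b → onto L b ≡ true → count r (grow r δ (T b) F) < k → ∀ z → piece b z ≡ true → S (grow r δ (T b) F) z ≡ true
      grow-covers-piece F b b∈ c z p = trans (same-piece {grow r δ (T b) F} (λ e We → grow-closed (T b) F c e (inj₂ We)) p)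
        (paths-lead b (built-reachable built b∈) (S (grow r δ (T b) F)) (covers-root (grow r δ (T b) F))
          (λ e Te → grow-closed (T b) F c e (inj₁ Te)))

      enlarge-closed : ∀ F → LightClosed F → count r (enlarge r δ D T F) < k → LightClosed (enlarge r δ D T F)
      enlarge-closed F closed small with enlarge-cases {r} {δ} {D} {T} F
      ... | inj₁ eq = subst LightClosed (sym eq) closed
      ... | inj₂ (P , _ , eq) = subst LightClosed (sym eq)
              (λ e We → grow-closed P F (subst (λ F → count r F < k) eq small) e (inj₂ We))

      -- If the enlarged tree meets listed pieces, it contains them, and striking them off loses no
      -- node. If it meets none, `b` is struck off: by the greedy choice the tree is at least as
      -- large as the one grown towards `b`, which contains `F` and the piece of `b`, and as it is
      -- disjoint from the remaining pieces the sizes add up.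
      exchange : ∀ F b B → (∀ c → c ∈ b ∷ B → onto L c ≡ true) → LightClosed F → count r (enlarge r δ D T F) < k →
                 Σ (List (Fin n)) λ B′ → (∀ c → c ∈ B′ → c ∈ b ∷ B) × length B′ ≤ length B ×
                 LightClosed (enlarge r δ D T F) × potential F (b ∷ B) ≤ potential (enlarge r δ D T F) B′
      exchange F b B B∈ closed small with uncovered-shrinks (S (enlarge r δ D T F)) (b ∷ B)
      ... | inj₁ shrinks = uncovered (S F′) (b ∷ B) , (λ c → uncovered-⊆ (S F′) (b ∷ B)) , ≤-pred shrinks , closed′ ,
            weigh-mono (λ _ → 1) swallow (allFin n)
        where
        F′ = enlarge r δ D T F
        F⊆F′ : F ⊆ F′
        F⊆F′ = enlarge-preserves {r} {δ} {D} {T} (F ⊆_) (λ P {F″} i e z → grow-⊇ P F″ e (i e z)) (λ e z → z)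
        closed′ = enlarge-closed F closed small
        swallow : (λ z → S F z ∨ pieces (b ∷ B) z) ⊆ (λ z → S F′ z ∨ pieces (uncovered (S F′) (b ∷ B)) z)
        swallow z p with ∨-true {S F z} p
        ... | inj₁ q = ∨-introˡ (covers-mono F⊆F′ z q)
        ... | inj₂ q = pieces-uncovered {F′} closed′ (b ∷ B) z q
      ... | inj₂ none = B , (λ c → there) , ≤-refl , closed′ , (begin
            potential F (b ∷ B)                                       ≤⟨ weigh-mono (λ _ → 1) reorder (allFin n) ⟩
            nodeCount (λ z → (S F z ∨ piece b z) ∨ pieces B z)             ≤⟨ weigh-∪ (λ _ → 1) (λ z → S F z ∨ piece b z) (pieces B) (allFin n) ⟩
            nodeCount (λ z → S F z ∨ piece b z) + nodeCount (pieces B)          ≤⟨ +-monoˡ-≤ _ (weigh-mono (λ _ → 1) inside (allFin n)) ⟩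
            count r (grow r δ (T b) F) + nodeCount (pieces B)              ≤⟨ +-monoˡ-≤ _ bigger ⟩
            count r F′ + nodeCount (pieces B)                              ≤⟨ weigh-disjoint (λ _ → 1) (S F′) (pieces B) (pieces-none {F′} closed′ B (λ c m → none c (there m))) (allFin n) ⟩
            potential F′ B                                            ∎)
        where
        open ≤-Reasoning
        F′ = enlarge r δ D T F
        closed′ = enlarge-closed F closed small
        bigger : count r (grow r δ (T b) F) ≤ count r F′
        bigger = enlarge-best {r} {δ} {D} {T} F b (cheap b (B∈ b (here refl)))
        reorder : (λ z → S F z ∨ pieces (b ∷ B) z) ⊆ (λ z → (S F z ∨ piece b z) ∨ pieces B z)
        reorder z p with ∨-true {S F z} p
        ... | inj₁ q = ∨-introˡ (∨-introˡ q)
        ... | inj₂ q with ∨-true {piece b z} q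
        ...   | inj₁ x = ∨-introˡ (∨-introʳ {S F z} x)
        ...   | inj₂ x = ∨-introʳ {S F z ∨ piece b z} x
        inside : (λ z → S F z ∨ piece b z) ⊆ S (grow r δ (T b) F)
        inside z p with ∨-true {S F z} p
        ... | inj₁ q = covers-mono (grow-⊇ (T b) F) z q
        ... | inj₂ q = grow-covers-piece F b (B∈ b (here refl)) (≤-<-trans bigger small) z q

      Full : Edges → Set
      Full F = k ≤ count r F × wt F ≤ h * wt D + k * δ

      -- After t enlargements all but h ∸ t of the pieces are made up for.
      Partial : ℕ → Edges → Set
      Partial t F = LightClosed F × Σ (List (Fin n)) λ B → (∀ b → b ∈ B → onto L b ≡ true) × length B + t ≤ h × k ≤ potential F B

      -- Until `k` nodes are reached, each enlargement is charged `wt D` and each node δ; the cap at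
      -- `k` turns the latter into `k * δ` in the end.
      Invariant : ℕ → Edges → Set
      Invariant t F = Full F ⊎ (wt F ≤ t * wt D + (count r F ⊓ k) * δ × Partial t F)

      enlarge-wt : ∀ t F → wt F ≤ t * wt D + (count r F ⊓ k) * δ →
                   wt (enlarge r δ D T F) ≤ suc t * wt D + (count r (enlarge r δ D T F) ⊓ k) * δ
      enlarge-wt t F p with enlarge-cases {r} {δ} {D} {T} F
      ... | inj₁ eq = subst (λ F′ → wt F′ ≤ suc t * wt D + (count r F′ ⊓ k) * δ) (sym eq)
                        (≤-trans p (+-monoˡ-≤ _ (m≤n+m _ (wt D))))
      ... | inj₂ (P , P≤ , eq) = subst (λ F′ → wt F′ ≤ suc t * wt D + (count r F′ ⊓ k) * δ) (sym eq)
        (grow-wt P {F} {suc t * wt D} (≤-trans (wt-∪ F P) (≤-trans (+-mono-≤ p P≤)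
          (≤-reflexive (trans (+-comm _ (wt D)) (sym (+-assoc (wt D) _ _)))))))

      full : ∀ t F → t ≤ h → k ≤ count r F → wt F ≤ t * wt D + (count r F ⊓ k) * δ → Full F
      full t F t≤h k≤ p = k≤ , ≤-trans p (+-mono-≤ (*-monoˡ-≤ (wt D) t≤h) (*-monoˡ-≤ δ (m⊓n≤n (count r F) k)))

      step : ∀ t F → Invariant t F → Invariant (suc t) (enlarge r δ D T F)
      step t F (inj₁ f) = inj₁ (subst Full (sym (enlarge-full {r} {δ} {D} {T} F (proj₁ f))) f)
      -- With no piece left the potential counts the tree alone, which therefore has `k` nodes.
      step t F (inj₂ (p , closed , [] , B∈ , t≤ , k≤)) =
        step t F (inj₁ (full t F t≤ (≤-trans k≤ (potential-[] F)) p))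
      step t F (inj₂ (p , closed , b ∷ B , B∈ , t≤ , k≤)) with k ≤? count r (enlarge r δ D T F)
      ... | yes q = inj₁ (full (suc t) _ (≤-trans (s≤s (m≤n+m t (length B))) t≤) q (enlarge-wt t F p))
      ... | no  q = let B′ , B′⊆ , l≤ , closed′ , pot≤ = exchange F b B B∈ closed (≰⇒> q) in
            inj₂ (enlarge-wt t F p , closed′ , B′ , (λ c m → B∈ c (B′⊆ c m)) ,
                  ≤-trans (≤-reflexive (+-suc _ t)) (≤-trans (s≤s (+-monoˡ-≤ t l≤)) t≤) , ≤-trans k≤ pot≤)

      start : Invariant 0 (grow r δ ∅ ∅)
      start with k ≤? count r (grow r δ ∅ ∅)
      ... | yes q = inj₁ (full 0 _ z≤n q (grow-wt ∅ {∅} {0} (≤-trans (≤-reflexive (wt-∅ _ (λ _ → refl))) z≤n)))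
      ... | no  q = inj₂ (grow-wt ∅ {∅} {0} (≤-trans (≤-reflexive (wt-∅ _ (λ _ → refl))) z≤n) , closed ,
                          reps L , (λ b → reps-onto L) , ≤-trans (≤-reflexive (+-identityʳ _)) few ,
                          ≤-trans (≤-trans long (size-onto≥ built)) (weigh-mono (λ _ → 1) cover (allFin n)))
        where
        F₀ = grow r δ ∅ ∅
        closed : LightClosed F₀
        closed e We = grow-closed ∅ ∅ (≰⇒> q) e (inj₂ We)
        in-pieces : ∀ B {b z} → b ∈ B → piece b z ≡ true → pieces B z ≡ true
        in-pieces (b ∷ B)         (here refl) p = ∨-introˡ p
        in-pieces (c ∷ B) {z = z} (there m)   p = ∨-introʳ {piece c z} (in-pieces B m p)
        -- The piece of `r` has no representative in `reps L`; it is already inside the saturated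
        -- tree, as `r` is.
        cover : onto L ⊆ (λ z → S F₀ z ∨ pieces (reps L) z)
        cover z p with label-reps built p
        ... | inj₁ eq = ∨-introˡ (trans (label-closed (S F₀) closed built p) (trans (cong (S F₀) eq) (covers-root F₀)))
        ... | inj₂ m  = ∨-introʳ {S F₀ z} (in-pieces (reps L) m (∧-intro p (==-refl (label L z))))

      rounds : ∀ (vs : List (Fin n)) → Invariant (length vs) (foldr (λ _ → enlarge r δ D T) (grow r δ ∅ ∅) vs)
      rounds []       = start
      rounds (v ∷ vs) = step (length vs) _ (rounds vs)

      greedy-Full : Full (greedy r δ D T)
      greedy-Full with rounds (allFin n)
      ... | inj₁ f = f
      ... | inj₂ (p , closed , [] , B∈ , t≤ , k≤) = full _ _ t≤ (≤-trans k≤ (potential-[] _)) p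
      -- A piece left over after `n` rounds would force `h` above `n`.
      ... | inj₂ (p , closed , b ∷ B , B∈ , t≤ , k≤) = contradiction h≤n (<⇒≱ (≤-trans (s≤s (m≤n+m n (length B)))
              (subst (λ t → suc (length B) + t ≤ h) (length-allFin n) t≤)))

  -- The best of all candidates

  GrownRooted : Rooted → Set
  GrownRooted B = Grown (proj₁ B) (proj₂ B)

  pick-Grown : ∀ C B → GrownRooted C → GrownRooted B → GrownRooted (pick C B)
  pick-Grown (r , F) (s , B) c b with not (count r F <ᵇ k) ∧ ((count s B <ᵇ k) ∨ (wt F <ᵇ wt B))
  ... | true  = c
  ... | false = b

  Good : ℕ → Rooted → Set
  Good X B = k ≤ count (proj₁ B) (proj₂ B) × wt (proj₂ B) ≤ X

  pick-keeps : ∀ {X} C B → Good X B → Good X (pick C B)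
  pick-keeps (r , F) (s , B) (b , w) with count r F <ᵇ k in eq₁
  ... | true = b , w
  ... | false rewrite ≤⇒<ᵇ-false b with wt F <ᵇ wt B in eq₂
  ...   | true  = <ᵇ-false {count r F} eq₁ , ≤-trans (<⇒≤ (<ᵇ-true eq₂)) w
  ...   | false = b , w

  pick-takes : ∀ {X} C B → Good X C → Good X (pick C B)
  pick-takes (r , F) (s , B) (c , w) rewrite ≤⇒<ᵇ-false c with count s B <ᵇ k in eq₁
  ... | true = c , w
  ... | false with wt F <ᵇ wt B in eq₂
  ...   | true  = c , w
  ...   | false = <ᵇ-false {count s B} eq₁ , ≤-trans (<ᵇ-false {wt F} eq₂) w

  searchδ-preserves : ∀ (I : Rooted → Set) r T D → (∀ δ B → I B → I (attempt r T D δ B)) → ∀ B → I B → I (searchδ r T D B)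
  searchδ-preserves I r T D h B i = foldr-preserves I _ (allFin m) (λ e B _ → h (W e) B) (h 0 B i)

  search-Grown : ∀ r₀ → GrownRooted (search r₀)
  search-Grown r₀ = foldr-preserves GrownRooted _ (allFin n) (λ r B _ → foldr-preserves GrownRooted _ (graphOf (paths r))
    λ row B _ → searchδ-preserves GrownRooted r (paths r) (proj₂ row)
      (λ δ B b → pick-Grown (r , greedy r δ (proj₂ row) (paths r)) B (greedy-Grown {r} {δ} {proj₂ row} {paths r}) b) B) root

  -- A good incumbent is replaced only by a lighter tree with enough nodes, so it suffices that one
  -- triple of parameters tried by the search gives a good tree.
  search-Good : ∀ {X} r₀ r v δ → δ ≡ 0 ⊎ (Σ (Fin m) λ e → δ ≡ W e) →
                Good X (r , greedy r δ (paths r v) (paths r)) → Good X (search r₀)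
  search-Good {X} r₀ r v δ δ∈ g = foldr-establishes (Good X) _ (λ r B → keepD r B) (∈-allFin r)
    (λ B → foldr-establishes (Good X) _ (λ row → keepδ r (proj₂ row)) (∈-graphOf (paths r) v) (λ B → found δ∈ B))
    where
    keep : ∀ r D δ B → Good X B → Good X (attempt r (paths r) D δ B)
    keep r D δ B = pick-keeps (r , greedy r δ D (paths r)) B
    keepδ : ∀ r D B → Good X B → Good X (searchδ r (paths r) D B)
    keepδ r D = searchδ-preserves (Good X) r (paths r) D (keep r D)
    keepD : ∀ r B → Good X B → Good X (searchD r (paths r) B)
    keepD r B = foldr-preserves (Good X) _ (graphOf (paths r)) (λ row B _ → keepδ r (proj₂ row) B)
    found : δ ≡ 0 ⊎ (Σ (Fin m) λ e → δ ≡ W e) → ∀ B → Good X (searchδ r (paths r) (paths r v) B)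
    found (inj₁ refl) B = foldr-preserves (Good X) _ (allFin m) (λ e B _ → keep r (paths r v) (W e) B)
      (pick-takes (r , greedy r 0 (paths r v) (paths r)) B g)
    found (inj₂ (e , refl)) B = foldr-establishes (Good X) _ (λ e B → keep r (paths r v) (W e) B) (∈-allFin e)
      (λ B → pick-takes (r , greedy r (W e) (paths r v) (paths r)) B g)

  -- Supplies the budget: the table entry of the farthest node of the target tree makes all of its
  -- nodes affordable.
  argmax : ∀ {A : Set} (f : A → ℕ) (p : A → Bool) {x₀} → p x₀ ≡ true → ∀ xs →
           Σ A λ x → p x ≡ true × ∀ y → y ∈ xs → p y ≡ true → f y ≤ f x
  argmax f p {x₀} p₀ [] = x₀ , p₀ , λ y ()
  argmax f p p₀ (z ∷ xs) with argmax f p p₀ xs | p z in pz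
  ... | x , px , best | false = x , px , λ { y (here refl) py → contradiction (trans (sym pz) py) λ () ; y (there m) py → best y m py }
  ... | x , px , best | true with ≤-total (f z) (f x)
  ...   | inj₁ le = x , px , λ { y (here refl) _ → le ; y (there m) py → best y m py }
  ...   | inj₂ le = z , pz , λ { y (here refl) _ → ≤-refl ; y (there m) py → ≤-trans (best y m py) le }

  -- The parameters of the good candidate: `build` extracts from `F` a tree with `k` nodes around
  -- `r`, `D` is the entry of its farthest node, and δ is its threshold for `h`. From h ≤ h² ≤ k ≤ n
  -- the `n` rounds are enough.
  search-approximates : ∀ (N : Fin n → Bool) (F : Edges) (r r₀ : Fin n) →
    (∀ z → N z ≡ true → Star (λ u v → Σ (Fin m) λ e → F e ≡ true × Joins e u v) r z) →
    weigh (λ _ → 1) N (allFin n) ≡ k → 1 ≤ k → k ≤ n → let s , B = search r₀ in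
    k ≤ count s B × wt B * wt B ≤ 4 * k * (wt F * wt F)
  search-approximates N F r r₀ walk N≡k (s≤s {n = j} z≤n) k≤n =
    let open Targets src tgt W k simple r
        L , built , len = build N F walk j (≤-reflexive (sym N≡k))
        h , h²≤k , k≤ = √-floor k
        δ , δ∈ , few , δ≤ = threshold h L
        v , v∈ , far = argmax (λ z → wt (paths r z)) (onto L) (onto-root L) (allFin n)
        L≤n = ≤-trans (≤-reflexive len) (≤-trans (n≤1+n j) k≤n)
        D≤ = ≤-trans (paths-wt (allFin n) built (≤-trans L≤n (≤-reflexive (sym (length-allFin n)))) v∈) (total≤wt built)
        h≤n = ≤-trans (≤-trans (h≤h² h) h²≤k) k≤n
        enough , light = search-Good r₀ r v δ δ∈ (greedy-Full r built (s≤s (≤-reflexive (sym len))) L≤n δ {h} few h≤n (paths r v) (λ z → far z (∈-allFin z)))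
    in enough , ≤-trans (*-mono-≤ light light) (√-bound {h} {k} {wt (paths r v)} {δ} h²≤k k≤ D≤ (≤-trans δ≤ (total≤wt built)))
    where
    h≤h² : ∀ h → h ≤ h * h
    h≤h² zero    = z≤n
    h≤h² (suc h) = m≤m+n (suc h) (h * suc h)

-- Clearing denominators

ι : ℕ → ℚ
ι a = ℤ.+ a ℚ./ 1

toℚᵘ-ι : ∀ a → toℚᵘ (ι a) ≃ mkℚᵘ (ℤ.+ a) 0
toℚᵘ-ι a = ℚₚ.toℚᵘ-fromℚᵘ (mkℚᵘ (ℤ.+ a) 0)

ι-+ : ∀ a b → ι (a + b) ≡ ι a ℚ.+ ι b
ι-+ a b = ℚₚ.toℚᵘ-injective (begin-equality
  toℚᵘ (ι (a + b))                      ≃⟨ toℚᵘ-ι (a + b) ⟩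
  mkℚᵘ (ℤ.+ (a + b)) 0                    ≃⟨ *≡* (cong (ℤ._* ℤ.+ 1) (sym (cong₂ ℤ._+_ (ℤₚ.*-identityʳ (ℤ.+ a)) (ℤₚ.*-identityʳ (ℤ.+ b))))) ⟩
  mkℚᵘ (ℤ.+ a) 0 ℚᵘ.+ mkℚᵘ (ℤ.+ b) 0        ≃⟨ ℚᵘₚ.+-cong (toℚᵘ-ι a) (toℚᵘ-ι b) ⟨
  toℚᵘ (ι a) ℚᵘ.+ toℚᵘ (ι b)            ≃⟨ ℚₚ.toℚᵘ-homo-+ (ι a) (ι b) ⟨
  toℚᵘ (ι a ℚ.+ ι b)                    ∎)
  where open ℚᵘₚ.≤-Reasoning

ι-* : ∀ a b → ι (a * b) ≡ ι a ℚ.* ι b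
ι-* a b = ℚₚ.toℚᵘ-injective (begin-equality
  toℚᵘ (ι (a * b))                      ≃⟨ toℚᵘ-ι (a * b) ⟩
  mkℚᵘ (ℤ.+ (a * b)) 0                    ≃⟨ *≡* (cong (ℤ._* ℤ.+ 1) (ℤₚ.pos-* a b)) ⟩
  mkℚᵘ (ℤ.+ a) 0 ℚᵘ.* mkℚᵘ (ℤ.+ b) 0        ≃⟨ ℚᵘₚ.*-cong (toℚᵘ-ι a) (toℚᵘ-ι b) ⟨
  toℚᵘ (ι a) ℚᵘ.* toℚᵘ (ι b)            ≃⟨ ℚₚ.toℚᵘ-homo-* (ι a) (ι b) ⟨
  toℚᵘ (ι a ℚ.* ι b)                    ∎)
  where open ℚᵘₚ.≤-Reasoning

ι-≤ : ∀ {a b} → a ≤ b → ι a ℚ.≤ ι b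
ι-≤ {a} {b} a≤b = ℚₚ.toℚᵘ-cancel-≤ (begin
  toℚᵘ (ι a)      ≃⟨ toℚᵘ-ι a ⟩
  mkℚᵘ (ℤ.+ a) 0    ≤⟨ *≤* (ℤₚ.*-monoʳ-≤-nonNeg (ℤ.+ 1) (ℤ.+≤+ a≤b)) ⟩
  mkℚᵘ (ℤ.+ b) 0    ≃⟨ toℚᵘ-ι b ⟨
  toℚᵘ (ι b)      ∎)
  where open ℚᵘₚ.≤-Reasoning

ι-positive : ∀ a .{{_ : NonZero a}} → Positive (ι a)
ι-positive a = ℚₚ.normalize-pos a 1

clear-denominator : ∀ q → 0ℚ ℚ.≤ q → q ℚ.* ι (↧ₙ q) ≡ ι ℤ.∣ ↥ q ∣
clear-denominator q@(mkℚ p d _) 0≤q = ℚₚ.toℚᵘ-injective (begin-equality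
  toℚᵘ (q ℚ.* ι (suc d))                ≃⟨ ℚₚ.toℚᵘ-homo-* q (ι (suc d)) ⟩
  mkℚᵘ p d ℚᵘ.* toℚᵘ (ι (suc d))        ≃⟨ ℚᵘₚ.*-cong (ℚᵘₚ.≃-refl {mkℚᵘ p d}) (toℚᵘ-ι (suc d)) ⟩
  mkℚᵘ p d ℚᵘ.* mkℚᵘ (ℤ.+ suc d) 0        ≃⟨ *≡* (trans (ℤₚ.*-identityʳ _) (trans (cong (ℤ._* ℤ.+ suc d) (sym ∣p∣≡p)) (cong (λ x → ℤ.+ ℤ.∣ p ∣ ℤ.* ℤ.+ suc x) (sym (*-identityʳ d))))) ⟩
  mkℚᵘ (ℤ.+ ℤ.∣ p ∣) 0                    ≃⟨ toℚᵘ-ι ℤ.∣ p ∣ ⟨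
  toℚᵘ (ι ℤ.∣ p ∣)                      ∎)
  where
  open ℚᵘₚ.≤-Reasoning
  ∣p∣≡p : ℤ.+ ℤ.∣ p ∣ ≡ p
  ∣p∣≡p = ℤₚ.0≤i⇒+∣i∣≡i (subst₂ ℤ._≤_ (ℤₚ.*-zeroˡ (ℤ.+ suc d)) (ℤₚ.*-identityʳ p) (ℚₚ.drop-*≤* 0≤q))

*-cancelʳ : ∀ {p q} r .{{_ : Positive r}} → p ℚ.* r ≡ q ℚ.* r → p ≡ q
*-cancelʳ r eq = ℚₚ.≤-antisym (ℚₚ.*-cancelʳ-≤-pos r (ℚₚ.≤-reflexive eq)) (ℚₚ.*-cancelʳ-≤-pos r (ℚₚ.≤-reflexive (sym eq)))

module _ {A : Set} (d : A → ℕ) where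

  prod : List A → ℕ
  prod = foldr (λ f w → d f * w) 1

  module _ (same : A → Bool) (e : A) (same-e : same e ≡ true) (only-e : ∀ f → same f ≡ true → f ≡ e) (c : ℕ) where

    private
      others : List A → ℕ
      others = foldr (λ f w → (if same f then 1 else d f) * w) c

    others-∉ : ∀ xs → (∀ x → x ∈ xs → e ≢ x) → others xs ≡ c * prod xs
    others-∉ [] h = sym (*-identityʳ c)
    others-∉ (x ∷ xs) h with same x in s
    ... | true  = contradiction (sym (only-e x s)) (h x (here refl))
    ... | false = trans (cong (d x *_) (others-∉ xs (λ y m → h y (there m))))
                    (trans (sym (*-assoc (d x) c _)) (trans (cong (_* prod xs) (*-comm (d x) c)) (*-assoc c (d x) _)))

    -- Leaving out the factor at `e` replaces a division by `d e`; as `xs` has no repetitions,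
    -- exactly one factor is left out.
    others-∈ : ∀ {xs} → Unique xs → e ∈ xs → others xs * d e ≡ c * prod xs
    others-∈ {x ∷ xs} (x∉ ∷ u) (here refl) rewrite same-e | +-identityʳ (others xs) | others-∉ xs (λ y m → All.lookup x∉ m) =
      trans (*-assoc c (prod xs) (d e)) (cong (c *_) (*-comm (prod xs) (d e)))
    others-∈ {x ∷ xs} (x∉ ∷ u) (there m) with same x in s
    ... | true  = contradiction (only-e x s) (All.lookup x∉ m)
    ... | false = trans (*-assoc (d x) (others xs) (d e)) (trans (cong (d x *_) (others-∈ u m))
                    (trans (sym (*-assoc (d x) c _)) (trans (cong (_* prod xs) (*-comm (d x) c)) (*-assoc c (d x) _))))

  prod-nonZero : (∀ x → NonZero (d x)) → ∀ xs → NonZero (prod xs)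
  prod-nonZero h [] = _
  prod-nonZero h (x ∷ xs) = m*n≢0 (d x) (prod xs) {{h x}} {{prod-nonZero h xs}}

scaled-weight : ∀ (q : ℚ) (Π w : ℕ) → 0ℚ ℚ.≤ q → w * ↧ₙ q ≡ ℤ.∣ ↥ q ∣ * Π → q ℚ.* ι Π ≡ ι w
scaled-weight q Π w 0≤q eq = *-cancelʳ (ι (↧ₙ q)) {{ι-positive (↧ₙ q)}} (begin
  q ℚ.* ι Π ℚ.* ι (↧ₙ q)          ≡⟨ ℚₚ.*-assoc q (ι Π) _ ⟩
  q ℚ.* (ι Π ℚ.* ι (↧ₙ q))        ≡⟨ cong (q ℚ.*_) (ℚₚ.*-comm (ι Π) _) ⟩
  q ℚ.* (ι (↧ₙ q) ℚ.* ι Π)        ≡⟨ ℚₚ.*-assoc q _ (ι Π) ⟨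
  q ℚ.* ι (↧ₙ q) ℚ.* ι Π          ≡⟨ cong (ℚ._* ι Π) (clear-denominator q 0≤q) ⟩
  ι ℤ.∣ ↥ q ∣ ℚ.* ι Π             ≡⟨ ι-* ℤ.∣ ↥ q ∣ Π ⟨
  ι (ℤ.∣ ↥ q ∣ * Π)               ≡⟨ cong ι eq ⟨
  ι (w * ↧ₙ q)                    ≡⟨ ι-* w (↧ₙ q) ⟩
  ι w ℚ.* ι (↧ₙ q)                ∎)
  where open ≡-Reasoning

scaled-sum : ∀ {m} (weight : Fin m → ℚ) (W : Fin m → ℕ) (Π : ℕ) → (∀ e → weight e ℚ.* ι Π ≡ ι (W e)) →
             ∀ (F : Fin m → Bool) → sum (λ e → if F e then weight e else 0ℚ) ℚ.* ι Π ≡ ι (weigh W F (allFin m))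
scaled-sum {m} weight W Π h F = go id
  where
  go : ∀ {n} (g : Fin n → Fin m) → sum (λ i → if F (g i) then weight (g i) else 0ℚ) ℚ.* ι Π ≡ ι (weigh W F (tabulate g))
  go {zero}  g = ℚₚ.*-zeroˡ (ι Π)
  go {suc n} g with F (g Fin.zero)
  ... | true  = trans (ℚₚ.*-distribʳ-+ (ι Π) (weight (g Fin.zero)) _)
                  (trans (cong₂ ℚ._+_ (h (g Fin.zero)) (go (g ∘ Fin.suc))) (sym (ι-+ (W (g Fin.zero)) _)))
  ... | false = trans (cong (ℚ._* ι Π) (ℚₚ.+-identityˡ (sum (λ i → if F (g (Fin.suc i)) then weight (g (Fin.suc i)) else 0ℚ)))) (go (g ∘ Fin.suc))

-- Both sides are quadratic in the weights, so the square of the common factor `Π` cancels.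
unscale : ∀ {t t* : ℚ} {w w* : ℕ} (Π c k : ℕ) .{{_ : NonZero Π}} → t ℚ.* ι Π ≡ ι w → t* ℚ.* ι Π ≡ ι w* →
          w * w ≤ c * c * k * (w* * w*) → t ≤[ c √ k ] t*
unscale {t} {t*} {w} {w*} Π c k h h* le = ℚₚ.*-cancelʳ-≤-pos (ι Π ℚ.* ι Π) {{ℚₚ.pos*pos⇒pos (ι Π) {{ι-positive Π}} (ι Π) {{ι-positive Π}}}} (begin
  (t ℚ.* t) ℚ.* (ι Π ℚ.* ι Π)                      ≡⟨ medial t t (ι Π) (ι Π) ⟩
  (t ℚ.* ι Π) ℚ.* (t ℚ.* ι Π)                      ≡⟨ cong₂ ℚ._*_ h h ⟩
  ι w ℚ.* ι w                                      ≡⟨ ι-* w w ⟨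
  ι (w * w)                                        ≤⟨ ι-≤ le ⟩
  ι (c * c * k * (w* * w*))                        ≡⟨ trans (ι-* (c * c * k) (w* * w*)) (cong (ι (c * c * k) ℚ.*_) (ι-* w* w*)) ⟩
  ι (c * c * k) ℚ.* (ι w* ℚ.* ι w*)                ≡⟨ cong (ι (c * c * k) ℚ.*_) (cong₂ ℚ._*_ h* h*) ⟨
  ι (c * c * k) ℚ.* ((t* ℚ.* ι Π) ℚ.* (t* ℚ.* ι Π)) ≡⟨ cong (ι (c * c * k) ℚ.*_) (medial t* t* (ι Π) (ι Π)) ⟨
  ι (c * c * k) ℚ.* ((t* ℚ.* t*) ℚ.* (ι Π ℚ.* ι Π)) ≡⟨ ℚₚ.*-assoc (ι (c * c * k)) (t* ℚ.* t*) _ ⟨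
  (ι (c * c * k) ℚ.* (t* ℚ.* t*)) ℚ.* (ι Π ℚ.* ι Π) ∎)
  where
  open ℚₚ.≤-Reasoning
  medial : ∀ a b c d → (a ℚ.* b) ℚ.* (c ℚ.* d) ≡ (a ℚ.* c) ℚ.* (b ℚ.* d)
  medial = interchange (record { isCommutativeSemigroup = record { isSemigroup = ℚₚ.*-isSemigroup ; comm = ℚₚ.*-comm } })

-- Grown edge sets are trees

∈-tabulate⁺ : ∀ {n} {p : Fin n → Bool} {x} → p x ≡ true → x Subset.∈ Vec.tabulate p
∈-tabulate⁺ {p = p} {x} q = lookup⇒[]= x (Vec.tabulate p) (trans (lookup∘tabulate p x) q)

∈-tabulate⁻ : ∀ {n} {p : Fin n → Bool} {x} → x Subset.∈ Vec.tabulate p → p x ≡ true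
∈-tabulate⁻ {p = p} {x} m = trans (sym (lookup∘tabulate p x)) ([]=⇒lookup m)

module _ {A : Set} {R : A → A → Set} (R-sym : ∀ {a b} → R a b → R b a) where

  Neighbours : A → Set
  Neighbours x = Σ A λ a → Σ A λ b → a ≢ b × R x a × R x b

  last-step : ∀ {v} y ys → Linked R (y ∷ ys ++ [ v ]) → Σ A λ l → l ∈ y ∷ ys × R l v
  last-step y []       (r ∷ _) = y , here refl , r
  last-step y (z ∷ zs) (_ ∷ c) = let l , m , r = last-step z zs c in l , there m , r

  -- The neighbours of the last inner node are its predecessor and `v`. The alternative in the
  -- hypothesis keeps them distinct: either the predecessor differs from `v` already or a further
  -- node follows.
  inner-neighbours : ∀ {v p x} ws → Unique (p ∷ ws) → All (v ≢_) ws → p ≢ v ⊎ 2 ≤ length ws →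
                     Linked R (p ∷ ws ++ [ v ]) → x ∈ ws → Neighbours x
  inner-neighbours (y ∷ []) _ _ (inj₁ p≢v) (r ∷ s ∷ _) (here refl) = _ , _ , p≢v , R-sym r , s
  inner-neighbours (y ∷ []) _ _ (inj₂ (s≤s ())) _ _
  inner-neighbours (y ∷ z ∷ zs) ((_ ∷ p≢z ∷ _) ∷ _) _ _ (r ∷ s ∷ _) (here refl) = _ , _ , p≢z , R-sym r , s
  inner-neighbours (y ∷ z ∷ zs) (_ ∷ u) (v≢y ∷ v∉) _ (_ ∷ c) (there m) =
    inner-neighbours (z ∷ zs) u v∉ (inj₁ (v≢y ∘ sym)) c m

  cycle-neighbours : ∀ {v x} vs → 2 ≤ length vs → Unique (v ∷ vs) → Linked R (v ∷ vs ++ [ v ]) → x ∈ v ∷ vs → Neighbours x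
  cycle-neighbours vs 2≤ u@(v∉ ∷ _) c (there m) = inner-neighbours vs u v∉ (inj₂ 2≤) c m
  cycle-neighbours (w ∷ y ∷ ys) _ (_ ∷ w∉ ∷ _) (r ∷ _ ∷ c) (here refl) =
    let l , m , s = last-step y ys c in w , l , All.lookup w∉ m , r , R-sym s
  cycle-neighbours (w ∷ []) (s≤s ()) _ _ _

avoiding : ∀ {A : Set} {R S : A → A → Set} {x} → (∀ {a b} → a ≢ x → b ≢ x → R a b → S a b) →
           ∀ {xs} → (∀ {a} → a ∈ xs → a ≢ x) → Linked R xs → Linked S xs
avoiding f out []      = []
avoiding f out [-]     = [-]
avoiding f out (r ∷ c) = f (out (here refl)) (out (there (here refl))) r ∷ avoiding f (out ∘ there) c

module Trees {n : ℕ} (G : Graph n) (W : Fin (Graph.m G) → ℕ) (k : ℕ) where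

  open Graph G using (m; src; tgt; simple)
  open Algorithm src tgt W k
  open Growth src tgt W k simple

  Link : Edges → Fin n → Fin n → Set
  Link F u v = Σ (Fin m) λ e → F e ≡ true × Joins e u v

  Joins-sym : ∀ {e u v} → Joins e u v → Joins e v u
  Joins-sym (inj₁ p) = inj₂ p
  Joins-sym (inj₂ p) = inj₁ p

  Link-sym : ∀ {F u v} → Link F u v → Link F v u
  Link-sym (e , Fe , j) = e , Fe , Joins-sym j

  Link-mono : ∀ {F F′ u v} → F ⊆ F′ → Link F u v → Link F′ u v
  Link-mono h (e , Fe , j) = e , h e Fe , j

  grown-connected : ∀ {r F z} → Grown r F → covers r F z ≡ true → Star (Link F) r z
  grown-connected root p with covers⁻ ∅ p
  ... | inj₁ refl = ε
  grown-connected {r} {z = z} (leaf {F} {e} g (u , v , j , u∈ , v∉)) p with covers⁻ (add e F) p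
  ... | inj₁ refl = ε
  ... | inj₂ (f , q , end) with add⁻ {e} {F} q
  ...   | inj₂ Ff = gmap id (Link-mono (add-⊇ e F)) (grown-connected g (covers-edge F Ff end))
  ...   | inj₁ refl = reach j end
    where
    to-u : Star (Link (add e F)) r u
    to-u = gmap id (Link-mono (add-⊇ e F)) (grown-connected g u∈)
    to-v : Star (Link (add e F)) r v
    to-v = to-u ◅◅ ((e , add-new e F , j) ◅ ε)
    reach : Joins e u v → src e ≡ z ⊎ tgt e ≡ z → Star (Link (add e F)) r z
    reach (inj₁ (refl , _)) (inj₁ refl) = to-u
    reach (inj₁ (_ , refl)) (inj₂ refl) = to-v
    reach (inj₂ (refl , _)) (inj₁ refl) = to-v
    reach (inj₂ (_ , refl)) (inj₂ refl) = to-u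

  link-covers : ∀ {r F u v} → Link F u v → covers r F u ≡ true
  link-covers {F = F} (e , Fe , inj₁ (p , _)) = covers-edge F Fe (inj₁ p)
  link-covers {F = F} (e , Fe , inj₂ (_ , p)) = covers-edge F Fe (inj₂ p)

  -- If the newest leaf lay on a cycle, it would have two distinct neighbours, but `u` is its only
  -- one. A cycle that avoids it lies in the older tree.
  grown-acyclic : ∀ {r F} → Grown r F → ∀ v vs → ¬ (2 ≤ length vs × Unique (v ∷ vs) × Linked (Link F) (v ∷ vs ++ [ v ]))
  grown-acyclic root v (w ∷ vs) (_ , _ , (_ , () , _) ∷ _)
  grown-acyclic {r} (leaf {F} {e} g (u , x , j , u∈ , x∉)) v vs (2≤ , unique , c) with _∈?_ Fin._≟_ x (v ∷ vs)
  ... | yes x∈ = let a , b , a≢b , xa , xb = cycle-neighbours Link-sym vs 2≤ unique c x∈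
                 in a≢b (trans (only xa) (sym (only xb)))
    where
    other : ∀ {y} → Joins e u x → Joins e x y → y ≡ u
    other (inj₁ (refl , refl)) (inj₁ (p , refl)) = sym p
    other (inj₁ (refl , refl)) (inj₂ (refl , _)) = refl
    other (inj₂ (refl , refl)) (inj₁ (_ , refl)) = refl
    other (inj₂ (refl , refl)) (inj₂ (refl , p)) = sym p
    only : ∀ {y} → Link (add e F) x y → y ≡ u
    only (f , q , i) with add⁻ {e} {F} q
    ... | inj₁ refl = other j i
    ... | inj₂ Ff   = contradiction (trans (sym x∉) (link-covers {r} (f , Ff , i))) λ ()
  ... | no x∉′ = grown-acyclic g v vs (2≤ , unique , avoiding old out c)
    where
    old : ∀ {a b} → a ≢ x → b ≢ x → Link (add e F) a b → Link F a b
    old a≢ b≢ (f , q , i) with add⁻ {e} {F} q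
    ... | inj₂ Ff = f , Ff , i
    ... | inj₁ refl = contradiction (end j i) λ { (inj₁ p) → a≢ p ; (inj₂ p) → b≢ p }
      where
      end : ∀ {a b} → Joins e u x → Joins e a b → a ≡ x ⊎ b ≡ x
      end (inj₁ (_ , refl)) (inj₁ (_ , p)) = inj₂ (sym p)
      end (inj₁ (_ , refl)) (inj₂ (_ , p)) = inj₁ (sym p)
      end (inj₂ (refl , _)) (inj₁ (p , _)) = inj₁ (sym p)
      end (inj₂ (refl , _)) (inj₂ (p , _)) = inj₂ (sym p)
    out : ∀ {a} → a ∈ v ∷ vs ++ [ v ] → a ≢ x
    out m refl = x∉′ (closing v vs m)
      where
      closing : ∀ {a} v vs → a ∈ v ∷ vs ++ [ v ] → a ∈ v ∷ vs
      closing v vs (here p)  = here p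
      closing v vs (there m) = go vs m
        where
        go : ∀ {a} ws → a ∈ ws ++ [ v ] → a ∈ v ∷ ws
        go []       (here p)  = here p
        go (w ∷ ws) (here p)  = there (here p)
        go (w ∷ ws) (there m) with go ws m
        ... | here p   = here p
        ... | there m′ = there (there m′)

  toSubgraph : Fin n → Edges → Subgraph G
  toSubgraph r F = record
    { nodes  = Vec.tabulate (covers r F)
    ; edges  = Vec.tabulate F
    ; closed = λ e e∈ → ∈-tabulate⁺ (covers-src F (∈-tabulate⁻ e∈)) , ∈-tabulate⁺ (covers-tgt F (∈-tabulate⁻ e∈)) }

  grown-isTree : ∀ {r F} → Grown r F → IsTree (toSubgraph r F)
  grown-isTree {r} {F} g = (r , ∈-tabulate⁺ (covers-root F)) , connected , λ v vs (2≤ , u , c) →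
    grown-acyclic g v vs (2≤ , u , Linked.map (λ (e , e∈ , j) → e , ∈-tabulate⁻ e∈ , j) c)
    where
    to : ∀ {v} → v Subset.∈ Vec.tabulate (covers r F) → Star (Link F) r v
    to v∈ = grown-connected g (∈-tabulate⁻ v∈)
    connected : Subgraph.Connected (toSubgraph r F)
    connected u v u∈ v∈ = gmap id (λ (e , Fe , j) → e , ∈-tabulate⁺ Fe , j) (reverse (Link-sym {F}) (to u∈) ◅◅ to v∈)

-- The program

card : Instance → ℕ
card = Instance.n

edgeCard : Instance → ℕ
edgeCard x = Graph.m (Instance.G x)

source target : ∀ x → Fin (edgeCard x) → Fin (card x)
source x = Graph.src (Instance.G x)
target x = Graph.tgt (Instance.G x)

numerator denominator : ∀ x → Fin (edgeCard x) → ℕ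
numerator   x e = ℤ.∣ ↥ Graph.weight (Instance.G x) e ∣
denominator x e = ↧ₙ Graph.weight (Instance.G x) e

sameEdge : ∀ x → Fin (edgeCard x) → Fin (edgeCard x) → Bool
sameEdge x e f = (source x e == source x f) ∧ (target x e == target x f)

-- The weight of e times the product of the denominators of all edges.
scaled : ∀ x → Fin (edgeCard x) → ℕ
scaled x e = foldr (λ f w → (if sameEdge x e f then 1 else denominator x f) * w) (numerator x e) (allFin (edgeCard x))

module A x = Algorithm (source x) (target x) (scaled x) (Instance.k x)

inputSize : Instance → ℕ
inputSize x = size (encodeInstance x)

open PolynomialTime inputSize (λ x → 1≤size (encodeInstance x))
open Ty using (enc) renaming (El to ⟨_⟩)
open Ob using (ty; sz; sz-poly; size-enc)

private
  nodesValue edgesValue : Instance → Value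
  nodesValue x = encodeList (tabulate {n = card x} (λ v → nat (toℕ v)))
  edgeValue : ∀ x → Fin (edgeCard x) → Value
  edgeValue x e = pair (pair (nat (toℕ (source x e))) (nat (toℕ (target x e)))) (encodeℚ (Graph.weight (Instance.G x) e))
  edgesValue x = encodeList (tabulate (edgeValue x))

  edgesValue≤inputSize : ∀ x → size (edgesValue x) ≤ inputSize x
  edgesValue≤inputSize x = m≤n⇒m≤1+n (≤-trans (m≤n⇒m≤1+n (m≤n+m _ (size (nodesValue x)))) (m≤n+m _ (bits (Instance.k x))))

  nodesValue≤inputSize : ∀ x → size (nodesValue x) ≤ inputSize x
  nodesValue≤inputSize x = m≤n⇒m≤1+n (≤-trans (m≤n⇒m≤1+n (m≤m+n _ (size (edgesValue x)))) (m≤n+m _ (bits (Instance.k x))))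

k≤inputSize : ∀ x → bits (Instance.k x) ≤ inputSize x
k≤inputSize x = m≤n⇒m≤1+n (m≤m+n _ _)

card≤inputSize : ∀ x → card x ≤ inputSize x
card≤inputSize x = ≤-trans (≤-reflexive (sym (length-tabulate (λ v → nat (toℕ v)))))
  (≤-trans (length≤size _) (nodesValue≤inputSize x))

edgeCard≤inputSize : ∀ x → edgeCard x ≤ inputSize x
edgeCard≤inputSize x = ≤-trans (≤-reflexive (sym (length-tabulate (edgeValue x))))
  (≤-trans (length≤size _) (edgesValue≤inputSize x))

toℕ≤inputSize : ∀ x (v : Fin (card x)) → bits (toℕ v) ≤ inputSize x
toℕ≤inputSize x v = ≤-trans (bits≤suc (toℕ v)) (≤-trans (toℕ<n v) (card≤inputSize x))

edgeValue≤inputSize : ∀ x e → size (edgeValue x e) ≤ inputSize x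
edgeValue≤inputSize x e = ≤-trans (element (edgeValue x) e) (edgesValue≤inputSize x)
  where
  element : ∀ {n} (f : Fin n → Value) i → size (f i) ≤ size (encodeList (tabulate f))
  element f Fin.zero    = m≤n⇒m≤1+n (m≤m+n _ _)
  element f (Fin.suc i) = m≤n⇒m≤1+n (≤-trans (element (f ∘ Fin.suc) i) (m≤n+m _ (size (f Fin.zero))))

private
  endpointsSize : ∀ x → Fin (edgeCard x) → ℕ
  endpointsSize x e = size (pair (nat (toℕ (source x e))) (nat (toℕ (target x e))))

numerator≤inputSize : ∀ x e → bits (numerator x e) ≤ inputSize x
numerator≤inputSize x e = ≤-trans (m≤n⇒m≤1+n (≤-trans (m≤n⇒m≤1+n (m≤m+n _ (bits (denominator x e)))) (m≤n+m _ (endpointsSize x e))))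
  (edgeValue≤inputSize x e)

denominator≤inputSize : ∀ x e → bits (denominator x e) ≤ inputSize x
denominator≤inputSize x e = ≤-trans (m≤n⇒m≤1+n (≤-trans (m≤n⇒m≤1+n (m≤n+m _ (bits (numerator x e)))) (m≤n+m _ (endpointsSize x e))))
  (edgeValue≤inputSize x e)

poly-card : Poly card
poly-card = poly-≤ card≤inputSize poly-N

poly-edgeCard : Poly edgeCard
poly-edgeCard = poly-≤ edgeCard≤inputSize poly-N

-- A numerator and one factor for each edge, all of at most `inputSize` bits; bit lengths add under
-- multiplication, so the common denominator does no harm.
scaledBits : Instance → ℕ
scaledBits x = edgeCard x * inputSize x + inputSize x

private
  product : ∀ x → Fin (edgeCard x) → List (Fin (edgeCard x)) → ℕ
  product x e = foldr (λ f w → (if sameEdge x e f then 1 else denominator x f) * w) (numerator x e)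

  bits-product : ∀ x e fs → bits (product x e fs) ≤ length fs * inputSize x + inputSize x
  bits-product x e []       = numerator≤inputSize x e
  bits-product x e (f ∷ fs) = ≤-trans (bits-* (if sameEdge x e f then 1 else denominator x f) (product x e fs))
    (≤-trans (+-mono-≤ factor (bits-product x e fs)) (≤-reflexive (sym (+-assoc (inputSize x) _ _))))
    where
    factor : bits (if sameEdge x e f then 1 else denominator x f) ≤ inputSize x
    factor with sameEdge x e f
    ... | true  = 1≤size (encodeInstance x)
    ... | false = denominator≤inputSize x f

  bits-product-tail : ∀ x e fs → fs IsTailOf allFin (edgeCard x) → bits (product x e fs) ≤ scaledBits x
  bits-product-tail x e fs t = ≤-trans (bits-product x e fs)
    (+-monoˡ-≤ (inputSize x) (*-monoˡ-≤ (inputSize x) (≤-trans (length-tail t) (≤-reflexive (length-allFin (edgeCard x))))))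

bits-scaled : ∀ x e → bits (scaled x e) ≤ scaledBits x
bits-scaled x e = bits-product-tail x e (allFin (edgeCard x)) here

poly-scaledBits : Poly scaledBits
poly-scaledBits = poly-+ (poly-* poly-edgeCard poly-N) poly-N

-- Encodings of the data of the algorithm

nodeᵒ rawEdgeᵒ edgeᵒ rawᵒ globalᵒ setᵒ tableᵒ rootedᵒ : Ob
nodeᵗ edgeᵗ setᵗ rawEdgeᵗ globalᵗ tableᵗ : Ty

⟨ nodeᵗ ⟩ x = Fin (card x)
enc nodeᵗ x v = nat (toℕ v)
ty nodeᵒ = nodeᵗ
sz nodeᵒ = inputSize
sz-poly nodeᵒ = poly-N
size-enc nodeᵒ = toℕ≤inputSize

⟨ rawEdgeᵗ ⟩ x = Fin (edgeCard x)
enc rawEdgeᵗ = edgeValue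
ty rawEdgeᵒ = rawEdgeᵗ
sz rawEdgeᵒ = inputSize
sz-poly rawEdgeᵒ = poly-N
size-enc rawEdgeᵒ = edgeValue≤inputSize

-- An edge carries its endpoints and its integer weight with it, whereas `rawEdgeᵗ` is the form
-- found in the input.
⟨ edgeᵗ ⟩ x = Fin (edgeCard x)
enc edgeᵗ x e = pair (pair (nat (toℕ (source x e))) (nat (toℕ (target x e)))) (nat (scaled x e))
ty edgeᵒ = edgeᵗ
sz edgeᵒ x = 1 + (1 + (inputSize x + inputSize x) + scaledBits x)
sz-poly edgeᵒ = poly-+ (poly-const 1) (poly-+ (poly-+ (poly-const 1) (poly-+ poly-N poly-N)) poly-scaledBits)
size-enc edgeᵒ x e = s≤s (+-mono-≤ (s≤s (+-mono-≤ (toℕ≤inputSize x (source x e)) (toℕ≤inputSize x (target x e)))) (bits-scaled x e))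

⟨ ty rawᵒ ⟩ _ = ⊤
enc (ty rawᵒ) x _ = encodeInstance x
sz rawᵒ = inputSize
sz-poly rawᵒ = poly-N
size-enc rawᵒ x _ = ≤-refl

private
  size-indexed : ∀ {n} {A : Set} (en : A → Value) {b} (f : Fin n → A) → (∀ a → size (en a) ≤ b) →
                 size (encodeList (map en (map f (allFin n)))) ≤ n * suc b + 1
  size-indexed {n} en {b} f h = ≤-trans (size-encodeList en _ h)
    (≤-reflexive (cong (λ l → l * suc b + 1) (trans (length-map f (allFin n)) (length-allFin n))))

  size-allFin : ∀ {n} (en : Fin n → Value) {b} → (∀ a → size (en a) ≤ b) →
                size (encodeList (map en (allFin n))) ≤ n * suc b + 1
  size-allFin {n} en {b} h = ≤-trans (size-encodeList en _ h) (≤-reflexive (cong (λ l → l * suc b + 1) (length-allFin n)))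

-- The preprocessed instance. Like `rawᵒ` it has one element for each instance, so that a map out of
-- it computes a quantity of the instance alone.
⟨ globalᵗ ⟩ _ = ⊤
enc globalᵗ x _ = enc (natᵗ ×ᵗ (listᵗ nodeᵗ ×ᵗ listᵗ edgeᵗ)) x (Instance.k x , allFin _ , allFin _)
ty globalᵒ = globalᵗ
sz globalᵒ x = 1 + (inputSize x + (1 + ((card x * suc (inputSize x) + 1) + (edgeCard x * suc (sz edgeᵒ x) + 1))))
sz-poly globalᵒ = poly-+ (poly-const 1) (poly-+ poly-N (poly-+ (poly-const 1) (poly-+
  (poly-+ (poly-* poly-card (poly-+ (poly-const 1) poly-N)) (poly-const 1))
  (poly-+ (poly-* poly-edgeCard (poly-+ (poly-const 1) (sz-poly edgeᵒ))) (poly-const 1)))))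
size-enc globalᵒ x _ = s≤s (+-mono-≤ (k≤inputSize x) (s≤s (+-mono-≤ (size-allFin _ (toℕ≤inputSize x)) (size-allFin _ (size-enc edgeᵒ x)))))

⟨ setᵗ ⟩ x = Fin (edgeCard x) → Bool
enc setᵗ x F = enc (listᵗ (ty (edgeᵒ ⊗ boolᵒ))) x (graphOf F)
ty setᵒ = setᵗ
sz setᵒ x = edgeCard x * suc (sz (edgeᵒ ⊗ boolᵒ) x) + 1
sz-poly setᵒ = poly-+ (poly-* poly-edgeCard (poly-+ (poly-const 1) (sz-poly (edgeᵒ ⊗ boolᵒ)))) (poly-const 1)
size-enc setᵒ x F = size-indexed _ _ (size-enc (edgeᵒ ⊗ boolᵒ) x)

⟨ tableᵗ ⟩ x = Fin (card x) → Fin (edgeCard x) → Bool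
enc tableᵗ x T = enc (listᵗ (ty (nodeᵒ ⊗ setᵒ))) x (graphOf T)
ty tableᵒ = tableᵗ
sz tableᵒ x = card x * suc (sz (nodeᵒ ⊗ setᵒ) x) + 1
sz-poly tableᵒ = poly-+ (poly-* poly-card (poly-+ (poly-const 1) (sz-poly (nodeᵒ ⊗ setᵒ)))) (poly-const 1)
size-enc tableᵒ x T = size-indexed _ _ (size-enc (nodeᵒ ⊗ setᵒ) x)

rootedᵒ = nodeᵒ ⊗ setᵒ

-- The algorithm as a polynomial-time map

private
  variable
    Γ : Ob

edge-fields : ∀ {e} → Hom Γ edgeᵗ e →
  Hom Γ ((natᵗ ×ᵗ natᵗ) ×ᵗ natᵗ) (λ x a → (toℕ (source x (e x a)) , toℕ (target x (e x a))) , scaled x (e x a))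
edge-fields = recode (λ _ _ → refl)

sourceʰ : ∀ {e} → Hom Γ edgeᵗ e → Hom Γ nodeᵗ (λ x a → source x (e x a))
sourceʰ E = recode (λ _ _ → refl) (fstʰ (fstʰ (edge-fields E)))

targetʰ : ∀ {e} → Hom Γ edgeᵗ e → Hom Γ nodeᵗ (λ x a → target x (e x a))
targetʰ E = recode (λ _ _ → refl) (sndʰ (fstʰ (edge-fields E)))

scaledʰ : ∀ {e} → Hom Γ edgeᵗ e → Hom Γ natᵗ (λ x a → scaled x (e x a))
scaledʰ E = sndʰ (edge-fields E)

toℕʰ : ∀ {u} → Hom Γ nodeᵗ u → Hom Γ natᵗ (λ x a → toℕ (u x a))
toℕʰ = recode (λ _ _ → refl)

_==ʰ_ : ∀ {u v} → Hom Γ nodeᵗ u → Hom Γ nodeᵗ v → Hom Γ boolᵗ (λ x a → u x a == v x a)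
U ==ʰ V = toℕʰ U ≡ʰ toℕʰ V

members : ∀ {F} → Hom Γ setᵗ F → Hom Γ (listᵗ (ty (edgeᵒ ⊗ boolᵒ))) (λ x a → graphOf (F x a))
members = recode (λ _ _ → refl)

rows : ∀ {T} → Hom Γ tableᵗ T → Hom Γ (listᵗ (ty (nodeᵒ ⊗ setᵒ))) (λ x a → graphOf (T x a))
rows = recode (λ _ _ → refl)

global-fields : ∀ {g} → Hom Γ globalᵗ g →
  Hom Γ (natᵗ ×ᵗ (listᵗ nodeᵗ ×ᵗ listᵗ edgeᵗ)) (λ x a → Instance.k x , allFin (card x) , allFin (edgeCard x))
global-fields = recode (λ _ _ → refl)

kʰ : ∀ {g} → Hom Γ globalᵗ g → Hom Γ natᵗ (λ x a → Instance.k x)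
kʰ G = fstʰ (global-fields G)

nodesʰ : ∀ {g} → Hom Γ globalᵗ g → Hom Γ (listᵗ nodeᵗ) (λ x a → allFin (card x))
nodesʰ G = fstʰ (sndʰ (global-fields G))

edgesʰ : ∀ {g} → Hom Γ globalᵗ g → Hom Γ (listᵗ edgeᵗ) (λ x a → allFin (edgeCard x))
edgesʰ G = sndʰ (sndʰ (global-fields G))

joinsʰ : ∀ {e u v} → Hom Γ edgeᵗ e → Hom Γ nodeᵗ u → Hom Γ nodeᵗ v →
         Hom Γ boolᵗ (λ x a → A.joins x (e x a) (u x a) (v x a))
joinsʰ E U V = ((sourceʰ E ==ʰ U) ∧ʰ (targetʰ E ==ʰ V)) ∨ʰ ((sourceʰ E ==ʰ V) ∧ʰ (targetʰ E ==ʰ U))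

touchesʰ : ∀ {e u} → Hom Γ edgeᵗ e → Hom Γ nodeᵗ u → Hom Γ boolᵗ (λ x a → A.touches x (e x a) (u x a))
touchesʰ E U = (sourceʰ E ==ʰ U) ∨ʰ (targetʰ E ==ʰ U)

≈ʰ : ∀ {e f} → Hom Γ edgeᵗ e → Hom Γ edgeᵗ f → Hom Γ boolᵗ (λ x a → A._≈_ x (e x a) (f x a))
≈ʰ E F = (sourceʰ E ==ʰ sourceʰ F) ∧ʰ (targetʰ E ==ʰ targetʰ F)

coversʰ : ∀ {r F u} → Hom Γ nodeᵗ r → Hom Γ setᵗ F → Hom Γ nodeᵗ u →
          Hom Γ boolᵗ (λ x a → A.covers x (r x a) (F x a) (u x a))
coversʰ R F U = foldᵒ {X = edgeᵒ ⊗ boolᵒ} {S = boolᵒ} (members F) (U ==ʰ R)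
  ((wk (sndʰ top) ∧ʰ touchesʰ (wk (fstʰ top)) (wk (wk U))) ∨ʰ top)

countʰ : ∀ {g r F} → Hom Γ globalᵗ g → Hom Γ nodeᵗ r → Hom Γ setᵗ F → Hom Γ natᵗ (λ x a → A.count x (r x a) (F x a))
countʰ {r = r} {F} G R S = foldʰ {X = nodeᵒ} {S = natᵗ} (poly-+ (poly-const 1) poly-card)
  (λ x a vs t → ≤-trans (bits≤suc _) (s≤s (≤-trans (weigh-1≤length (A.covers x (r x a) (F x a)) vs)
    (≤-trans (length-tail t) (≤-reflexive (length-allFin (card x)))))))
  (nodesʰ G) (litʰ 0) (ifʰ (coversʰ (wk (wk R)) (wk (wk S)) (wk top)) (opʰ plus (litʰ 1) acc) acc)

wtʰ : ∀ {F} → Hom Γ setᵗ F → Hom Γ natᵗ (λ x a → A.wt x (F x a))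
wtʰ {F = F} S = foldʰ {X = edgeᵒ ⊗ boolᵒ} {S = natᵗ} (poly-+ (poly-* poly-edgeCard poly-scaledBits) (poly-const 1))
  (λ x a ps t → ≤-trans (bits-sum x ps) (+-monoˡ-≤ 1 (*-monoˡ-≤ (scaledBits x)
    (≤-trans (length-tail t) (≤-reflexive (trans (length-map _ (allFin (edgeCard x))) (length-allFin (edgeCard x))))))))
  (members S) (litʰ 0) (ifʰ (wk (sndʰ top)) (opʰ plus (scaledʰ (wk (fstʰ top))) acc) acc)
  where
  bits-sum : ∀ x (ps : List (Fin (edgeCard x) × Bool)) →
    bits (foldr (λ p w → if proj₂ p then scaled x (proj₁ p) + w else w) 0 ps) ≤ length ps * scaledBits x + 1
  bits-sum x [] = ≤-refl
  bits-sum x ((e , true) ∷ ps) = ≤-trans (bits-+ (scaled x e) _)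
    (≤-trans (+-mono-≤ (bits-scaled x e) (bits-sum x ps)) (≤-reflexive (sym (+-assoc (scaledBits x) _ 1))))
  bits-sum x ((e , false) ∷ ps) = ≤-trans (bits-sum x ps) (+-monoˡ-≤ 1 (m≤n+m _ (scaledBits x)))

map-graphOf : ∀ {n} {B C : Set} (h : Fin n → B → C) (f : Fin n → B) →
              map (λ p → proj₁ p , h (proj₁ p) (proj₂ p)) (graphOf f) ≡ graphOf (λ i → h i (f i))
map-graphOf h f = sym (map-∘ (allFin _))

private
  fromMembers : ∀ {F} → Hom Γ (listᵗ (ty (edgeᵒ ⊗ boolᵒ))) (λ x a → graphOf (F x a)) → Hom Γ setᵗ F
  fromMembers = recode (λ _ _ → refl)

  fromRows : ∀ {T} → Hom Γ (listᵗ (ty (nodeᵒ ⊗ setᵒ))) (λ x a → graphOf (T x a)) → Hom Γ tableᵗ T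
  fromRows = recode (λ _ _ → refl)

addʰ : ∀ {e F} → Hom Γ edgeᵗ e → Hom Γ setᵗ F → Hom Γ setᵗ (λ x a → A.add x (e x a) (F x a))
addʰ E S = fromMembers (ext (λ x a → map-graphOf _ _)
  (mapʰ {X = edgeᵒ ⊗ boolᵒ} (members S) (fstʰ top ,ʰ (≈ʰ (wk E) (fstʰ top) ∨ʰ sndʰ top))))

∅ʰ : ∀ {g} → Hom Γ globalᵗ g → Hom Γ setᵗ (λ x a → A.∅ x)
∅ʰ G = fromMembers (mapʰ {X = edgeᵒ} (edgesʰ G) (top ,ʰ falseʰ))

addableʰ : ∀ {g r δ p F} → Hom Γ globalᵗ g → Hom Γ nodeᵗ r → Hom Γ natᵗ δ → Hom Γ (ty (edgeᵒ ⊗ boolᵒ)) p → Hom Γ setᵗ F →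
           Hom Γ boolᵗ (λ x a → A.addable x (r x a) (δ x a) (p x a) (F x a))
addableʰ G R Δ P S = (sndʰ P ∨ʰ notʰ (Δ <ʰ scaledʰ (fstʰ P))) ∧ʰ
  ((coversʰ R S (sourceʰ (fstʰ P)) xorʰ coversʰ R S (targetʰ (fstʰ P))) ∧ʰ (countʰ G R S <ʰ kʰ G))

growʰ : ∀ {g r δ P F} → Hom Γ globalᵗ g → Hom Γ nodeᵗ r → Hom Γ natᵗ δ → Hom Γ setᵗ P → Hom Γ setᵗ F →
        Hom Γ setᵗ (λ x a → A.grow x (r x a) (δ x a) (P x a) (F x a))
growʰ G R Δ P S = foldᵒ {X = nodeᵒ} {S = setᵒ} (nodesʰ G) S
  (foldᵒ {X = edgeᵒ ⊗ boolᵒ} {S = setᵒ} (members (wk (wk P))) top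
    (ifʰ (addableʰ (up G) (up R) (up Δ) (wk top) top) (addʰ (fstʰ (wk top)) top) top))
  where
  up : ∀ {X Y Z V B f} → Hom Γ B f → Hom ((((Γ ⊗ X) ⊗ Y) ⊗ Z) ⊗ V) B _
  up H = wk (wk (wk (wk H)))

relaxʰ : ∀ {g T} → Hom Γ globalᵗ g → Hom Γ tableᵗ T → Hom Γ tableᵗ (λ x a → A.relax x (T x a))
relaxʰ G T = fromRows (ext (λ x a → map-graphOf _ _)
  (mapʰ {X = nodeᵒ ⊗ setᵒ} (rows T) (fstʰ top ,ʰ
    foldᵒ {X = nodeᵒ ⊗ setᵒ} {S = setᵒ} (rows (wk T)) (sndʰ top)
      (foldᵒ {X = edgeᵒ} {S = setᵒ} (edgesʰ (wk (wk (wk G)))) top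
        -- From the inside out, the context holds the current set, the edge, the set before this
        -- row, the row of `u` and the row of `v`.
        (ifʰ (joinsʰ (wk top) (fstʰ (wk (wk (wk top)))) (fstʰ (wk (wk (wk (wk top))))) ∧ʰ
              (wtʰ (addʰ (wk top) (sndʰ (wk (wk (wk top))))) <ʰ wtʰ top))
             (addʰ (wk top) (sndʰ (wk (wk (wk top))))) top)))))

pathsʰ : ∀ {g r} → Hom Γ globalᵗ g → Hom Γ nodeᵗ r → Hom Γ tableᵗ (λ x a → A.paths x (r x a))
pathsʰ G R = foldᵒ {X = nodeᵒ} {S = tableᵒ} (nodesʰ G)
  (fromRows (mapʰ {X = nodeᵒ} (nodesʰ G) (top ,ʰ
    fromMembers (mapʰ {X = edgeᵒ} (edgesʰ (wk G)) (top ,ʰ notʰ (wk top ==ʰ wk (wk R)))))))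
  (relaxʰ (wk (wk G)) top)

enlargeʰ : ∀ {g r δ D T F} → Hom Γ globalᵗ g → Hom Γ nodeᵗ r → Hom Γ natᵗ δ → Hom Γ setᵗ D → Hom Γ tableᵗ T → Hom Γ setᵗ F →
           Hom Γ setᵗ (λ x a → A.enlarge x (r x a) (δ x a) (D x a) (T x a) (F x a))
enlargeʰ {Γ = Γ} G R Δ D T S = foldᵒ {X = nodeᵒ ⊗ setᵒ} {S = setᵒ} (rows T) S
  (ifʰ (notʰ (wtʰ (wk (wk D)) <ʰ wtʰ (sndʰ (wk top))) ∧ʰ
        (countʰ (wk (wk G)) (wk (wk R)) top <ʰ countʰ (wk (wk G)) (wk (wk R)) larger))
       larger top)
  where larger = growʰ (wk (wk G)) (wk (wk R)) (wk (wk Δ)) (sndʰ (wk top)) (wk (wk S))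

greedyʰ : ∀ {g r δ D T} → Hom Γ globalᵗ g → Hom Γ nodeᵗ r → Hom Γ natᵗ δ → Hom Γ setᵗ D → Hom Γ tableᵗ T →
          Hom Γ setᵗ (λ x a → A.greedy x (r x a) (δ x a) (D x a) (T x a))
greedyʰ G R Δ D T = foldᵒ {X = nodeᵒ} {S = setᵒ} (nodesʰ G) (growʰ G R Δ (∅ʰ G) (∅ʰ G))
  (enlargeʰ (wk (wk G)) (wk (wk R)) (wk (wk Δ)) (wk (wk D)) (wk (wk T)) top)

pickʰ : ∀ {g C B} → Hom Γ globalᵗ g → Hom Γ (ty rootedᵒ) C → Hom Γ (ty rootedᵒ) B →
        Hom Γ (ty rootedᵒ) (λ x a → A.pick x (C x a) (B x a))
pickʰ G C B = ifʰ (notʰ (countʰ G (fstʰ C) (sndʰ C) <ʰ kʰ G) ∧ʰ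
    ((countʰ G (fstʰ B) (sndʰ B) <ʰ kʰ G) ∨ʰ (wtʰ (sndʰ C) <ʰ wtʰ (sndʰ B))))
  C B

attemptʰ : ∀ {g r T D δ B} → Hom Γ globalᵗ g → Hom Γ nodeᵗ r → Hom Γ tableᵗ T → Hom Γ setᵗ D → Hom Γ natᵗ δ → Hom Γ (ty rootedᵒ) B →
           Hom Γ (ty rootedᵒ) (λ x a → A.attempt x (r x a) (T x a) (D x a) (δ x a) (B x a))
attemptʰ G R T D Δ B = pickʰ G (R ,ʰ greedyʰ G R Δ D T) B

searchδʰ : ∀ {g r T D B} → Hom Γ globalᵗ g → Hom Γ nodeᵗ r → Hom Γ tableᵗ T → Hom Γ setᵗ D → Hom Γ (ty rootedᵒ) B →
           Hom Γ (ty rootedᵒ) (λ x a → A.searchδ x (r x a) (T x a) (D x a) (B x a))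
searchδʰ G R T D B = foldᵒ {X = edgeᵒ} {S = rootedᵒ} (edgesʰ G) (attemptʰ G R T D (litʰ 0) B)
  (attemptʰ (wk (wk G)) (wk (wk R)) (wk (wk T)) (wk (wk D)) (scaledʰ (wk top)) top)

searchDʰ : ∀ {g r T B} → Hom Γ globalᵗ g → Hom Γ nodeᵗ r → Hom Γ tableᵗ T → Hom Γ (ty rootedᵒ) B →
           Hom Γ (ty rootedᵒ) (λ x a → A.searchD x (r x a) (T x a) (B x a))
searchDʰ G R T B = foldᵒ {X = nodeᵒ ⊗ setᵒ} {S = rootedᵒ} (rows T) B
  (searchδʰ (wk (wk G)) (wk (wk R)) (wk (wk T)) (sndʰ (wk top)) top)

firstNode : ∀ x → Fin (card x)
firstNode x = fromℕ< (≤-trans (Instance.1≤k x) (Instance.k≤n x))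

searchʰ : ∀ {g} → Hom Γ globalᵗ g → Hom Γ (ty rootedᵒ) (λ x a → A.search x (firstNode x))
searchʰ G = foldᵒ {X = nodeᵒ} {S = rootedᵒ} (nodesʰ G)
  -- The first node is encoded by the number 0 in every instance, so a literal produces it.
  (recode (λ x a → cong nat (sym (toℕ-fromℕ< (≤-trans (Instance.1≤k x) (Instance.k≤n x))))) (litʰ 0) ,ʰ ∅ʰ G)
  (searchDʰ (wk (wk G)) (wk top) (pathsʰ (wk (wk G)) (wk top)) top)

private
  raw-edge-fields : ∀ {e} → Hom Γ rawEdgeᵗ e → Hom Γ ((natᵗ ×ᵗ natᵗ) ×ᵗ (natᵗ ×ᵗ natᵗ))
    (λ x a → (toℕ (source x (e x a)) , toℕ (target x (e x a))) , (numerator x (e x a) , denominator x (e x a)))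
  raw-edge-fields = recode (λ _ _ → refl)

  raw-sameʰ : ∀ {e f} → Hom Γ rawEdgeᵗ e → Hom Γ rawEdgeᵗ f → Hom Γ boolᵗ (λ x a → sameEdge x (e x a) (f x a))
  raw-sameʰ E F = (fstʰ (fstʰ (raw-edge-fields E)) ≡ʰ fstʰ (fstʰ (raw-edge-fields F))) ∧ʰ
                  (sndʰ (fstʰ (raw-edge-fields E)) ≡ʰ sndʰ (fstʰ (raw-edge-fields F)))

  raw-fields : Hom rawᵒ (natᵗ ×ᵗ (listᵗ nodeᵗ ×ᵗ listᵗ rawEdgeᵗ)) (λ x a → Instance.k x , allFin (card x) , allFin (edgeCard x))
  raw-fields = recode (λ x a → cong₂ (λ vs es → pair (nat (Instance.k x)) (pair (encodeList vs) (encodeList es)))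
    (sym (map-tabulate id (enc nodeᵗ x))) (sym (map-tabulate id (edgeValue x)))) idʰ

scaleʰ : ∀ {e} → Hom Γ (listᵗ rawEdgeᵗ) (λ x a → allFin (edgeCard x)) → Hom Γ rawEdgeᵗ e → Hom Γ natᵗ (λ x a → scaled x (e x a))
scaleʰ {e = e} L E = foldʰ {X = rawEdgeᵒ} {S = natᵗ} poly-scaledBits (λ x a fs t → bits-product-tail x (e x a) fs t)
  L (fstʰ (sndʰ (raw-edge-fields E)))
  (opʰ times (ifʰ (raw-sameʰ (wk (wk E)) (wk top)) (litʰ 1) (sndʰ (sndʰ (raw-edge-fields (wk top))))) acc)

globalʰ : Hom rawᵒ globalᵗ (λ x a → tt)
globalʰ = recode (λ x a → refl) (fstʰ raw-fields ,ʰ (fstʰ (sndʰ raw-fields) ,ʰ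
  -- On values this map is the identity; its effect is to re-encode each edge with its scaled
  -- weight.
  ext (λ x a → map-id (allFin (edgeCard x))) (mapʰ {X = rawEdgeᵒ} {B = edgeᵗ} (sndʰ (sndʰ raw-fields))
    (recode (λ x a → refl) (fstʰ (raw-edge-fields top) ,ʰ scaleʰ (wk (sndʰ (sndʰ raw-fields))) top)))))

outputᵗ : Ty
outputᵗ = listᵗ boolᵗ ×ᵗ listᵗ boolᵗ

-- The search is run again for every node, which costs only a polynomial factor.
outputʰ : Hom globalᵒ outputᵗ (λ x a → map (A.covers x (proj₁ (A.search x (firstNode x))) (proj₂ (A.search x (firstNode x)))) (allFin (card x)) ,
                                       map (proj₂ (A.search x (firstNode x))) (allFin (edgeCard x)))
outputʰ = mapʰ {X = nodeᵒ} (nodesʰ idʰ) (coversʰ (wk (fstʰ (searchʰ idʰ))) (wk (sndʰ (searchʰ idʰ))) top) ,ʰ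
  ext (λ x a → sym (map-∘ (allFin (edgeCard x)))) (mapʰ {X = edgeᵒ ⊗ boolᵒ} (members (sndʰ (searchʰ idʰ))) (sndʰ top))

solutionʰ : Hom rawᵒ outputᵗ (λ x a → map (A.covers x (proj₁ (A.search x (firstNode x))) (proj₂ (A.search x (firstNode x)))) (allFin (card x)) ,
                                      map (proj₂ (A.search x (firstNode x))) (allFin (edgeCard x)))
solutionʰ = globalʰ ∙ outputʰ

encodeList-subset : ∀ {n} (p : Fin n → Bool) → encodeList (map encodeBool (map p (allFin n))) ≡ encodeSubset (Vec.tabulate p)
encodeList-subset p = cong (encodeList ∘ map encodeBool) (trans (map-tabulate id p) (sym (toList-tabulate p)))
  where
  toList-tabulate : ∀ {n} (p : Fin n → Bool) → Vec.toList (Vec.tabulate p) ≡ tabulate p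
  toList-tabulate {zero}  p = refl
  toList-tabulate {suc n} p = cong (p Fin.zero ∷_) (toList-tabulate (p ∘ Fin.suc))

searchedTree : ∀ x → Subset (card x) × Subset (edgeCard x)
searchedTree x = let r , F = A.search x (firstNode x) in Vec.tabulate (A.covers x r F) , Vec.tabulate F

hom-solvable : ∀ {B f} → Hom rawᵒ B f → {Correct : Instance → Value → Set} →
  (∀ x → Correct x (enc B x (f x tt))) → PolynomialTimeSolvable encodeInstance Correct
hom-solvable {B} {f} H correct = program (code H) , coefficient total , degree total , λ x →
  let t , r , t≤ = computes-program (run H x tt)
  in enc B x (f x tt) , t , r , ≤-trans (+-mono-≤ t≤ (small H x tt)) (bound total x) , correct x
  where total = poly-+ (cost-poly H) (cost-poly H)

solvable : ∀ {Correct : Instance → Value → Set} →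
  (∀ x → Correct x (pair (encodeSubset (proj₁ (searchedTree x))) (encodeSubset (proj₂ (searchedTree x))))) →
  PolynomialTimeSolvable encodeInstance Correct
solvable {Correct} correct = hom-solvable solutionʰ λ x → subst (Correct x) (sym (cong₂ pair
  (encodeList-subset (A.covers x (proj₁ (A.search x (firstNode x))) (proj₂ (A.search x (firstNode x)))))
  (encodeList-subset (proj₂ (A.search x (firstNode x)))))) (correct x)

-- Correctness of the computed subgraph

module _ (x : Instance) where

  open Instance x
  open Graph G using (m; src; tgt; weight; simple; nonneg)
  open Algorithm src tgt (scaled x) k
  open Growth src tgt (scaled x) k simple
  open Approximation src tgt (scaled x) k simple
  open Trees G (scaled x) k

  commonDenominator : ℕ
  commonDenominator = prod (denominator x) (allFin m)

  weight-scaled : ∀ e → weight e ℚ.* ι commonDenominator ≡ ι (scaled x e)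
  weight-scaled e = scaled-weight (weight e) commonDenominator (scaled x e) (nonneg e)
    (others-∈ (denominator x) (e ≈_) e (≈-refl e) (λ f p → sym (≈⇒≡ p)) (numerator x e) (allFin⁺ m) (∈-allFin e))

  totalWeight-scaled : ∀ (S : Subgraph G) (F : Edges) → (∀ e → Vec.lookup (edges S) e ≡ F e) →
                       totalWeight S ℚ.* ι commonDenominator ≡ ι (wt F)
  totalWeight-scaled S F h = trans (scaled-sum weight (scaled x) commonDenominator weight-scaled (Vec.lookup (edges S)))
    (cong ι (trans (weigh-cong (scaled x) h (allFin m)) (sym (wt≡weigh F))))

  found : Rooted
  found = search (firstNode x)

  foundTree : Subgraph G
  foundTree = toSubgraph (proj₁ found) (proj₂ found)

  foundTree-approximates : (T* : Subgraph G) → TreeSpanning k T* →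
    IsTree foundTree × k ≤ ∣ nodes foundTree ∣ × totalWeight foundTree ≤[ 2 √ k ] totalWeight T*
  foundTree-approximates T* (((r , r∈) , connected , _) , size≡k) =
    grown-isTree (search-Grown (firstNode x)) ,
    ≤-trans (proj₁ approx) (≤-reflexive (sym (trans (size≡weigh (nodes foundTree))
      (weigh-cong (λ _ → 1) (lookup∘tabulate (covers (proj₁ found) (proj₂ found))) (allFin n))))) ,
    unscale {totalWeight foundTree} {totalWeight T*} {wt (proj₂ found)} {wt (Vec.lookup (edges T*))} commonDenominator 2 k
      {{prod-nonZero (denominator x) (λ _ → _) (allFin m)}}
      (totalWeight-scaled foundTree (proj₂ found) (lookup∘tabulate (proj₂ found)))
      (totalWeight-scaled T* (Vec.lookup (edges T*)) (λ _ → refl))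
      (proj₂ approx)
    where
    walk : ∀ z → Vec.lookup (nodes T*) z ≡ true → Star (λ u v → Σ (Fin m) λ e → Vec.lookup (edges T*) e ≡ true × Joins e u v) r z
    walk z p = gmap id (λ (e , e∈ , j) → e , []=⇒lookup e∈ , j) (connected r z r∈ (lookup⇒[]= z (nodes T*) p))
    approx = search-approximates (Vec.lookup (nodes T*)) (Vec.lookup (edges T*)) r (firstNode x) walk
      (trans (sym (size≡weigh (nodes T*))) size≡k) 1≤k k≤n

theorem1p2 : PolynomialTimeSolvable encodeInstance
    (λ x output → let open Instance x in
    (T* : Subgraph G) → MinimumWeightTreeSpanning k T* →
    Σ (Subgraph G) λ T →
    output ≡ encodeSubgraph T ×
    IsTree T ×
    k ≤ ∣ nodes T ∣ ×
    totalWeight T ≤[ 2 √ k ] totalWeight T*)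
theorem1p2 = solvable λ x T* (spanning , _) → foundTree x , refl , foundTree-approximates x T* spanning
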